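{- Let $q$ be an odd prime power, $d\ge 0$, and let $(\mathbb F_q^{2d},\omega)$ be a symplectic space. Then $$\sum_{F\in\mathcal{WF}(\mathbb F_q^{2d},\omega)}t^{w(F)}=M_d^{\pm}\prod_{j=1}^d\frac{1}{1-t^j},\qquad M_d^\pm=\sum_{\sigma\in\mathcal S_d^{\pm}}q^{l^\pm(\sigma)}t^{\mathrm{Wmaj}(\sigma)}.$$
   Context: A subspace $L$ of the symplectic space (a $2d$-dimensional vector space with a non-degenerate alternating bilinear form $\omega$) is isotropic if $\omega$ vanishes on $L\times L$. A flag of $(\mathbb F_q^{2d},\omega)$ is a strictly increasing sequence $V_1\subset\dots\subset V_k$ ($k\ge0$) of nonzero isotropic subspaces; a weighted flag additionally carries strictly positive integers $w_1,\dots,w_k$ and has weight $w(F)=\sum_i w_i\dim V_i$; $\mathcal{WF}(\mathbb F_q^{2d},\omega)$ is the set of weighted flags. $\mathcal S_d^\pm$ is the group of permutations $\sigma$ of $\{\pm1,\dots,\pm d\}$ with $\sigma(-i)=-\sigma(i)$. For $\sigma\in\mathcal S_d^\pm$: $l^\pm(\sigma)=\#\{0<i<j\le d:\sigma(i)\sigma(j)(\sigma(i)-\sigma(j))>0\}+\sum_{1\le i\le d,\sigma(i)<0}(d+1+\sigma(i))$, and $\mathrm{Wmaj}(\sigma)=\sum_{1\le i<d,\ \sigma(i)>\sigma(i+1)}i+\#\{1\le i\le d:\sigma(i)<0\}$ (with the usual order on integers). -}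

module Defs where

open import Level using (0ℓ)
open import Data.Nat as ℕ using (ℕ; zero; suc; _∸_; _^_)
open import Data.Nat.Primality using (Prime)
open import Data.Nat.Divisibility using (_∣_; _∣?_)
open import Data.Fin as Fin using (Fin; toℕ; cast)
open import Data.Bool using (Bool; true; false; if_then_else_; _∧_; not)
open import Data.Product using (Σ; ∃; _×_; _,_; proj₁; proj₂)
open import Data.Nat.ListAction using (sum)
open import Data.List using (List; []; _∷_; map; length; filter; concatMap; upTo; allFin)
open import Relation.Binary.PropositionalEquality using (_≡_; _≢_)
open import Relation.Nullary using (¬_)
open import Relation.Nullary.Decidable using (⌊_⌋)
open import Algebra.Structures using (IsCommutativeRing)
open import Data.Integer as ℤ using (ℤ; +_)
import Data.Bool.Properties as BP
import Data.Integer.Properties as ℤP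

IsPrimePower : ℕ → Set
IsPrimePower q = Σ ℕ λ p → Σ ℕ λ k → Prime p × q ≡ p ^ suc k

record Field : Set₁ where
  field
    Carrier : Set
    _+_ _*_ : Carrier → Carrier → Carrier
    -_      : Carrier → Carrier
    0# 1#   : Carrier
    isCommutativeRing : IsCommutativeRing _≡_ _+_ _*_ -_ 0# 1#
    0≢1     : 0# ≢ 1#
    inverse : ∀ x → x ≢ 0# → Σ Carrier λ y → (x * y) ≡ 1#

HasCount : (A : Set) → (A → A → Set) → ℕ → Set
HasCount A _≈_ N =
  Σ (Fin N → A) λ e → (∀ i j → e i ≈ e j → i ≡ j) × (∀ a → Σ (Fin N) λ i → e i ≈ a)

module LinAlg (K : Field) where
  open Field K

  ∑ : ∀ {m} → (Fin m → Carrier) → Carrier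
  ∑ {zero}  f = 0#
  ∑ {suc m} f = f Fin.zero + ∑ (λ i → f (Fin.suc i))

  Vect : ℕ → Set
  Vect N = Fin N → Carrier

  _≗V_ : ∀ {N} → Vect N → Vect N → Set
  u ≗V v = ∀ i → u i ≡ v i

  0V : ∀ {N} → Vect N
  0V _ = 0#

  _+V_ : ∀ {N} → Vect N → Vect N → Vect N
  (u +V v) i = u i + v i

  _·V_ : ∀ {N} → Carrier → Vect N → Vect N
  (a ·V v) i = a * v i

  lincomb : ∀ {N m} → (Fin m → Carrier) → (Fin m → Vect N) → Vect N
  lincomb c b j = ∑ (λ i → c i * b i j)

  LinIndep : ∀ {N m} → (Fin m → Vect N) → Set
  LinIndep b = ∀ c → lincomb c b ≗V 0V → ∀ i → c i ≡ 0#

  -- a bilinear form on K^N, given by its Gram matrix B: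
  -- ω(u,v) = Σ_i Σ_j u_i B_ij v_j
  Form : ℕ → Set
  Form N = Fin N → Fin N → Carrier

  ev : ∀ {N} → Form N → Vect N → Vect N → Carrier
  ev B u v = ∑ (λ i → ∑ (λ j → u i * (B i j * v j)))

  Alternating : ∀ {N} → Form N → Set
  Alternating B = ∀ v → ev B v v ≡ 0#

  NonDegenerate : ∀ {N} → Form N → Set
  NonDegenerate B = ∀ u → (∀ v → ev B u v ≡ 0#) → u ≗V 0V

  record Subspace (N : ℕ) : Set where
    field
      mem      : Vect N → Bool
      mem-resp : ∀ u v → u ≗V v → mem u ≡ mem v
      mem-0    : mem 0V ≡ true
      mem-+    : ∀ u v → mem u ≡ true → mem v ≡ true → mem (u +V v) ≡ true
      mem-·    : ∀ a v → mem v ≡ true → mem (a ·V v) ≡ true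
  open Subspace public

  _∈S_ : ∀ {N} → Vect N → Subspace N → Set
  v ∈S S = mem S v ≡ true

  SameSub : ∀ {N} → Subspace N → Subspace N → Set
  SameSub S T = ∀ v → mem S v ≡ mem T v

  _⊂S_ : ∀ {N} → Subspace N → Subspace N → Set
  _⊂S_ {N} S T = (∀ v → v ∈S S → v ∈S T) × Σ (Vect N) λ v → (v ∈S T) × ¬ (v ∈S S)

  NonZeroSub : ∀ {N} → Subspace N → Set
  NonZeroSub {N} S = Σ (Vect N) λ v → (v ∈S S) × ¬ (v ≗V 0V)

  Isotropic : ∀ {N} → Form N → Subspace N → Set
  Isotropic B S = ∀ u v → u ∈S S → v ∈S S → ev B u v ≡ 0#

  HasDim : ∀ {N} → Subspace N → ℕ → Set
  HasDim {N} S m =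
    Σ (Fin m → Vect N) λ b →
      (∀ i → b i ∈S S) × LinIndep b
      × (∀ v → v ∈S S → Σ (Fin m → Carrier) λ c → v ≗V lincomb c b)

  ∑ℕ : ∀ {m} → (Fin m → ℕ) → ℕ
  ∑ℕ {zero}  f = 0
  ∑ℕ {suc m} f = f Fin.zero ℕ.+ ∑ℕ (λ i → f (Fin.suc i))

  record WFlag {N : ℕ} (B : Form N) (n : ℕ) : Set where
    field
      k       : ℕ
      V       : Fin k → Subspace N
      w       : Fin k → ℕ
      dims    : Fin k → ℕ
      w-pos   : ∀ i → 1 ℕ.≤ w i
      hasDim  : ∀ i → HasDim (V i) (dims i)
      nonzero : ∀ i → NonZeroSub (V i)
      iso     : ∀ i → Isotropic B (V i)
      incr    : ∀ i j → toℕ i ℕ.< toℕ j → V i ⊂S V j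
      weight  : ∑ℕ (λ i → w i ℕ.* dims i) ≡ n

  SameFlag : ∀ {N} {B : Form N} {n} → WFlag B n → WFlag B n → Set
  SameFlag F G =
    Σ (WFlag.k F ≡ WFlag.k G) λ p →
      ∀ i → SameSub (WFlag.V F i) (WFlag.V G (cast p i))
            × WFlag.w F i ≡ WFlag.w G (cast p i)

Series : Set
Series = ℕ → ℕ

_⋆_ : Series → Series → Series
(f ⋆ g) n = sum (map (λ k → f k ℕ.* g (n ∸ k)) (upTo (suc n)))

oneS : Series
oneS zero    = 1
oneS (suc _) = 0

-- 1/(1 - t^j) = Σ_m t^(j m)   (used for j ≥ 1)
geomS : ℕ → Series
geomS j n = if ⌊ j ∣? n ⌋ then 1 else 0

prodGeom : ℕ → Series
prodGeom zero    = oneS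
prodGeom (suc d) = prodGeom d ⋆ geomS (suc d)

-- Signed permutations: σ ∈ S_d^± is determined by (σ(1),…,σ(d)); we encode
-- a value ±(m+1) (m : Fin d) as (negative?, m).  An element of S_d^± is
-- exactly such a map whose absolute values |σ(i)| are pairwise distinct.

allFuns : ∀ {A : Set} (n : ℕ) → List A → List (Fin n → A)
allFuns zero    xs = (λ ()) ∷ []
allFuns {A} (suc n) xs =
  concatMap (λ a → map (λ f → ext a f) (allFuns n xs)) xs
  where
  ext : A → (Fin n → A) → Fin (suc n) → A
  ext a f Fin.zero    = a
  ext a f (Fin.suc i) = f i

SVal : ℕ → Set
SVal d = Bool × Fin d

allSVal : (d : ℕ) → List (SVal d)
allSVal d = concatMap (λ b → map (λ m → (b , m)) (allFin d)) (true ∷ false ∷ [])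

toℤ : ∀ {d} → SVal d → ℤ
toℤ (false , m) = + suc (toℕ m)
toℤ (true  , m) = ℤ.- (+ suc (toℕ m))

pairs : (d : ℕ) → List (Fin d × Fin d)
pairs d = concatMap (λ i → map (λ j → (i , j)) (allFin d)) (allFin d)

allB : ∀ {A : Set} → (A → Bool) → List A → Bool
allB p []       = true
allB p (x ∷ xs) = p x ∧ allB p xs

absInjective : ∀ {d} → (Fin d → SVal d) → Bool
absInjective {d} s =
  allB (λ ij → not ⌊ toℕ (proj₁ ij) ℕ.<? toℕ (proj₂ ij) ⌋
              ∨' not ⌊ toℕ (proj₂ (s (proj₁ ij))) ℕ.≟ toℕ (proj₂ (s (proj₂ ij))) ⌋)
      (pairs d)
  where
  _∨'_ : Bool → Bool → Bool
  true ∨' _ = true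
  false ∨' b = b

signedPerms : (d : ℕ) → List (Fin d → SVal d)
signedPerms d = filter (λ s → absInjective s BP.≟ true) (allFuns d (allSVal d))

count : ∀ {A : Set} → (A → Bool) → List A → ℕ
count p xs = length (filter (λ x → p x BP.≟ true) xs)

absℤ : ℤ → ℕ
absℤ = ℤ.∣_∣

_<ℤ_ : ℤ → ℤ → Bool
a <ℤ b = ⌊ a ℤP.<? b ⌋

lpm : ∀ {d} → (Fin d → SVal d) → ℕ
lpm {d} s =
  count (λ ij → ⌊ toℕ (proj₁ ij) ℕ.<? toℕ (proj₂ ij) ⌋
                ∧ ((+ 0) <ℤ (σ (proj₁ ij) ℤ.* σ (proj₂ ij) ℤ.* (σ (proj₁ ij) ℤ.- σ (proj₂ ij)))))
        (pairs d)
  ℕ.+ sum (map (λ i → if σ i <ℤ (+ 0) then absℤ ((+ suc d) ℤ.+ σ i) else 0) (allFin d))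
  where
  σ : Fin d → ℤ
  σ i = toℤ (s i)

-- Wmaj(σ) = Σ_{1≤i<d, σ(i)>σ(i+1)} i + #{1≤i≤d : σ(i)<0}
-- (index i : Fin d stands for i+1; the pair (i, j) with toℕ j = toℕ i + 1)
Wmaj : ∀ {d} → (Fin d → SVal d) → ℕ
Wmaj {d} s =
  sum (map (λ ij → if ⌊ toℕ (proj₂ ij) ℕ.≟ suc (toℕ (proj₁ ij)) ⌋ ∧ (σ (proj₂ ij) <ℤ σ (proj₁ ij))
                   then suc (toℕ (proj₁ ij)) else 0)
           (pairs d))
  ℕ.+ count (λ i → σ i <ℤ (+ 0)) (allFin d)
  where
  σ : Fin d → ℤ
  σ i = toℤ (s i)

Mpm : ℕ → (d : ℕ) → Series
Mpm q d n = sum (map (λ s → if ⌊ Wmaj s ℕ.≟ n ⌋ then q ^ lpm s else 0) (signedPerms d))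

rhsSeries : ℕ → ℕ → Series
rhsSeries q d = Mpm q d ⋆ prodGeom d

{-# OPTIONS --safe #-}
module Submission where

-- Flags.  A weighted flag is a multichain F₁ ⊇ F₂ ⊇ … of isotropic subspaces of weight
-- Σ dim Fᵢ.  Subspaces are counted as frames divided by bases, isotropic frames being counted
-- one vector at a time since the orthogonal of m independent vectors has q^(2d-m) elements.
-- Hence, with Gaussian binomials [k+l choose k], the flags have the generating function
--   Σ_{k+l=d} [k+l choose k] Π_{i=l+1}^{d} (1 + q^i) t^k A_k ,   A_k = Σ_{j+i=k} [j+i choose j] t^j A_j ,
-- where A_k counts the multichains in a k-dimensional space (V-bottom).
--
-- Permutations.  t^maj / Π (1 - t^j) counts the sequences b₁ ≥ … ≥ b_d ≥ 0 that decrease strictly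
-- at the descents of σ.  If the first value x of σ is removed and the rest is standardised, lpm drops by
-- an amount depending on x only, so the pairs (σ, b) are built up by inserting values in increasing
-- order of (b, -x).  This yields the same recursion as for words in the letters
-- 0 < -1 < 1 < -2 < 2 < …, a letter ±s having weight s, in which the largest letter occurring is
-- split off.  Splitting off the largest letter (V) and the smallest one (V-bottom) count the same
-- words, and by the q-binomial theorem the choice of signs contributes the factors 1 + q^i.

open import Defs
open import Level using (0ℓ)
open import Algebra.Bundles using (CommutativeRing)
open import Data.Bool using (Bool; true; false)
import Data.Bool.Properties as BP
open import Data.Empty using (⊥; ⊥-elim)
open import Data.Fin as Fin using (Fin; toℕ; opposite; inject₁; fromℕ; cast)
import Data.Fin.Properties as FP
open import Data.List using (List; []; _∷_; length; lookup; tabulate)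
open import Data.Nat as ℕ using (ℕ; zero; suc; _∸_; _^_)
import Data.Nat.Properties as ℕP
open import Data.Nat.Divisibility using (_∣_)
open import Data.Nat.Tactic.RingSolver using (solve-∀)
open import Data.Product using (Σ; _×_; _,_; proj₁; proj₂)
open import Data.Sum using (inj₁; inj₂; [_,_]′)
open import Data.Unit using (⊤; tt)
open import Data.Vec.Functional using (tail) renaming (_∷_ to _◂_)
open import Function using (_∘_; id)
open import Function.Bundles using (_↔_; Inverse; mk⇔)
open import Relation.Binary.Definitions using (tri<; tri≈; tri>)
open import Relation.Binary.PropositionalEquality
open import Relation.Nullary using (Dec; yes; no; ¬_)
open import Relation.Nullary.Decidable using (⌊_⌋; map′; isYes≗does; does-⇔; dec-true; dec-false; ¬?; decidable-stable; _×-dec_)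

-- The recursion for A_k contains the term t^k A_k on its right-hand side, so it determines A_k only
-- degree by degree. Both sides are therefore compared in a fixed degree n, and the alphabet is cut
-- off at a largest letter s: a word of weight n cannot use a letter above n. The common value is
-- `V φ± (suc n) d n`. On the side of the flags, a letter should be thought of as the number of
-- members of the multichain that contain a given basis direction. The letters 0 lie outside the
-- largest subspace, and lowering all other letters by one removes one copy of it. The parameter `φ`
-- describes the ambient space: it is `φ±` for isotropic subspaces of the symplectic space and `𝟙`
-- inside an isotropic subspace, where every subspace is isotropic. Hence `φ±` enters only with the
-- largest subspace of a flag. All coefficients are natural numbers: q-factorials and numbers of
-- bases are multiplied through and cancelled, never divided by.

module Combinatorics where
  open import Data.Bool using (if_then_else_; _∧_; _∨_; not)
  open import Data.Fin using (punchIn)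
  open import Data.Integer as ℤ using (ℤ; -[1+_])
  import Data.Integer.Properties as ℤP
  open import Data.List using (map; filter; concatMap; applyUpTo; allFin; _++_)
  open import Data.List.Properties using (map-++)
  open import Data.Nat
  open import Data.Nat.Properties
  open import Data.Nat.Divisibility using (_∣?_; ∣m+n∣m⇒∣n; ∣m∣n⇒∣m+n; ∣-refl; >⇒∤; _∣0)
  open import Data.Nat.ListAction using (sum)
  open import Data.Nat.ListAction.Properties using (sum-++)
  open ≡-Reasoning

  -- Sums over the antidiagonal k + l = d.

  anti : (ℕ → ℕ → ℕ) → ℕ → ℕ
  anti f zero    = f 0 0
  anti f (suc d) = f 0 (suc d) + anti (λ k l → f (suc k) l) d

  anti-cong : ∀ {f g : ℕ → ℕ → ℕ} d → (∀ k l → k + l ≡ d → f k l ≡ g k l) → anti f d ≡ anti g d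
  anti-cong zero    h = h 0 0 refl
  anti-cong (suc d) h =
    cong₂ _+_ (h 0 (suc d) refl) (anti-cong d (λ k l e → h (suc k) l (cong suc e)))

  anti-cong′ : ∀ {f g : ℕ → ℕ → ℕ} d → (∀ k l → f k l ≡ g k l) → anti f d ≡ anti g d
  anti-cong′ d h = anti-cong d (λ k l _ → h k l)

  +-interchange : ∀ a b c d → (a + b) + (c + d) ≡ (a + c) + (b + d)
  +-interchange = solve-∀

  anti-+ : ∀ (f g : ℕ → ℕ → ℕ) d → anti (λ k l → f k l + g k l) d ≡ anti f d + anti g d
  anti-+ f g zero    = refl
  anti-+ f g (suc d) = trans
    (cong ((f 0 (suc d) + g 0 (suc d)) +_) (anti-+ (λ k l → f (suc k) l) (λ k l → g (suc k) l) d))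
    (+-interchange (f 0 (suc d)) (g 0 (suc d)) _ _)

  anti-*ˡ : ∀ c (f : ℕ → ℕ → ℕ) d → anti (λ k l → c * f k l) d ≡ c * anti f d
  anti-*ˡ c f zero    = refl
  anti-*ˡ c f (suc d) = trans
    (cong (c * f 0 (suc d) +_) (anti-*ˡ c (λ k l → f (suc k) l) d))
    (sym (*-distribˡ-+ c (f 0 (suc d)) _))

  anti-zero : ∀ {f : ℕ → ℕ → ℕ} d → (∀ k l → k + l ≡ d → f k l ≡ 0) → anti f d ≡ 0
  anti-zero zero    h = h 0 0 refl
  anti-zero (suc d) h =
    cong₂ _+_ (h 0 (suc d) refl) (anti-zero d (λ k l e → h (suc k) l (cong suc e)))

  anti-last : ∀ (f : ℕ → ℕ → ℕ) d → anti f (suc d) ≡ anti (λ k l → f k (suc l)) d + f (suc d) 0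
  anti-last f zero    = refl
  anti-last f (suc d) = trans
    (cong (f 0 (suc (suc d)) +_) (anti-last (λ k l → f (suc k) l) d))
    (sym (+-assoc (f 0 (suc (suc d))) _ _))

  -- Both sides run over the triples k + j + i = d. This regrouping is what lets two letters be
  -- split off in either order.
  anti-assoc : ∀ (f : ℕ → ℕ → ℕ → ℕ) d →
    anti (λ k l → anti (f k) l) d ≡ anti (λ m i → anti (λ k j → f k j i) m) d
  anti-assoc f zero    = refl
  anti-assoc f (suc d) = begin
    (f 0 0 (suc d) + anti (λ m i → f 0 (suc m) i) d) + anti (λ k l → anti (f (suc k)) l) d
      ≡⟨ +-assoc (f 0 0 (suc d)) _ _ ⟩
    f 0 0 (suc d) + (anti (λ m i → f 0 (suc m) i) d + anti (λ k l → anti (f (suc k)) l) d)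
      ≡⟨ cong (λ z → f 0 0 (suc d) + (anti (λ m i → f 0 (suc m) i) d + z))
           (anti-assoc (λ k → f (suc k)) d) ⟩
    f 0 0 (suc d) + (anti (λ m i → f 0 (suc m) i) d
                     + anti (λ m i → anti (λ k j → f (suc k) j i) m) d)
      ≡⟨ cong (f 0 0 (suc d) +_) (sym (anti-+ (λ m i → f 0 (suc m) i) _ d)) ⟩
    f 0 0 (suc d) + anti (λ m i → f 0 (suc m) i + anti (λ k j → f (suc k) j i) m) d ∎

  -- Multiplication of a series by a power of t

  sh : ℕ → Series → Series
  sh zero    f n       = f n
  sh (suc k) f zero    = 0
  sh (suc k) f (suc n) = sh k f n

  sh-cong : ∀ k {f g : Series} n → (∀ m → f m ≡ g m) → sh k f n ≡ sh k g n
  sh-cong zero    n       h = h n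
  sh-cong (suc k) zero    h = refl
  sh-cong (suc k) (suc n) h = sh-cong k n h

  sh-sh : ∀ a b (f : Series) n → sh a (sh b f) n ≡ sh (a + b) f n
  sh-sh zero    b f n       = refl
  sh-sh (suc a) b f zero    = refl
  sh-sh (suc a) b f (suc n) = sh-sh a b f n

  sh-+ : ∀ k (f g : Series) n → sh k (λ m → f m + g m) n ≡ sh k f n + sh k g n
  sh-+ zero    f g n       = refl
  sh-+ (suc k) f g zero    = refl
  sh-+ (suc k) f g (suc n) = sh-+ k f g n

  sh-* : ∀ k c (f : Series) n → sh k (λ m → c * f m) n ≡ c * sh k f n
  sh-* zero    c f n       = refl
  sh-* (suc k) c f zero    = sym (*-zeroʳ c)
  sh-* (suc k) c f (suc n) = sh-* k c f n

  sh-anti : ∀ k (f : ℕ → ℕ → Series) d n →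
    sh k (λ m → anti (λ a b → f a b m) d) n ≡ anti (λ a b → sh k (f a b) n) d
  sh-anti k f zero    n = refl
  sh-anti k f (suc d) n = trans (sh-+ k (f 0 (suc d)) _ n)
    (cong (sh k (f 0 (suc d)) n +_) (sh-anti k (λ a b → f (suc a) b) d n))

  sh-zero : ∀ k {f : Series} n → (∀ m → f m ≡ 0) → sh k f n ≡ 0
  sh-zero zero    n       h = h n
  sh-zero (suc k) zero    h = refl
  sh-zero (suc k) (suc n) h = sh-zero k n h

  sh-small : ∀ k (f : Series) n → n < k → sh k f n ≡ 0
  sh-small (suc k) f zero    _         = refl
  sh-small (suc k) f (suc n) (s≤s n<k) = sh-small k f n n<k

  sh-big : ∀ k (f : Series) m → sh k f (k + m) ≡ f m
  sh-big zero    f m = refl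
  sh-big (suc k) f m = sh-big k f m

  sh-∸ : ∀ k (f : Series) n → k ≤ n → sh k f n ≡ f (n ∸ k)
  sh-∸ zero    f n       _         = refl
  sh-∸ (suc k) f (suc n) (s≤s k≤n) = sh-∸ k f n k≤n

  -- Gaussian binomials and the generating functions of words.

  module QBinomial (q : ℕ) where

    -- qb k l is the Gaussian binomial coefficient [k + l choose k].
    qb : ℕ → ℕ → ℕ
    qb zero    l       = 1
    qb (suc k) zero    = 1
    qb (suc k) (suc l) = qb k (suc l) + q ^ suc k * qb (suc k) l

    qb-0 : ∀ k → qb k 0 ≡ 1
    qb-0 zero    = refl
    qb-0 (suc k) = refl

    qint : ℕ → ℕ
    qint zero    = 0
    qint (suc n) = 1 + q * qint n

    qfac : ℕ → ℕ
    qfac zero    = 1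
    qfac (suc n) = qint (suc n) * qfac n

    qfac-nonZero : ∀ n → NonZero (qfac n)
    qfac-nonZero zero    = _
    qfac-nonZero (suc n) = m*n≢0 (qint (suc n)) (qfac n) {{_}} {{qfac-nonZero n}}

    qint-+ : ∀ a b → qint (a + b) ≡ qint a + q ^ a * qint b
    qint-+ zero    b = sym (+-identityʳ (qint b))
    qint-+ (suc a) b = trans (cong (λ z → 1 + q * z) (qint-+ a b)) (lem q (qint a) (q ^ a) (qint b))
      where
      lem : ∀ q x y z → 1 + q * (x + y * z) ≡ 1 + q * x + q * y * z
      lem = solve-∀

    qb-qfac : ∀ a b → qb a b * (qfac a * qfac b) ≡ qfac (a + b)
    qb-qfac zero b = trans (*-identityˡ (1 * qfac b)) (*-identityˡ (qfac b))
    qb-qfac (suc a) zero = begin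
      1 * (qfac (suc a) * 1) ≡⟨ trans (*-identityˡ _) (*-identityʳ _) ⟩
      qfac (suc a)           ≡⟨ cong (λ z → qfac (suc z)) (+-identityʳ a) ⟨
      qfac (suc a + 0)       ∎
    qb-qfac (suc a) (suc b) = begin
      (qb a (suc b) + q ^ suc a * qb (suc a) b) * (qfac (suc a) * qfac (suc b))
        ≡⟨ lem (qb a (suc b)) (q ^ suc a) (qb (suc a) b) (qint (suc a)) (qfac a) (qint (suc b)) (qfac b) ⟩
      qint (suc a) * (qb a (suc b) * (qfac a * qfac (suc b)))
        + q ^ suc a * qint (suc b) * (qb (suc a) b * (qfac (suc a) * qfac b))
        ≡⟨ cong₂ (λ y z → qint (suc a) * y + q ^ suc a * qint (suc b) * z)
             (trans (qb-qfac a (suc b)) (cong qfac (+-suc a b))) (qb-qfac (suc a) b) ⟩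
      qint (suc a) * qfac (suc a + b) + q ^ suc a * qint (suc b) * qfac (suc a + b)
        ≡⟨ *-distribʳ-+ (qfac (suc a + b)) (qint (suc a)) (q ^ suc a * qint (suc b)) ⟨
      (qint (suc a) + q ^ suc a * qint (suc b)) * qfac (suc a + b)
        ≡⟨ cong (_* qfac (suc a + b)) (qint-+ (suc a) (suc b)) ⟨
      qint (suc a + suc b) * qfac (suc a + b)
        ≡⟨ cong (λ z → qint (suc a + suc b) * qfac z) (+-suc a b) ⟨
      qint (suc a + suc b) * qfac (a + suc b) ∎
      where
      lem : ∀ x y z i f j g → (x + y * z) * ((i * f) * (j * g)) ≡ i * (x * (f * (j * g))) + y * j * (z * ((i * f) * g))
      lem = solve-∀

    -- Both products are the q-multinomial coefficient of (k, m, i); after multiplication by the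
    -- three q-factorials each becomes `qfac` of k + m + i.
    qb-trinomial : ∀ k m i → qb k (m + i) * qb m i ≡ qb (k + m) i * qb k m
    qb-trinomial k m i = *-cancelʳ-≡ _ _ D {{nz}} (begin
      qb k (m + i) * qb m i * D
        ≡⟨ l₁ (qb k (m + i)) (qb m i) (qfac k) (qfac m) (qfac i) ⟩
      qb k (m + i) * (qfac k * (qb m i * (qfac m * qfac i)))
        ≡⟨ cong (λ z → qb k (m + i) * (qfac k * z)) (qb-qfac m i) ⟩
      qb k (m + i) * (qfac k * qfac (m + i))
        ≡⟨ qb-qfac k (m + i) ⟩
      qfac (k + (m + i))
        ≡⟨ cong qfac (+-assoc k m i) ⟨
      qfac (k + m + i)
        ≡⟨ qb-qfac (k + m) i ⟨
      qb (k + m) i * (qfac (k + m) * qfac i)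
        ≡⟨ cong (λ z → qb (k + m) i * (z * qfac i)) (qb-qfac k m) ⟨
      qb (k + m) i * (qb k m * (qfac k * qfac m) * qfac i)
        ≡⟨ l₂ (qb (k + m) i) (qb k m) (qfac k) (qfac m) (qfac i) ⟩
      qb (k + m) i * qb k m * D ∎)
      where
      D = qfac k * qfac m * qfac i
      nz : NonZero D
      nz = m*n≢0 _ _ {{m*n≢0 _ _ {{qfac-nonZero k}} {{qfac-nonZero m}}}} {{qfac-nonZero i}}
      l₁ : ∀ x y a b c → x * y * (a * b * c) ≡ x * (a * (y * (b * c)))
      l₁ = solve-∀
      l₂ : ∀ x y a b c → x * (y * (a * b) * c) ≡ x * y * (a * b * c)
      l₂ = solve-∀

    -- The q-Pascal rule under a weighted sum: every induction on the length of a word below goes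
    -- through this form.
    anti-pascal : ∀ (g : ℕ → ℕ → ℕ) d →
      anti (λ k l → qb k l * g k l) (suc d)
      ≡ anti (λ k l → qb k l * g (suc k) l) d + anti (λ k l → qb k l * (q ^ k * g k (suc l))) d
    anti-pascal g d = begin
      anti (λ k l → qb k l * g k l) (suc d)
        ≡⟨ anti-cong (suc d) split ⟩
      anti (λ k l → A k l + B k l) (suc d)
        ≡⟨ anti-+ A B (suc d) ⟩
      anti A (suc d) + anti B (suc d)
        ≡⟨ cong (anti A (suc d) +_) (trans (anti-last B d) (+-identityʳ _)) ⟩
      anti (λ k l → qb k l * g (suc k) l) d + anti (λ k l → qb k l * (q ^ k * g k (suc l))) d ∎
      where
      A B : ℕ → ℕ → ℕ
      -- Pascal's rule has only one summand when `k` or `l` is 0; padding with 0 lets both shifted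
      -- sums run over the whole antidiagonal.
      A zero    l = 0
      A (suc k) l = qb k l * g (suc k) l
      B k zero    = 0
      B k (suc l) = qb k l * (q ^ k * g k (suc l))
      lem : ∀ x y z w → (x + y * z) * w ≡ x * w + z * (y * w)
      lem = solve-∀
      split : ∀ k l → k + l ≡ suc d → qb k l * g k l ≡ A k l + B k l
      split zero    zero    ()
      split zero    (suc l) _ = cong (1 *_) (sym (*-identityˡ (g 0 (suc l))))
      split (suc k) zero    _ = sym (trans (+-identityʳ _) (cong (_* g (suc k) 0) (qb-0 k)))
      split (suc k) (suc l) _ = lem (qb k (suc l)) (q ^ suc k) (qb (suc k) l) (g (suc k) (suc l))

    -- ρ φ k l = φ (l + 1) ⋯ φ (l + k)
    ρ : (ℕ → ℕ) → ℕ → ℕ → ℕ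
    ρ φ zero    l = 1
    ρ φ (suc k) l = φ (suc (k + l)) * ρ φ k l

    ρ-+ : ∀ φ k m i → ρ φ k (m + i) * ρ φ m i ≡ ρ φ (k + m) i
    ρ-+ φ zero    m i = *-identityˡ (ρ φ m i)
    ρ-+ φ (suc k) m i = begin
      φ (suc (k + (m + i))) * ρ φ k (m + i) * ρ φ m i   ≡⟨ *-assoc (φ (suc (k + (m + i)))) (ρ φ k (m + i)) (ρ φ m i) ⟩
      φ (suc (k + (m + i))) * (ρ φ k (m + i) * ρ φ m i) ≡⟨ cong₂ (λ x y → φ (suc x) * y) (sym (+-assoc k m i)) (ρ-+ φ k m i) ⟩
      φ (suc (k + m + i)) * ρ φ (k + m) i               ∎

    𝟙 : ℕ → ℕ
    𝟙 _ = 1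

    ρ-𝟙 : ∀ k l → ρ 𝟙 k l ≡ 1
    ρ-𝟙 zero    l = refl
    ρ-𝟙 (suc k) l = trans (*-identityˡ (ρ 𝟙 k l)) (ρ-𝟙 k l)

    φ± : ℕ → ℕ
    φ± i = 1 + q ^ i

    -- Of k letters of equal absolute value p are positive and m negative, and the negative ones
    -- carry the factors q^(l+1), ..., q^(l+m). In the induction the second sum of `anti-pascal`
    -- gains q^p q^(m+l+1) = q^(k+l+1), which does not depend on the split.
    q-binomial-theorem : ∀ l k → anti (λ p m → qb p m * ρ (q ^_) m l) k ≡ ρ φ± k l
    q-binomial-theorem l zero    = refl
    q-binomial-theorem l (suc k) = begin
      anti (λ p m → qb p m * ρ (q ^_) m l) (suc k)
        ≡⟨ anti-pascal (λ p m → ρ (q ^_) m l) k ⟩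
      anti f k + anti (λ p m → qb p m * (q ^ p * (q ^ suc (m + l) * ρ (q ^_) m l))) k
        ≡⟨ cong (anti f k +_) (anti-cong k step) ⟩
      anti f k + anti (λ p m → q ^ suc (k + l) * f p m) k
        ≡⟨ cong (anti f k +_) (anti-*ˡ (q ^ suc (k + l)) f k) ⟩
      (1 + q ^ suc (k + l)) * anti f k
        ≡⟨ cong ((1 + q ^ suc (k + l)) *_) (q-binomial-theorem l k) ⟩
      φ± (suc (k + l)) * ρ φ± k l ∎
      where
      f : ℕ → ℕ → ℕ
      f p m = qb p m * ρ (q ^_) m l
      lem : ∀ x y z w → x * (y * (z * w)) ≡ (y * z) * (x * w)
      lem = solve-∀
      step : ∀ p m → p + m ≡ k → qb p m * (q ^ p * (q ^ suc (m + l) * ρ (q ^_) m l)) ≡ q ^ suc (k + l) * f p m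
      step p m refl = begin
        qb p m * (q ^ p * (q ^ suc (m + l) * ρ (q ^_) m l))
          ≡⟨ lem (qb p m) (q ^ p) (q ^ suc (m + l)) (ρ (q ^_) m l) ⟩
        q ^ p * q ^ suc (m + l) * f p m
          ≡⟨ cong (_* f p m) (^-distribˡ-+-* q p (suc (m + l))) ⟨
        q ^ (p + suc (m + l)) * f p m
          ≡⟨ cong (λ z → q ^ z * f p m) (trans (+-suc p (m + l)) (cong suc (sym (+-assoc p m l)))) ⟩
        q ^ suc (p + m + l) * f p m ∎

    -- L prev ψ w u r counts words of length u + r whose last r letters may also take a new
    -- maximal letter of weight w; prev counts the words without it.
    L : (ℕ → Series) → (ℕ → ℕ) → ℕ → ℕ → ℕ → Series
    L prev ψ w u zero    n = prev u n
    L prev ψ w u (suc r) n = L prev ψ w (suc u) r n + q ^ u * ψ (suc (u + r)) * sh w (L prev ψ w u r) n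

    -- Choose which k of the r free places receive the new letter. Each of these k letters passes
    -- the u frozen ones, whence q^(u k), and `ψ` is evaluated at the successive lengths, whence
    -- `ρ`. The recursion of `L` on the first free place is the q-Pascal rule: freezing that place
    -- turns q^(u k) into q^((u+1) k).
    L-closed : ∀ prev ψ w u r n →
      L prev ψ w u r n
      ≡ anti (λ k l → qb k l * (q ^ (u * k) * ρ ψ k (u + l) * sh (k * w) (prev (u + l)) n)) r
    L-closed prev ψ w u zero n = sym (begin
      1 * (q ^ (u * 0) * 1 * prev (u + 0) n) ≡⟨ cong₂ (λ x y → 1 * (q ^ x * 1 * prev y n)) (*-zeroʳ u) (+-identityʳ u) ⟩
      1 * (1 * prev u n)                     ≡⟨ trans (*-identityˡ _) (*-identityˡ _) ⟩
      prev u n                               ∎)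
    L-closed prev ψ w u (suc r) n = sym (begin
      anti (λ k l → qb k l * g u k l n) (suc r)
        ≡⟨ anti-pascal (λ k l → g u k l n) r ⟩
      anti (λ k l → qb k l * g u (suc k) l n) r + anti (λ k l → qb k l * (q ^ k * g u k (suc l) n)) r
        ≡⟨ cong₂ _+_ (anti-cong r first) (anti-cong′ r second) ⟩
      anti (λ k l → c * sh w (λ m → qb k l * g u k l m) n) r + anti (λ k l → qb k l * g (suc u) k l n) r
        ≡⟨ cong₂ _+_ (trans (anti-*ˡ c _ r) (cong (c *_) (sym (sh-anti w (λ k l m → qb k l * g u k l m) r n))))
                     (sym (L-closed prev ψ w (suc u) r n)) ⟩
      c * sh w (λ m → anti (λ k l → qb k l * g u k l m) r) n + L prev ψ w (suc u) r n
        ≡⟨ cong (λ z → c * z + L prev ψ w (suc u) r n) (sh-cong w n (λ m → sym (L-closed prev ψ w u r m))) ⟩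
      c * sh w (L prev ψ w u r) n + L prev ψ w (suc u) r n
        ≡⟨ +-comm _ (L prev ψ w (suc u) r n) ⟩
      L prev ψ w u (suc r) n ∎)
      where
      c = q ^ u * ψ (suc (u + r))
      g : ℕ → ℕ → ℕ → Series
      g u k l n = q ^ (u * k) * ρ ψ k (u + l) * sh (k * w) (prev (u + l)) n
      l₁ : ∀ b x y f r s → b * (x * y * (f * r) * s) ≡ (x * f) * (b * (y * r * s))
      l₁ = solve-∀
      first : ∀ k l → k + l ≡ r → qb k l * g u (suc k) l n ≡ c * sh w (λ m → qb k l * g u k l m) n
      first k l refl = begin
        qb k l * (q ^ (u * suc k) * (ψ (suc (k + (u + l))) * ρ ψ k (u + l)) * sh (w + k * w) (prev (u + l)) n)
          ≡⟨ cong₂ (λ x y → qb k l * (x * (ψ (suc y) * ρ ψ k (u + l)) * sh (w + k * w) (prev (u + l)) n))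
               (trans (cong (q ^_) (*-suc u k)) (^-distribˡ-+-* q u (u * k))) (eq k u l) ⟩
        qb k l * (q ^ u * q ^ (u * k) * (ψ (suc (u + (k + l))) * ρ ψ k (u + l)) * sh (w + k * w) (prev (u + l)) n)
          ≡⟨ l₁ (qb k l) (q ^ u) (q ^ (u * k)) _ (ρ ψ k (u + l)) _ ⟩
        c * (qb k l * (q ^ (u * k) * ρ ψ k (u + l) * sh (w + k * w) (prev (u + l)) n))
          ≡⟨ cong (λ z → c * (qb k l * (q ^ (u * k) * ρ ψ k (u + l) * z))) (sh-sh w (k * w) (prev (u + l)) n) ⟨
        c * (qb k l * (q ^ (u * k) * ρ ψ k (u + l) * sh w (sh (k * w) (prev (u + l))) n))
          ≡⟨ cong (λ z → c * (qb k l * z)) (sh-* w (q ^ (u * k) * ρ ψ k (u + l)) (sh (k * w) (prev (u + l))) n) ⟨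
        c * (qb k l * sh w (g u k l) n)
          ≡⟨ cong (c *_) (sh-* w (qb k l) (g u k l) n) ⟨
        c * sh w (λ m → qb k l * g u k l m) n ∎
        where
        eq : ∀ k u l → k + (u + l) ≡ u + (k + l)
        eq = solve-∀
      l₂ : ∀ b a x r s → b * (a * (x * r * s)) ≡ b * ((a * x) * r * s)
      l₂ = solve-∀
      second : ∀ k l → qb k l * (q ^ k * g u k (suc l) n) ≡ qb k l * g (suc u) k l n
      second k l = begin
        qb k l * (q ^ k * (q ^ (u * k) * ρ ψ k (u + suc l) * sh (k * w) (prev (u + suc l)) n))
          ≡⟨ cong (λ z → qb k l * (q ^ k * (q ^ (u * k) * ρ ψ k z * sh (k * w) (prev z) n))) (+-suc u l) ⟩
        qb k l * (q ^ k * (q ^ (u * k) * ρ ψ k (suc u + l) * sh (k * w) (prev (suc u + l)) n))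
          ≡⟨ l₂ (qb k l) (q ^ k) (q ^ (u * k)) (ρ ψ k (suc u + l)) _ ⟩
        qb k l * (q ^ k * q ^ (u * k) * ρ ψ k (suc u + l) * sh (k * w) (prev (suc u + l)) n)
          ≡⟨ cong (λ z → qb k l * (z * ρ ψ k (suc u + l) * sh (k * w) (prev (suc u + l)) n)) (^-distribˡ-+-* q k (u * k)) ⟨
        qb k l * g (suc u) k l n ∎

    L-closed₀ : ∀ prev ψ w d n →
      L prev ψ w 0 d n ≡ anti (λ k l → qb k l * (ρ ψ k l * sh (k * w) (prev l) n)) d
    L-closed₀ prev ψ w d n = trans (L-closed prev ψ w 0 d n)
      (anti-cong′ d (λ k l → cong (λ z → qb k l * (z * sh (k * w) (prev l) n)) (*-identityˡ (ρ ψ k l))))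

    -- Words of length d in the letters 0, …, s, a letter having its value as weight.
    V : (ℕ → ℕ) → ℕ → ℕ → Series
    V φ zero    d n = oneS n
    V φ (suc s) d n = anti (λ k l → qb k l * (ρ φ k l * sh (k * suc s) (V φ s l) n)) d

    V-0 : ∀ φ s n → V φ s 0 n ≡ oneS n
    V-0 φ zero    n = refl
    V-0 φ (suc s) n = trans (trans (*-identityˡ _) (*-identityˡ _)) (V-0 φ s n)

    -- Peeling off the smallest letter of a word instead of the largest one.
    V-bottom : ∀ φ s d n →
      V φ (suc s) d n ≡ anti (λ m i → qb m i * (ρ φ m i * sh m (V 𝟙 s m) n)) d
    V-bottom φ zero d n = anti-cong′ d (λ k l →
      cong (λ z → qb k l * (ρ φ k l * sh z oneS n)) (*-identityʳ k))
    V-bottom φ (suc s) d n = begin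
      anti (λ k l → qb k l * (ρ φ k l * sh (k * suc (suc s)) (V φ (suc s) l) n)) d
        ≡⟨ anti-cong′ d lhs ⟩
      anti (λ k l → anti (λ m i → T k m i) l) d
        ≡⟨ anti-assoc T d ⟩
      anti (λ m′ i → anti (λ k m → T k m i) m′) d
        ≡⟨ anti-cong′ d rhs ⟨
      anti (λ m i → qb m i * (ρ φ m i * sh m (V 𝟙 (suc s) m) n)) d ∎
      where
      -- The common refinement: k letters equal to the maximum, m smaller nonzero ones and i zeros.
      -- The nonzero letters are lowered by one, which accounts for the shift by m and reduces the
      -- maximum by one in the second expansion.
      T : ℕ → ℕ → ℕ → ℕ
      T k m i = qb k (m + i) * qb m i * (ρ φ (k + m) i * sh (k * suc (suc s) + m) (V 𝟙 s m) n)
      l₁ : ∀ a b c d e → a * b * (c * (d * e)) ≡ a * c * (b * d * e)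
      l₁ = solve-∀
      lhs : ∀ k l → qb k l * (ρ φ k l * sh (k * suc (suc s)) (V φ (suc s) l) n) ≡ anti (λ m i → T k m i) l
      lhs k l = begin
        qb k l * (ρ φ k l * sh w (V φ (suc s) l) n)
          ≡⟨ *-assoc (qb k l) (ρ φ k l) _ ⟨
        qb k l * ρ φ k l * sh w (V φ (suc s) l) n
          ≡⟨ cong (qb k l * ρ φ k l *_) (trans (sh-cong w n (V-bottom φ s l)) (sh-anti w _ l n)) ⟩
        qb k l * ρ φ k l * anti (λ m i → sh w (λ n′ → qb m i * (ρ φ m i * sh m (V 𝟙 s m) n′)) n) l
          ≡⟨ anti-*ˡ (qb k l * ρ φ k l) _ l ⟨
        anti (λ m i → qb k l * ρ φ k l * sh w (λ n′ → qb m i * (ρ φ m i * sh m (V 𝟙 s m) n′)) n) l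
          ≡⟨ anti-cong l (λ m i e → term m i e) ⟩
        anti (λ m i → T k m i) l ∎
        where
        w = k * suc (suc s)
        term : ∀ m i → m + i ≡ l →
          qb k l * ρ φ k l * sh w (λ n′ → qb m i * (ρ φ m i * sh m (V 𝟙 s m) n′)) n ≡ T k m i
        term m i refl = begin
          qb k (m + i) * ρ φ k (m + i) * sh w (λ n′ → qb m i * (ρ φ m i * sh m (V 𝟙 s m) n′)) n
            ≡⟨ cong (qb k (m + i) * ρ φ k (m + i) *_)
                 (trans (sh-* w (qb m i) _ n) (cong (qb m i *_) (trans (sh-* w (ρ φ m i) _ n)
                   (cong (ρ φ m i *_) (sh-sh w m (V 𝟙 s m) n))))) ⟩
          qb k (m + i) * ρ φ k (m + i) * (qb m i * (ρ φ m i * sh (w + m) (V 𝟙 s m) n))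
            ≡⟨ l₁ (qb k (m + i)) (ρ φ k (m + i)) (qb m i) (ρ φ m i) _ ⟩
          qb k (m + i) * qb m i * (ρ φ k (m + i) * ρ φ m i * sh (w + m) (V 𝟙 s m) n)
            ≡⟨ cong (λ z → qb k (m + i) * qb m i * (z * sh (w + m) (V 𝟙 s m) n)) (ρ-+ φ k m i) ⟩
          T k m i ∎
      rhs : ∀ m′ i → qb m′ i * (ρ φ m′ i * sh m′ (V 𝟙 (suc s) m′) n) ≡ anti (λ k m → T k m i) m′
      rhs m′ i = begin
        qb m′ i * (ρ φ m′ i * sh m′ (V 𝟙 (suc s) m′) n)
          ≡⟨ *-assoc (qb m′ i) (ρ φ m′ i) _ ⟨
        qb m′ i * ρ φ m′ i * sh m′ (V 𝟙 (suc s) m′) n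
          ≡⟨ cong (qb m′ i * ρ φ m′ i *_) (sh-anti m′ _ m′ n) ⟩
        qb m′ i * ρ φ m′ i * anti (λ k m → sh m′ (λ n′ → qb k m * (ρ 𝟙 k m * sh (k * suc s) (V 𝟙 s m) n′)) n) m′
          ≡⟨ anti-*ˡ (qb m′ i * ρ φ m′ i) _ m′ ⟨
        anti (λ k m → qb m′ i * ρ φ m′ i * sh m′ (λ n′ → qb k m * (ρ 𝟙 k m * sh (k * suc s) (V 𝟙 s m) n′)) n) m′
          ≡⟨ anti-cong m′ term ⟩
        anti (λ k m → T k m i) m′ ∎
        where
        wt : ∀ k m s → k + m + k * suc s ≡ k * suc (suc s) + m
        wt = solve-∀
        term : ∀ k m → k + m ≡ m′ →
          qb m′ i * ρ φ m′ i * sh m′ (λ n′ → qb k m * (ρ 𝟙 k m * sh (k * suc s) (V 𝟙 s m) n′)) n ≡ T k m i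
        term k m refl = begin
          qb (k + m) i * ρ φ (k + m) i * sh (k + m) (λ n′ → qb k m * (ρ 𝟙 k m * sh (k * suc s) (V 𝟙 s m) n′)) n
            ≡⟨ cong (qb (k + m) i * ρ φ (k + m) i *_)
                 (trans (sh-* (k + m) (qb k m) _ n) (cong (qb k m *_) (trans (sh-* (k + m) (ρ 𝟙 k m) _ n)
                   (cong₂ _*_ (ρ-𝟙 k m) (trans (sh-sh (k + m) (k * suc s) (V 𝟙 s m) n)
                      (cong (λ z → sh z (V 𝟙 s m) n) (wt k m s))))))) ⟩
          qb (k + m) i * ρ φ (k + m) i * (qb k m * (1 * X))
            ≡⟨ l₃ (qb (k + m) i) (ρ φ (k + m) i) (qb k m) X ⟩
          qb (k + m) i * qb k m * (ρ φ (k + m) i * X)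
            ≡⟨ cong (_* (ρ φ (k + m) i * X)) (qb-trinomial k m i) ⟨
          T k m i ∎
          where
          X = sh (k * suc (suc s) + m) (V 𝟙 s m) n
          l₃ : ∀ a b c e → a * b * (c * (1 * e)) ≡ a * c * (b * e)
          l₃ = solve-∀

    -- δ₀, Tpos 0, Tneg 0, Tpos 1, Tneg 1, … count words over longer and longer initial
    -- segments of the alphabet 0 < −1 < 1 < −2 < 2 < … , a letter ±s having weight s.
    δ₀ : ℕ → Series
    δ₀ zero    n = oneS n
    δ₀ (suc _) n = 0

    Tneg Tpos prev : ℕ → ℕ → Series
    prev zero    = δ₀
    prev (suc b) = Tneg b
    Tpos b d = L (prev b) 𝟙 b 0 d
    Tneg b d = L (Tpos b) (q ^_) (suc b) 0 d

    Tpos-0 : ∀ d n → Tpos 0 d n ≡ oneS n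
    Tpos-0 d n = go d n
      where
      -- A frozen letter would have to come from the empty alphabet.
      z : ∀ u r n → L δ₀ 𝟙 0 (suc u) r n ≡ 0
      z u zero    n = refl
      z u (suc r) n = trans (cong₂ _+_ (z (suc u) r n) (cong (q ^ suc u * 1 *_) (z u r n))) (*-zeroʳ (q ^ suc u * 1))
      go : ∀ r n → L δ₀ 𝟙 0 0 r n ≡ oneS n
      go zero    n = refl
      go (suc r) n = trans (cong₂ (λ x y → x + 1 * y) (z 0 r n) (go r n)) (+-identityʳ (oneS n))

    -- The two letters of absolute value s have the same weight, so p copies of the positive one and
    -- m of the negative one shift by an amount depending on p + m only. Collecting by k = p + m and
    -- rewriting with `qb-trinomial` pulls out `qb k l` and leaves exactly the sum of the q-binomial
    -- theorem.
    Tpos≡V : ∀ s d n → Tpos s d n ≡ V φ± s d n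
    Tpos≡V zero    d n = Tpos-0 d n
    Tpos≡V (suc s) d n = begin
      L (Tneg s) 𝟙 (suc s) 0 d n
        ≡⟨ L-closed₀ (Tneg s) 𝟙 (suc s) d n ⟩
      anti (λ p l′ → qb p l′ * (ρ 𝟙 p l′ * sh (p * suc s) (Tneg s l′) n)) d
        ≡⟨ anti-cong′ d lhs ⟩
      anti (λ p l′ → anti (λ m l → F p m l) l′) d
        ≡⟨ anti-assoc F d ⟩
      anti (λ k l → anti (λ p m → F p m l) k) d
        ≡⟨ anti-cong′ d rhs ⟩
      V φ± (suc s) d n ∎
      where
      F : ℕ → ℕ → ℕ → ℕ
      F p m l = qb p (m + l) * qb m l * (ρ (q ^_) m l * sh ((p + m) * suc s) (V φ± s l) n)
      lhs : ∀ p l′ → qb p l′ * (ρ 𝟙 p l′ * sh (p * suc s) (Tneg s l′) n) ≡ anti (λ m l → F p m l) l′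
      lhs p l′ = begin
        qb p l′ * (ρ 𝟙 p l′ * sh (p * suc s) (Tneg s l′) n)
          ≡⟨ cong (qb p l′ *_) (trans (cong (_* sh (p * suc s) (Tneg s l′) n) (ρ-𝟙 p l′)) (*-identityˡ _)) ⟩
        qb p l′ * sh (p * suc s) (Tneg s l′) n
          ≡⟨ cong (qb p l′ *_) (trans (sh-cong (p * suc s) n (L-closed₀ (Tpos s) (q ^_) (suc s) l′))
               (sh-anti (p * suc s) _ l′ n)) ⟩
        qb p l′ * anti (λ m l → sh (p * suc s) (λ n′ → qb m l * (ρ (q ^_) m l * sh (m * suc s) (Tpos s l) n′)) n) l′
          ≡⟨ anti-*ˡ (qb p l′) _ l′ ⟨
        anti (λ m l → qb p l′ * sh (p * suc s) (λ n′ → qb m l * (ρ (q ^_) m l * sh (m * suc s) (Tpos s l) n′)) n) l′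
          ≡⟨ anti-cong l′ term ⟩
        anti (λ m l → F p m l) l′ ∎
        where
        term : ∀ m l → m + l ≡ l′ →
          qb p l′ * sh (p * suc s) (λ n′ → qb m l * (ρ (q ^_) m l * sh (m * suc s) (Tpos s l) n′)) n ≡ F p m l
        term m l refl = trans (cong (qb p (m + l) *_)
          (trans (sh-* (p * suc s) (qb m l) _ n) (cong (qb m l *_) (trans (sh-* (p * suc s) (ρ (q ^_) m l) _ n)
            (cong (ρ (q ^_) m l *_) (trans (sh-sh (p * suc s) (m * suc s) (Tpos s l) n)
              (trans (cong (λ z → sh z (Tpos s l) n) (sym (*-distribʳ-+ (suc s) p m)))
                (sh-cong ((p + m) * suc s) n (Tpos≡V s l)))))))))
          (sym (*-assoc (qb p (m + l)) (qb m l) _))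
      rhs : ∀ k l → anti (λ p m → F p m l) k ≡ qb k l * (ρ φ± k l * sh (k * suc s) (V φ± s l) n)
      rhs k l = begin
        anti (λ p m → F p m l) k
          ≡⟨ anti-cong k term ⟩
        anti (λ p m → qb k l * X * (qb p m * ρ (q ^_) m l)) k
          ≡⟨ anti-*ˡ (qb k l * X) _ k ⟩
        qb k l * X * anti (λ p m → qb p m * ρ (q ^_) m l) k
          ≡⟨ cong (qb k l * X *_) (q-binomial-theorem l k) ⟩
        qb k l * X * ρ φ± k l
          ≡⟨ l₄ (qb k l) X (ρ φ± k l) ⟩
        qb k l * (ρ φ± k l * X) ∎
        where
        X = sh (k * suc s) (V φ± s l) n
        l₄ : ∀ a b c → a * b * c ≡ a * (c * b)
        l₄ = solve-∀
        l₅ : ∀ a b c e → a * b * (c * e) ≡ a * e * (b * c)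
        l₅ = solve-∀
        term : ∀ p m → p + m ≡ k → F p m l ≡ qb k l * X * (qb p m * ρ (q ^_) m l)
        term p m refl = trans
          (cong (_* (ρ (q ^_) m l * X)) (qb-trinomial p m l))
          (l₅ (qb (p + m) l) (qb p m) (ρ (q ^_) m l) X)

    -- The largest letter has weight suc n, too heavy to matter.
    Tneg≡V : ∀ d n → Tneg n d n ≡ V φ± (suc n) d n
    Tneg≡V d n = trans (sym (L-heavy d)) (Tpos≡V (suc n) d n)
      where
      L-heavy : ∀ r {u} → L (Tneg n) 𝟙 (suc n) u r n ≡ Tneg n (u + r) n
      L-heavy zero    {u} = cong (λ z → Tneg n z n) (sym (+-identityʳ u))
      L-heavy (suc r) {u} = begin
        L (Tneg n) 𝟙 (suc n) (suc u) r n + q ^ u * 1 * sh (suc n) (L (Tneg n) 𝟙 (suc n) u r) n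
          ≡⟨ cong₂ _+_ (L-heavy r) (cong (q ^ u * 1 *_) (sh-small (suc n) _ n (n<1+n n))) ⟩
        Tneg n (suc u + r) n + q ^ u * 1 * 0 ≡⟨ trans (cong (Tneg n (suc u + r) n +_) (*-zeroʳ (q ^ u * 1))) (+-identityʳ _) ⟩
        Tneg n (suc u + r) n                 ≡⟨ cong (λ z → Tneg n z n) (+-suc u r) ⟨
        Tneg n (u + suc r) n                 ∎

  -- Finite sums over indices and lists.

  sumF : ∀ {n} → (Fin n → ℕ) → ℕ
  sumF {zero}  f = 0
  sumF {suc n} f = f Fin.zero + sumF (f ∘ Fin.suc)

  sumF-cong : ∀ {n} {f g : Fin n → ℕ} → (∀ i → f i ≡ g i) → sumF f ≡ sumF g
  sumF-cong {zero}  h = refl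
  sumF-cong {suc n} h = cong₂ _+_ (h Fin.zero) (sumF-cong (h ∘ Fin.suc))

  sumF-+ : ∀ {n} (f g : Fin n → ℕ) → sumF (λ i → f i + g i) ≡ sumF f + sumF g
  sumF-+ {zero}  f g = refl
  sumF-+ {suc n} f g = trans (cong (f Fin.zero + g Fin.zero +_) (sumF-+ (f ∘ Fin.suc) (g ∘ Fin.suc)))
    (+-interchange (f Fin.zero) (g Fin.zero) _ _)

  sumF-*ˡ : ∀ {n} c (f : Fin n → ℕ) → sumF (λ i → c * f i) ≡ c * sumF f
  sumF-*ˡ {zero}  c f = sym (*-zeroʳ c)
  sumF-*ˡ {suc n} c f = trans (cong (c * f Fin.zero +_) (sumF-*ˡ c (f ∘ Fin.suc)))
    (sym (*-distribˡ-+ c (f Fin.zero) _))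

  sumF-zero : ∀ {n} {f : Fin n → ℕ} → (∀ i → f i ≡ 0) → sumF f ≡ 0
  sumF-zero {zero}  h = refl
  sumF-zero {suc n} h = cong₂ _+_ (h Fin.zero) (sumF-zero (h ∘ Fin.suc))

  sumF-const : ∀ n c → sumF {n} (λ _ → c) ≡ n * c
  sumF-const zero    c = refl
  sumF-const (suc n) c = cong (c +_) (sumF-const n c)

  sumF-punchIn : ∀ {n} (i : Fin (suc n)) (f : Fin (suc n) → ℕ) → sumF f ≡ f i + sumF (f ∘ punchIn i)
  sumF-punchIn         Fin.zero    f = refl
  sumF-punchIn {suc n} (Fin.suc i) f = trans
    (cong (f Fin.zero +_) (sumF-punchIn i (f ∘ Fin.suc)))
    (lem (f Fin.zero) (f (Fin.suc i)) _)
    where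
    lem : ∀ x y z → x + (y + z) ≡ y + (x + z)
    lem = solve-∀

  sumL : ∀ {A : Set} → (A → ℕ) → List A → ℕ
  sumL f xs = sum (map f xs)

  sumL-cong : ∀ {A : Set} {f g : A → ℕ} (xs : List A) → (∀ x → f x ≡ g x) → sumL f xs ≡ sumL g xs
  sumL-cong []       h = refl
  sumL-cong (x ∷ xs) h = cong₂ _+_ (h x) (sumL-cong xs h)

  sumL-++ : ∀ {A : Set} (f : A → ℕ) xs ys → sumL f (xs ++ ys) ≡ sumL f xs + sumL f ys
  sumL-++ f xs ys = trans (cong sum (map-++ f xs ys)) (sum-++ (map f xs) (map f ys))

  sumL-*ˡ : ∀ {A : Set} c (f : A → ℕ) xs → sumL (λ x → c * f x) xs ≡ c * sumL f xs
  sumL-*ˡ c f []       = sym (*-zeroʳ c)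
  sumL-*ˡ c f (x ∷ xs) = trans (cong (c * f x +_) (sumL-*ˡ c f xs)) (sym (*-distribˡ-+ c (f x) _))

  sumL-map : ∀ {A B : Set} (f : B → ℕ) (g : A → B) xs → sumL f (map g xs) ≡ sumL (f ∘ g) xs
  sumL-map f g []       = refl
  sumL-map f g (x ∷ xs) = cong (f (g x) +_) (sumL-map f g xs)

  sumL-concatMap : ∀ {A B : Set} (f : B → ℕ) (g : A → List B) xs →
    sumL f (concatMap g xs) ≡ sumL (λ x → sumL f (g x)) xs
  sumL-concatMap f g []       = refl
  sumL-concatMap f g (x ∷ xs) = trans (sumL-++ f (g x) (concatMap g xs)) (cong (sumL f (g x) +_) (sumL-concatMap f g xs))

  sumL-tabulate : ∀ {A : Set} {n} (f : A → ℕ) (g : Fin n → A) → sumL f (tabulate g) ≡ sumF (f ∘ g)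
  sumL-tabulate {n = zero}  f g = refl
  sumL-tabulate {n = suc n} f g = cong (f (g Fin.zero) +_) (sumL-tabulate f (g ∘ Fin.suc))

  sumL-allFin : ∀ n (f : Fin n → ℕ) → sumL f (allFin n) ≡ sumF f
  sumL-allFin n f = sumL-tabulate f id

  sumL-pairs : ∀ d (f : Fin d × Fin d → ℕ) → sumL f (pairs d) ≡ sumF (λ i → sumF (λ j → f (i , j)))
  sumL-pairs d f = begin
    sumL f (pairs d)
      ≡⟨ sumL-concatMap f _ (allFin d) ⟩
    sumL (λ i → sumL f (map (i ,_) (allFin d))) (allFin d)
      ≡⟨ sumL-allFin d _ ⟩
    sumF (λ i → sumL f (map (i ,_) (allFin d)))
      ≡⟨ sumF-cong (λ i → trans (sumL-map f (i ,_) (allFin d)) (sumL-allFin d _)) ⟩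
    sumF (λ i → sumF (λ j → f (i , j))) ∎

  I : Bool → ℕ
  I b = if b then 1 else 0

  I-∧ : ∀ a b → I (a ∧ b) ≡ I a * I b
  I-∧ true  b = sym (+-identityʳ (I b))
  I-∧ false b = refl

  sumL-filter : ∀ {A : Set} (f : A → ℕ) (p : A → Bool) xs →
    sumL f (filter (λ x → p x BP.≟ true) xs) ≡ sumL (λ x → I (p x) * f x) xs
  sumL-filter f p []       = refl
  sumL-filter f p (x ∷ xs) with p x
  ... | true  = cong₂ _+_ (sym (+-identityʳ (f x))) (sumL-filter f p xs)
  ... | false = sumL-filter f p xs

  length-filter : ∀ {A : Set} (p : A → Bool) xs →
    length (filter (λ x → p x BP.≟ true) xs) ≡ sumL (I ∘ p) xs
  length-filter p []       = refl
  length-filter p (x ∷ xs) with p x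
  ... | true  = cong suc (length-filter p xs)
  ... | false = length-filter p xs

  ⌊<?⌋ : ∀ m n → ⌊ m <? n ⌋ ≡ (m <ᵇ n)
  ⌊<?⌋ m n = isYes≗does (m <? n)

  ⌊≟⌋ : ∀ m n → ⌊ m ≟ n ⌋ ≡ (m ≡ᵇ n)
  ⌊≟⌋ m n = isYes≗does (m ≟ n)

  -- Products of geometric series as limits of t-binomial coefficients

  Σ< : ℕ → (ℕ → ℕ) → ℕ
  Σ< zero    f = 0
  Σ< (suc m) f = Σ< m f + f m

  Σ<-cong : ∀ m {f g : ℕ → ℕ} → (∀ i → f i ≡ g i) → Σ< m f ≡ Σ< m g
  Σ<-cong zero    h = refl
  Σ<-cong (suc m) h = cong₂ _+_ (Σ<-cong m h) (h m)

  Σ<-+ : ∀ a c (f : ℕ → ℕ) → Σ< (a + c) f ≡ Σ< a f + Σ< c (λ i → f (a + i))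
  Σ<-+ a zero    f = trans (cong (λ z → Σ< z f) (+-identityʳ a)) (sym (+-identityʳ _))
  Σ<-+ a (suc c) f = begin
    Σ< (a + suc c) f ≡⟨ cong (λ z → Σ< z f) (+-suc a c) ⟩
    Σ< (a + c) f + f (a + c) ≡⟨ cong (_+ f (a + c)) (Σ<-+ a c f) ⟩
    Σ< a f + Σ< c (λ i → f (a + i)) + f (a + c) ≡⟨ +-assoc (Σ< a f) _ _ ⟩
    Σ< a f + (Σ< c (λ i → f (a + i)) + f (a + c)) ∎

  Σ<-zero : ∀ m {f : ℕ → ℕ} → (∀ i → i < m → f i ≡ 0) → Σ< m f ≡ 0
  Σ<-zero zero    h = refl
  Σ<-zero (suc m) h = cong₂ _+_ (Σ<-zero m (λ i i<m → h i (m<n⇒m<1+n i<m))) (h m (n<1+n m))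

  sh-Σ< : ∀ k m (f : ℕ → Series) n → sh k (λ n′ → Σ< m (λ i → f i n′)) n ≡ Σ< m (λ i → sh k (f i) n)
  sh-Σ< k zero    f n = sh-zero k n (λ _ → refl)
  sh-Σ< k (suc m) f n = trans (sh-+ k (λ n′ → Σ< m (λ i → f i n′)) (f m) n) (cong (_+ sh k (f m) n) (sh-Σ< k m f n))

  -- G c d is the t-binomial coefficient [c + d choose d], the generating function of
  -- partitions in a c × d box.
  G : ℕ → ℕ → Series
  G c zero    n = oneS n
  G c (suc d) n = Σ< (suc c) (λ i → sh i (G i d) n)

  G-0 : ∀ d n → G 0 d n ≡ oneS n
  G-0 zero    n = refl
  G-0 (suc d) n = G-0 d n

  -- `G` is defined by removing the largest part of a partition; here the smallest part decides.
  -- Either it is 0 and is dropped, or all d + 1 parts are positive and are lowered by one.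
  G-dual : ∀ c d n → G (suc c) (suc d) n ≡ G (suc c) d n + sh (suc d) (G c (suc d)) n
  G-dual zero zero n = refl
  G-dual (suc c) zero n = begin
    G (suc c) 1 n + sh (suc (suc c)) oneS n
      ≡⟨ cong (_+ sh (suc (suc c)) oneS n) (G-dual c zero n) ⟩
    oneS n + sh 1 (G c 1) n + sh (suc (suc c)) oneS n
      ≡⟨ +-assoc (oneS n) _ _ ⟩
    oneS n + (sh 1 (G c 1) n + sh (suc (suc c)) oneS n)
      ≡⟨ cong (λ z → oneS n + (sh 1 (G c 1) n + z)) (sh-sh 1 (suc c) oneS n) ⟨
    oneS n + (sh 1 (G c 1) n + sh 1 (sh (suc c) oneS) n)
      ≡⟨ cong (oneS n +_) (sh-+ 1 (G c 1) (sh (suc c) oneS) n) ⟨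
    oneS n + sh 1 (G (suc c) 1) n ∎
  G-dual zero (suc d) n = begin
    G 0 (suc (suc d)) n + sh 1 (G 1 (suc d)) n
      ≡⟨ cong (G 0 (suc (suc d)) n +_) (trans (sh-cong 1 n (G-dual zero d)) (sh-+ 1 (G 1 d) _ n)) ⟩
    G 0 (suc (suc d)) n + (sh 1 (G 1 d) n + sh 1 (sh (suc d) (G 0 (suc d))) n)
      ≡⟨ cong (λ z → G 0 (suc (suc d)) n + (sh 1 (G 1 d) n + z)) (sh-sh 1 (suc d) (G 0 (suc d)) n) ⟩
    G 0 (suc (suc d)) n + (sh 1 (G 1 d) n + sh (suc (suc d)) (G 0 (suc d)) n)
      ≡⟨ +-assoc (G 0 (suc (suc d)) n) _ _ ⟨
    G 1 (suc d) n + sh (suc (suc d)) (G 0 (suc (suc d))) n ∎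
  G-dual (suc c) (suc d) n = begin
    G (suc c) (suc (suc d)) n + sh (suc (suc c)) (G (suc (suc c)) (suc d)) n
      ≡⟨ cong₂ _+_ (G-dual c (suc d) n)
           (trans (sh-cong (suc (suc c)) n (G-dual (suc c) d)) (sh-+ (suc (suc c)) (G (suc (suc c)) d) _ n)) ⟩
    (G (suc c) (suc d) n + sh (suc (suc d)) (G c (suc (suc d))) n)
      + (sh (suc (suc c)) (G (suc (suc c)) d) n + sh (suc (suc c)) (sh (suc d) (G (suc c) (suc d))) n)
      ≡⟨ +-interchange (G (suc c) (suc d) n) _ _ _ ⟩
    G (suc (suc c)) (suc d) n
      + (sh (suc (suc d)) (G c (suc (suc d))) n + sh (suc (suc c)) (sh (suc d) (G (suc c) (suc d))) n)
      ≡⟨ cong (λ z → G (suc (suc c)) (suc d) n + (sh (suc (suc d)) (G c (suc (suc d))) n + z)) swap ⟩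
    G (suc (suc c)) (suc d) n
      + (sh (suc (suc d)) (G c (suc (suc d))) n + sh (suc (suc d)) (sh (suc c) (G (suc c) (suc d))) n)
      ≡⟨ cong (G (suc (suc c)) (suc d) n +_) (sh-+ (suc (suc d)) (G c (suc (suc d))) _ n) ⟨
    G (suc (suc c)) (suc d) n + sh (suc (suc d)) (G (suc c) (suc (suc d))) n ∎
    where
    swap : sh (suc (suc c)) (sh (suc d) (G (suc c) (suc d))) n ≡ sh (suc (suc d)) (sh (suc c) (G (suc c) (suc d))) n
    swap = trans (sh-sh (suc (suc c)) (suc d) _ n) (trans
      (cong (λ z → sh z (G (suc c) (suc d)) n) (cong suc (trans (cong suc (+-comm c (suc d))) (cong suc (sym (+-suc d c))))))
      (sym (sh-sh (suc (suc d)) (suc c) _ n)))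

  sh-cong-≤ : ∀ k {f g : Series} n → (∀ m → k + m ≤ n → f m ≡ g m) → sh k f n ≡ sh k g n
  sh-cong-≤ zero    n       h = h n ≤-refl
  sh-cong-≤ (suc k) zero    h = refl
  sh-cong-≤ (suc k) (suc n) h = sh-cong-≤ k n (λ m le → h m (s≤s le))

  ⋆-anti : ∀ (f g : Series) n → (f ⋆ g) n ≡ anti (λ k l → f k * g l) n
  ⋆-anti f g n = trans (go (λ k → f k * g (n ∸ k)) id n)
    (anti-cong n (λ k l e → cong (λ z → f k * g z) (trans (cong (_∸ k) (sym e)) (m+n∸m≡n k l))))
    where
    go : ∀ (h g : ℕ → ℕ) n → sum (map h (applyUpTo g (suc n))) ≡ anti (λ k _ → h (g k)) n
    go h g zero    = +-identityʳ _
    go h g (suc n) = cong (h (g 0) +_) (go h (g ∘ suc) n)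

  anti-sh : ∀ w (f g : Series) n → anti (λ k l → f k * sh w g l) n ≡ sh w (λ m → anti (λ k l → f k * g l) m) n
  anti-sh zero    f g n    = refl
  anti-sh (suc w) f g zero = *-zeroʳ (f 0)
  anti-sh (suc w) f g (suc n) = begin
    anti (λ k l → f k * sh (suc w) g l) (suc n)
      ≡⟨ anti-last (λ k l → f k * sh (suc w) g l) n ⟩
    anti (λ k l → f k * sh w g l) n + f (suc n) * 0
      ≡⟨ trans (cong (anti (λ k l → f k * sh w g l) n +_) (*-zeroʳ (f (suc n)))) (+-identityʳ _) ⟩
    anti (λ k l → f k * sh w g l) n
      ≡⟨ anti-sh w f g n ⟩
    sh w (λ m → anti (λ k l → f k * g l) m) n ∎

  anti-oneS : ∀ (f : Series) n → anti (λ k l → f k * oneS l) n ≡ f n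
  anti-oneS f zero    = *-identityʳ (f 0)
  anti-oneS f (suc n) = trans (cong (_+ anti (λ k l → f (suc k) * oneS l) n) (*-zeroʳ (f 0))) (anti-oneS (f ∘ suc) n)

  geomS-step : ∀ j n → geomS (suc j) n ≡ oneS n + sh (suc j) (geomS (suc j)) n
  geomS-step j n with suc j ≤? n
  ... | yes j<n = begin
    geomS (suc j) n
      ≡⟨ cong (geomS (suc j)) eq ⟨
    geomS (suc j) (suc j + (n ∸ suc j))
      ≡⟨ cong (if_then 1 else 0) (trans (isYes≗does (suc j ∣? (suc j + (n ∸ suc j)))) (trans
           (does-⇔ (mk⇔ (λ d → ∣m+n∣m⇒∣n d ∣-refl) (∣m∣n⇒∣m+n ∣-refl))
              (suc j ∣? (suc j + (n ∸ suc j))) (suc j ∣? (n ∸ suc j)))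
           (sym (isYes≗does (suc j ∣? (n ∸ suc j)))))) ⟩
    geomS (suc j) (n ∸ suc j)
      ≡⟨ sh-big (suc j) (geomS (suc j)) (n ∸ suc j) ⟨
    sh (suc j) (geomS (suc j)) (suc j + (n ∸ suc j))
      ≡⟨ cong (λ z → oneS z + sh (suc j) (geomS (suc j)) z) eq ⟩
    oneS n + sh (suc j) (geomS (suc j)) n ∎
    where eq = m+[n∸m]≡n j<n
  geomS-step j zero    | no _ = cong (if_then 1 else 0) (trans (isYes≗does (suc j ∣? 0))
    (dec-true (suc j ∣? 0) (suc j ∣0)))
  geomS-step j (suc n) | no j≮n = trans
    (cong (if_then 1 else 0) (trans (isYes≗does (suc j ∣? suc n))
      (dec-false (suc j ∣? suc n) (>⇒∤ (≰⇒> j≮n)))))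
    (sym (sh-small (suc j) (geomS (suc j)) (suc n) (≰⇒> j≮n)))

  prodGeom-step : ∀ d n → prodGeom (suc d) n ≡ prodGeom d n + sh (suc d) (prodGeom (suc d)) n
  prodGeom-step d n = begin
    prodGeom (suc d) n
      ≡⟨ ⋆-anti f g n ⟩
    anti (λ k l → f k * g l) n
      ≡⟨ anti-cong′ n (λ k l → trans (cong (f k *_) (geomS-step d l)) (*-distribˡ-+ (f k) (oneS l) _)) ⟩
    anti (λ k l → f k * oneS l + f k * sh (suc d) g l) n
      ≡⟨ anti-+ (λ k l → f k * oneS l) _ n ⟩
    anti (λ k l → f k * oneS l) n + anti (λ k l → f k * sh (suc d) g l) n
      ≡⟨ cong₂ _+_ (anti-oneS f n) (anti-sh (suc d) f g n) ⟩
    f n + sh (suc d) (λ m → anti (λ k l → f k * g l) m) n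
      ≡⟨ cong (f n +_) (sh-cong (suc d) n (λ m → sym (⋆-anti f g m))) ⟩
    f n + sh (suc d) (prodGeom (suc d)) n ∎
    where
    f = prodGeom d
    g = geomS (suc d)

  -- The parts of a partition of n are at most n, so a bound c ≥ n on the parts is invisible.
  -- Formally `G-dual` and `prodGeom-step` are the same recursion, and the shift by d + 1
  -- compensates for the smaller bound c.
  G≡prodGeom : ∀ c d n → n ≤ c → G c d n ≡ prodGeom d n
  G≡prodGeom c zero n _ = refl
  G≡prodGeom zero (suc d) zero _ = trans (G≡prodGeom zero d zero z≤n) (trans
    (sym (+-identityʳ _)) (sym (prodGeom-step d 0)))
  G≡prodGeom (suc c) (suc d) n le = begin
    G (suc c) (suc d) n
      ≡⟨ G-dual c d n ⟩
    G (suc c) d n + sh (suc d) (G c (suc d)) n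
      ≡⟨ cong₂ _+_ (G≡prodGeom (suc c) d n le)
           (sh-cong-≤ (suc d) n (λ m le′ → G≡prodGeom c (suc d) m
             (≤-pred (≤-trans (s≤s (m≤n+m m d)) (≤-trans le′ le))))) ⟩
    prodGeom d n + sh (suc d) (prodGeom (suc d)) n
      ≡⟨ prodGeom-step d n ⟨
    prodGeom (suc d) n ∎

  -- Comparison of signed values by cases on the signs.

  ltS : ∀ {D} → SVal D → SVal D → Bool
  ltS (false , m) (false , l) = toℕ m <ᵇ toℕ l
  ltS (false , m) (true  , l) = false
  ltS (true  , m) (false , l) = true
  ltS (true  , m) (true  , l) = toℕ l <ᵇ toℕ m

  <ℤ-ltS : ∀ {D} (x y : SVal D) → (toℤ x <ℤ toℤ y) ≡ ltS x y
  <ℤ-ltS x@(false , m) y@(false , l) = isYes≗does (toℤ x ℤP.<? toℤ y)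
  <ℤ-ltS (false , m) (true  , l) = refl
  <ℤ-ltS (true  , m) (false , l) = refl
  <ℤ-ltS x@(true  , m) y@(true  , l) = isYes≗does (toℤ x ℤP.<? toℤ y)

  -- The sign of the product of the two values decides the direction of the comparison: equal signs
  -- give an ordinary inversion, opposite signs count exactly when the first value is negative.
  invS : ∀ {D} → SVal D → SVal D → Bool
  invS x@(false , _) y@(false , _) = ltS y x
  invS x@(false , _) y@(true  , _) = ltS x y
  invS x@(true  , _) y@(false , _) = ltS x y
  invS x@(true  , _) y@(true  , _) = ltS y x

  ⌊⌋-⇔ : ∀ {P Q : Set} (P? : Dec P) (Q? : Dec Q) → (P → Q) → (Q → P) → ⌊ P? ⌋ ≡ ⌊ Q? ⌋
  ⌊⌋-⇔ P? Q? f g = trans (isYes≗does P?) (trans (does-⇔ (mk⇔ f g) P? Q?) (sym (isYes≗does Q?)))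

  private
    0<y-x : ∀ x y → x ℤ.< y → (ℤ.+ 0) ℤ.< y ℤ.- x
    0<y-x x y lt = subst (ℤ._< y ℤ.- x) (ℤP.+-inverseʳ x) (ℤP.+-monoˡ-< (ℤ.- x) lt)

    0<y-x⁻ : ∀ x y → (ℤ.+ 0) ℤ.< y ℤ.- x → x ℤ.< y
    0<y-x⁻ x y lt = subst₂ ℤ._<_ (ℤP.+-identityˡ x)
      (trans (ℤP.+-assoc y (ℤ.- x) x) (trans (cong (λ z → y ℤ.+ z) (ℤP.+-inverseˡ x)) (ℤP.+-identityʳ y)))
      (ℤP.+-monoˡ-< x lt)

    y-x<0 : ∀ x y → y ℤ.< x → y ℤ.- x ℤ.< (ℤ.+ 0)
    y-x<0 x y lt = subst (y ℤ.- x ℤ.<_) (ℤP.+-inverseʳ x) (ℤP.+-monoˡ-< (ℤ.- x) lt)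

    y-x<0⁻ : ∀ x y → y ℤ.- x ℤ.< (ℤ.+ 0) → y ℤ.< x
    y-x<0⁻ x y lt = subst₂ ℤ._<_
      (trans (ℤP.+-assoc y (ℤ.- x) x) (trans (cong (λ z → y ℤ.+ z) (ℤP.+-inverseˡ x)) (ℤP.+-identityʳ y)))
      (ℤP.+-identityˡ x) (ℤP.+-monoˡ-< x lt)

    pos-factor : ∀ A x y → ((ℤ.+ 0) <ℤ (ℤ.+ suc A ℤ.* (x ℤ.- y))) ≡ (y <ℤ x)
    pos-factor A x y = ⌊⌋-⇔ ((ℤ.+ 0) ℤP.<? (ℤ.+ suc A ℤ.* (x ℤ.- y))) (y ℤP.<? x)
      (λ p → 0<y-x⁻ y x (ℤP.*-cancelˡ-<-nonNeg (ℤ.+ suc A) (subst (ℤ._< ℤ.+ suc A ℤ.* (x ℤ.- y)) (sym (ℤP.*-zeroʳ (ℤ.+ suc A))) p)))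
      (λ p → subst (ℤ._< ℤ.+ suc A ℤ.* (x ℤ.- y)) (ℤP.*-zeroʳ (ℤ.+ suc A)) (ℤP.*-monoˡ-<-pos (ℤ.+ suc A) (0<y-x y x p)))

    neg-factor : ∀ A x y → ((ℤ.+ 0) <ℤ (-[1+ A ] ℤ.* (x ℤ.- y))) ≡ (x <ℤ y)
    neg-factor A x y = ⌊⌋-⇔ ((ℤ.+ 0) ℤP.<? (-[1+ A ] ℤ.* (x ℤ.- y))) (x ℤP.<? y)
      (λ p → y-x<0⁻ y x (ℤP.*-cancelˡ-<-neg A (subst (ℤ._< -[1+ A ] ℤ.* (x ℤ.- y)) (sym (ℤP.*-zeroʳ -[1+ A ])) p)))
      (λ p → subst (ℤ._< -[1+ A ] ℤ.* (x ℤ.- y)) (ℤP.*-zeroʳ -[1+ A ]) (ℤP.*-monoˡ-<-neg -[1+ A ] (y-x<0 y x p)))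

  <ℤ-invS : ∀ {D} (x y : SVal D) →
    ((ℤ.+ 0) <ℤ (toℤ x ℤ.* toℤ y ℤ.* (toℤ x ℤ.- toℤ y))) ≡ invS x y
  <ℤ-invS x@(false , m) y@(false , l) = trans (pos-factor (toℕ l + toℕ m * suc (toℕ l)) (toℤ x) (toℤ y)) (<ℤ-ltS y x)
  <ℤ-invS x@(false , m) y@(true  , l) = trans (neg-factor (toℕ l + toℕ m * suc (toℕ l)) (toℤ x) (toℤ y)) (<ℤ-ltS x y)
  <ℤ-invS x@(true  , m) y@(false , l) = trans (neg-factor (toℕ l + toℕ m * suc (toℕ l)) (toℤ x) (toℤ y)) (<ℤ-ltS x y)
  <ℤ-invS x@(true  , m) y@(true  , l) = trans (pos-factor (toℕ l + toℕ m * suc (toℕ l)) (toℤ x) (toℤ y)) (<ℤ-ltS y x)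

  private variable
    n d D : ℕ

  punchIn-<ᵇ : (i : Fin (suc n)) (l : Fin n) → (toℕ (punchIn i l) <ᵇ toℕ i) ≡ (toℕ l <ᵇ toℕ i)
  punchIn-<ᵇ Fin.zero    l           = refl
  punchIn-<ᵇ (Fin.suc i) Fin.zero    = refl
  punchIn-<ᵇ (Fin.suc i) (Fin.suc l) = punchIn-<ᵇ i l

  <ᵇ-punchIn : (i : Fin (suc n)) (l : Fin n) → (toℕ i <ᵇ toℕ (punchIn i l)) ≡ not (toℕ l <ᵇ toℕ i)
  <ᵇ-punchIn Fin.zero    l           = refl
  <ᵇ-punchIn (Fin.suc i) Fin.zero    = refl
  <ᵇ-punchIn (Fin.suc i) (Fin.suc l) = <ᵇ-punchIn i l

  punchIn-mono-<ᵇ : (i : Fin (suc n)) (l m : Fin n) →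
    (toℕ (punchIn i l) <ᵇ toℕ (punchIn i m)) ≡ (toℕ l <ᵇ toℕ m)
  punchIn-mono-<ᵇ Fin.zero    l           m           = refl
  punchIn-mono-<ᵇ (Fin.suc i) Fin.zero    Fin.zero    = refl
  punchIn-mono-<ᵇ (Fin.suc i) Fin.zero    (Fin.suc m) = refl
  punchIn-mono-<ᵇ (Fin.suc i) (Fin.suc l) Fin.zero    = refl
  punchIn-mono-<ᵇ (Fin.suc i) (Fin.suc l) (Fin.suc m) = punchIn-mono-<ᵇ i l m

  punchIn-≡ᵇ : (i : Fin (suc n)) (l m : Fin n) →
    (toℕ (punchIn i l) ≡ᵇ toℕ (punchIn i m)) ≡ (toℕ l ≡ᵇ toℕ m)
  punchIn-≡ᵇ Fin.zero    l           m           = refl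
  punchIn-≡ᵇ (Fin.suc i) Fin.zero    Fin.zero    = refl
  punchIn-≡ᵇ (Fin.suc i) Fin.zero    (Fin.suc m) = refl
  punchIn-≡ᵇ (Fin.suc i) (Fin.suc l) Fin.zero    = refl
  punchIn-≡ᵇ (Fin.suc i) (Fin.suc l) (Fin.suc m) = punchIn-≡ᵇ i l m

  ∸-punchIn : (i : Fin (suc n)) (l : Fin n) → suc n ∸ toℕ (punchIn i l) ≡ (n ∸ toℕ l) + I (toℕ l <ᵇ toℕ i)
  ∸-punchIn         Fin.zero    l           = sym (+-identityʳ _)
  ∸-punchIn {suc n} (Fin.suc i) Fin.zero    = cong suc (+-comm 1 n)
  ∸-punchIn {suc n} (Fin.suc i) (Fin.suc l) = ∸-punchIn i l

  punch : SVal (suc D) → SVal D → SVal (suc D)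
  punch a (β , l) = β , punchIn (proj₂ a) l

  ltS-punch : (a : SVal (suc D)) (x y : SVal D) → ltS (punch a x) (punch a y) ≡ ltS x y
  ltS-punch a (false , l) (false , m) = punchIn-mono-<ᵇ (proj₂ a) l m
  ltS-punch a (false , l) (true  , m) = refl
  ltS-punch a (true  , l) (false , m) = refl
  ltS-punch a (true  , l) (true  , m) = punchIn-mono-<ᵇ (proj₂ a) m l

  invS-punch : (a : SVal (suc D)) (x y : SVal D) → invS (punch a x) (punch a y) ≡ invS x y
  invS-punch a x@(false , _) y@(false , _) = ltS-punch a y x
  invS-punch a x@(false , _) y@(true  , _) = refl
  invS-punch a x@(true  , _) y@(false , _) = refl
  invS-punch a x@(true  , _) y@(true  , _) = ltS-punch a y x

  -- Signed permutations as trees: the first value, then the standardised remaining values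

  infixr 5 _⊲_
  _⊲_ : SVal (suc D) → (Fin n → SVal D) → Fin (suc n) → SVal (suc D)
  a ⊲ h = a ◂ (punch a ∘ h)

  sumS : (SVal D → ℕ) → ℕ
  sumS f = sumF (λ i → f (false , i)) + sumF (λ i → f (true , i))

  nil : Fin 0 → SVal 0
  nil ()

  PS : ∀ d → ((Fin d → SVal d) → ℕ) → ℕ
  PS zero    F = F nil
  PS (suc d) F = sumS (λ a → PS d (λ h → F (a ⊲ h)))

  -- The functions that `PS` sums over, as a predicate: facts that hold for signed permutations
  -- only, such as `lpm-⊲`, can then be used inside the sum through `PS-cong`.
  data Tree : ∀ {d} → (Fin d → SVal d) → Set where
    leaf : Tree nil
    node : ∀ {d} {h : Fin d → SVal d} a → Tree h → Tree (a ⊲ h)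

  sumS-cong : {f g : SVal D → ℕ} → (∀ x → f x ≡ g x) → sumS f ≡ sumS g
  sumS-cong h = cong₂ _+_ (sumF-cong (λ i → h (false , i))) (sumF-cong (λ i → h (true , i)))

  sumS-+ : (f g : SVal D → ℕ) → sumS (λ x → f x + g x) ≡ sumS f + sumS g
  sumS-+ f g = trans (cong₂ _+_ (sumF-+ (λ i → f (false , i)) (λ i → g (false , i)))
                                (sumF-+ (λ i → f (true , i)) (λ i → g (true , i))))
    (+-interchange (sumF (λ i → f (false , i))) _ _ _)

  sumS-*ˡ : ∀ c (f : SVal D → ℕ) → sumS (λ x → c * f x) ≡ c * sumS f
  sumS-*ˡ c f = trans (cong₂ _+_ (sumF-*ˡ c (λ i → f (false , i))) (sumF-*ˡ c (λ i → f (true , i))))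
    (sym (*-distribˡ-+ c (sumF (λ i → f (false , i))) _))

  PS-cong : ∀ d {F F′ : (Fin d → SVal d) → ℕ} → (∀ h → Tree h → F h ≡ F′ h) → PS d F ≡ PS d F′
  PS-cong zero    e = e nil leaf
  PS-cong (suc d) e = sumS-cong (λ a → PS-cong d (λ h t → e (a ⊲ h) (node a t)))

  PS-+ : ∀ d (F F′ : (Fin d → SVal d) → ℕ) → PS d (λ h → F h + F′ h) ≡ PS d F + PS d F′
  PS-+ zero    F F′ = refl
  PS-+ (suc d) F F′ = trans (sumS-cong (λ a → PS-+ d (λ h → F (a ⊲ h)) (λ h → F′ (a ⊲ h))))
    (sumS-+ (λ a → PS d (λ h → F (a ⊲ h))) (λ a → PS d (λ h → F′ (a ⊲ h))))

  PS-*ˡ : ∀ d c (F : (Fin d → SVal d) → ℕ) → PS d (λ h → c * F h) ≡ c * PS d F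
  PS-*ˡ zero    c F = refl
  PS-*ˡ (suc d) c F = trans (sumS-cong (λ a → PS-*ˡ d c (λ h → F (a ⊲ h)))) (sumS-*ˡ c (λ a → PS d (λ h → F (a ⊲ h))))

  PS-zero : ∀ d {F : (Fin d → SVal d) → ℕ} → (∀ h → F h ≡ 0) → PS d F ≡ 0
  PS-zero d {F} e = trans (PS-cong d (λ h _ → e h)) (PS-*ˡ d 0 F)

  sumS-sh : ∀ k (f : SVal D → Series) n → sh k (λ m → sumS (λ x → f x m)) n ≡ sumS (λ x → sh k (f x) n)
  sumS-sh zero    f n       = refl
  sumS-sh {D} (suc k) f zero    = sym (cong₂ _+_ (sumF-zero {D} (λ _ → refl)) (sumF-zero {D} (λ _ → refl)))
  sumS-sh (suc k) f (suc n) = sumS-sh k f n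

  PS-sh : ∀ d k (F : (Fin d → SVal d) → Series) n → sh k (λ m → PS d (λ h → F h m)) n ≡ PS d (λ h → sh k (F h) n)
  PS-sh zero    k F n = refl
  PS-sh (suc d) k F n = trans (sumS-sh k (λ a m → PS d (λ h → F (a ⊲ h) m)) n) (sumS-cong (λ a → PS-sh d k (λ h → F (a ⊲ h)) n))

  -- Functions are known to be equal only pointwise, so a summand must be invariant under pointwise
  -- equality before its argument may be rewritten as `a ◂ f` or `a ⊲ h`.
  Resp : ((Fin n → SVal D) → ℕ) → Set
  Resp F = ∀ f g → (∀ i → f i ≡ g i) → F f ≡ F g

  AF : ∀ n D → ((Fin n → SVal D) → ℕ) → ℕ
  AF n D F = sumL F (allFuns n (allSVal D))

  sumL-allSVal : ∀ D (f : SVal D → ℕ) → sumL f (allSVal D) ≡ sumS f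
  sumL-allSVal D f = begin
    sumL f (allSVal D)
      ≡⟨ sumL-concatMap f (λ b → map (b ,_) (allFin D)) (true ∷ false ∷ []) ⟩
    sumL f (map (true ,_) (allFin D)) + (sumL f (map (false ,_) (allFin D)) + 0)
      ≡⟨ cong₂ (λ x y → x + (y + 0)) (part true) (part false) ⟩
    sumF (λ i → f (true , i)) + (sumF (λ i → f (false , i)) + 0)
      ≡⟨ trans (cong (sumF (λ i → f (true , i)) +_) (+-identityʳ _)) (+-comm (sumF (λ i → f (true , i))) _) ⟩
    sumS f ∎
    where
    part : ∀ b → sumL f (map (b ,_) (allFin D)) ≡ sumF (λ i → f (b , i))
    part b = trans (sumL-map f (b ,_) (allFin D)) (sumL-allFin D _)

  AF-suc : ∀ n D (F : (Fin (suc n) → SVal D) → ℕ) → Resp F →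
    AF (suc n) D F ≡ sumS (λ a → AF n D (λ f → F (a ◂ f)))
  AF-suc n D F resp = trans
    (trans (sumL-concatMap F _ (allSVal D))
      (sumL-cong (allSVal D) (λ a → trans (sumL-map F _ (allFuns n (allSVal D)))
        (sumL-cong (allFuns n (allSVal D)) (λ f → resp _ (a ◂ f) (λ { Fin.zero → refl ; (Fin.suc i) → refl }))))))
    (sumL-allSVal D _)

  allF : (Fin n → Bool) → Bool
  allF {zero}  p = true
  allF {suc n} p = p Fin.zero ∧ allF (p ∘ Fin.suc)

  allF-cong : {p p′ : Fin n → Bool} → (∀ i → p i ≡ p′ i) → allF p ≡ allF p′
  allF-cong {zero}  h = refl
  allF-cong {suc n} h = cong₂ _∧_ (h Fin.zero) (allF-cong (h ∘ Fin.suc))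

  allF-true : allF {n} (λ _ → true) ≡ true
  allF-true {zero}  = refl
  allF-true {suc n} = allF-true {n}

  allB-cong : ∀ {A : Set} {p p′ : A → Bool} xs → (∀ x → p x ≡ p′ x) → allB p xs ≡ allB p′ xs
  allB-cong []       h = refl
  allB-cong (x ∷ xs) h = cong₂ _∧_ (h x) (allB-cong xs h)

  allB-++ : ∀ {A : Set} (p : A → Bool) xs ys → allB p (xs ++ ys) ≡ allB p xs ∧ allB p ys
  allB-++ p []       ys = refl
  allB-++ p (x ∷ xs) ys = trans (cong (p x ∧_) (allB-++ p xs ys)) (sym (BP.∧-assoc (p x) _ _))

  allB-pairs : ∀ d (p : Fin d × Fin d → Bool) → allB p (pairs d) ≡ allF (λ i → allF (λ j → p (i , j)))
  allB-pairs d p = outer id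
    where
    inner : ∀ {n} i (g : Fin n → Fin d) → allB p (map (i ,_) (tabulate g)) ≡ allF (λ j → p (i , g j))
    inner {zero}  i g = refl
    inner {suc n} i g = cong (p (i , g Fin.zero) ∧_) (inner i (g ∘ Fin.suc))
    outer : ∀ {n} (g : Fin n → Fin d) →
      allB p (concatMap (λ i → map (i ,_) (allFin d)) (tabulate g)) ≡ allF (λ i → allF (λ j → p (g i , j)))
    outer {zero}  g = refl
    outer {suc n} g = trans (allB-++ p (map (g Fin.zero ,_) (allFin d)) _)
      (cong₂ _∧_ (inner (g Fin.zero) id) (outer (g ∘ Fin.suc)))

  distinct? : SVal D → SVal D → Bool
  distinct? x y = not (toℕ (proj₂ x) ≡ᵇ toℕ (proj₂ y))

  fresh : SVal D → (Fin n → SVal D) → Bool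
  fresh a f = allF (λ j → distinct? a (f j))

  inj? : (Fin n → SVal D) → Bool
  inj? {n = zero}  f = true
  inj? {n = suc n} f = fresh (f Fin.zero) (tail f) ∧ inj? (tail f)

  private
    -- absInjective tests a predicate built from a disjunction local to its definition;
    -- unification makes that predicate available under a name.
    predicateOf : ∀ {A : Set} {p : A → Bool} {xs b} → allB p xs ≡ b → A → Bool
    predicateOf {p = p} _ = p

    P : ∀ {d} (s : Fin d → SVal d) → Fin d × Fin d → Bool
    P {d} s = predicateOf {xs = pairs d} (refl {x = absInjective s})

    P-spec : ∀ {d} (s : Fin d → SVal d) i j → P s (i , j) ≡ not (toℕ i <ᵇ toℕ j) ∨ distinct? (s i) (s j)
    P-spec s i j rewrite ⌊<?⌋ (toℕ i) (toℕ j) | ⌊≟⌋ (toℕ (proj₂ (s i))) (toℕ (proj₂ (s j))) with toℕ i <ᵇ toℕ j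
    ... | true  = refl
    ... | false = refl

  absInjective-inj? : (s : Fin d → SVal d) → absInjective s ≡ inj? s
  absInjective-inj? {d} s = trans (allB-pairs d (P s)) (trans
    (allF-cong (λ i → allF-cong (λ j → P-spec s i j))) (go s))
    where
    go : ∀ {n D} (s : Fin n → SVal D) → allF (λ i → allF (λ j → not (toℕ i <ᵇ toℕ j) ∨ distinct? (s i) (s j))) ≡ inj? s
    go {zero}  s = refl
    go {suc n} s = cong (fresh (s Fin.zero) (tail s) ∧_) (go (tail s))

  inj?-cong : (f g : Fin n → SVal D) → (∀ i → f i ≡ g i) → inj? f ≡ inj? g
  inj?-cong {zero}  f g e = refl
  inj?-cong {suc n} f g e = cong₂ _∧_ (allF-cong (λ j → cong₂ distinct? (e Fin.zero) (e (Fin.suc j)))) (inj?-cong _ _ (e ∘ Fin.suc))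

  inj?-punch : (a : SVal (suc D)) (h : Fin n → SVal D) → inj? (punch a ∘ h) ≡ inj? h
  inj?-punch {n = zero}  a h = refl
  inj?-punch {n = suc n} a h = cong₂ _∧_
    (allF-cong (λ j → cong not (punchIn-≡ᵇ (proj₂ a) (proj₂ (h Fin.zero)) (proj₂ (h (Fin.suc j))))))
    (inj?-punch a (tail h))

  ≡ᵇ-refl : ∀ m → (m ≡ᵇ m) ≡ true
  ≡ᵇ-refl zero    = refl
  ≡ᵇ-refl (suc m) = ≡ᵇ-refl m

  ≡ᵇ-punchIn : (i : Fin (suc n)) (l : Fin n) → (toℕ i ≡ᵇ toℕ (punchIn i l)) ≡ false
  ≡ᵇ-punchIn Fin.zero    l           = refl
  ≡ᵇ-punchIn (Fin.suc i) Fin.zero    = refl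
  ≡ᵇ-punchIn (Fin.suc i) (Fin.suc l) = ≡ᵇ-punchIn i l

  sumS-punch : (a : SVal (suc D)) (F : SVal (suc D) → ℕ) →
    sumS (λ x → I (distinct? a x) * F x) ≡ sumS (F ∘ punch a)
  sumS-punch {D} a F = cong₂ _+_ (half false) (half true)
    where
    i = proj₂ a
    half : ∀ b → sumF (λ j → I (distinct? a (b , j)) * F (b , j)) ≡ sumF (λ l → F (b , punchIn i l))
    half b = trans (sumF-punchIn i (λ j → I (distinct? a (b , j)) * F (b , j))) (cong₂ _+_
      (cong (λ z → I (not z) * F (b , i)) (≡ᵇ-refl (toℕ i)))
      (sumF-cong (λ l → trans (cong (λ z → I (not z) * F (b , punchIn i l)) (≡ᵇ-punchIn i l)) (*-identityˡ _))))

  AF-cong : ∀ n D {F F′ : (Fin n → SVal D) → ℕ} → (∀ f → F f ≡ F′ f) → AF n D F ≡ AF n D F′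
  AF-cong n D e = sumL-cong (allFuns n (allSVal D)) e

  -- Avoiding the absolute value of `a` is a condition on each entry separately, and the values
  -- satisfying it are exactly the image of `punch a`. So the alphabet can be shrunk one entry at a
  -- time.
  AF-punch : ∀ n (a : SVal (suc D)) (F : (Fin n → SVal (suc D)) → ℕ) → Resp F →
    AF n (suc D) (λ g → I (fresh a g) * F g) ≡ AF n D (λ h → F (punch a ∘ h))
  AF-punch zero a F resp = cong (_+ 0) (trans (*-identityˡ _) (resp _ _ (λ ())))
  AF-punch {D} (suc n) a F resp = begin
    AF (suc n) (suc D) (λ g → I (fresh a g) * F g)
      ≡⟨ AF-suc n (suc D) _ (λ f g e → cong₂ _*_ (cong I (allF-cong (λ j → cong (distinct? a) (e j)))) (resp f g e)) ⟩
    sumS (λ x → AF n (suc D) (λ g → I (distinct? a x ∧ fresh a g) * F (x ◂ g)))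
      ≡⟨ sumS-cong (λ x → trans
           (AF-cong n (suc D) (λ g → trans (cong (_* F (x ◂ g)) (I-∧ (distinct? a x) (fresh a g))) (*-assoc (I (distinct? a x)) _ _)))
           (sumL-*ˡ (I (distinct? a x)) _ (allFuns n (allSVal (suc D))))) ⟩
    sumS (λ x → I (distinct? a x) * AF n (suc D) (λ g → I (fresh a g) * F (x ◂ g)))
      ≡⟨ sumS-cong (λ x → cong (I (distinct? a x) *_)
           (AF-punch n a (λ g → F (x ◂ g)) (λ f g e → resp _ _ (λ { Fin.zero → refl ; (Fin.suc i) → e i })))) ⟩
    sumS (λ x → I (distinct? a x) * AF n D (λ h → F (x ◂ (punch a ∘ h))))
      ≡⟨ sumS-punch a (λ x → AF n D (λ h → F (x ◂ (punch a ∘ h)))) ⟩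
    sumS (λ y → AF n D (λ h → F (punch a y ◂ (punch a ∘ h))))
      ≡⟨ sumS-cong (λ y → AF-cong n D (λ h → resp (punch a y ◂ (punch a ∘ h)) (punch a ∘ (y ◂ h)) (λ { Fin.zero → refl ; (Fin.suc i) → refl }))) ⟩
    sumS (λ y → AF n D (λ h → F (punch a ∘ (y ◂ h))))
      ≡⟨ AF-suc n D (λ h → F (punch a ∘ h)) (λ f g e → resp _ _ (λ i → cong (punch a) (e i))) ⟨
    AF (suc n) D (λ h → F (punch a ∘ h)) ∎

  AF-inj? : ∀ d (F : (Fin d → SVal d) → ℕ) → Resp F → AF d d (λ s → I (inj? s) * F s) ≡ PS d F
  AF-inj? zero F resp = trans (+-identityʳ _) (trans (*-identityˡ _) (resp _ _ (λ ())))
  AF-inj? (suc d) F resp = begin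
    AF (suc d) (suc d) (λ s → I (inj? s) * F s)
      ≡⟨ AF-suc d (suc d) _ (λ f g e → cong₂ _*_ (cong I (inj?-cong f g e)) (resp f g e)) ⟩
    sumS (λ a → AF d (suc d) (λ g → I (fresh a g ∧ inj? g) * F (a ◂ g)))
      ≡⟨ sumS-cong (λ a → AF-cong d (suc d) (λ g → trans (cong (_* F (a ◂ g)) (I-∧ (fresh a g) (inj? g))) (*-assoc (I (fresh a g)) _ _))) ⟩
    sumS (λ a → AF d (suc d) (λ g → I (fresh a g) * (I (inj? g) * F (a ◂ g))))
      ≡⟨ sumS-cong (λ a → AF-punch d a (λ g → I (inj? g) * F (a ◂ g)) (λ f g e → cong₂ _*_ (cong I (inj?-cong f g e)) (resp◂ a f g e))) ⟩
    sumS (λ a → AF d d (λ h → I (inj? (punch a ∘ h)) * F (a ⊲ h)))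
      ≡⟨ sumS-cong (λ a → AF-cong d d (λ h → cong (λ z → I z * F (a ⊲ h)) (inj?-punch a h))) ⟩
    sumS (λ a → AF d d (λ h → I (inj? h) * F (a ⊲ h)))
      ≡⟨ sumS-cong (λ a → AF-inj? d (λ h → F (a ⊲ h)) (λ f g e → resp◂ a _ _ (λ i → cong (punch a) (e i)))) ⟩
    PS (suc d) F ∎
    where
    resp◂ : ∀ a f g → (∀ i → f i ≡ g i) → F (a ◂ f) ≡ F (a ◂ g)
    resp◂ a f g e = resp _ _ (λ { Fin.zero → refl ; (Fin.suc i) → e i })

  sumL-signedPerms : ∀ d (F : (Fin d → SVal d) → ℕ) → Resp F → sumL F (signedPerms d) ≡ PS d F
  sumL-signedPerms d F resp = begin
    sumL F (signedPerms d)
      ≡⟨ sumL-filter F absInjective (allFuns d (allSVal d)) ⟩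
    AF d d (λ s → I (absInjective s) * F s)
      ≡⟨ AF-cong d d (λ s → cong (λ z → I z * F s) (absInjective-inj? s)) ⟩
    AF d d (λ s → I (inj? s) * F s)
      ≡⟨ AF-inj? d F resp ⟩
    PS d F ∎

  -- Length, descents and major index under removal of the first value.

  inv : (Fin n → SVal D) → ℕ
  inv {zero}  s = 0
  inv {suc n} s = sumF (λ j → I (invS (s Fin.zero) (s (Fin.suc j)))) + inv (tail s)

  inv-cong : (f g : Fin n → SVal D) → (∀ i → f i ≡ g i) → inv f ≡ inv g
  inv-cong {zero}  f g e = refl
  inv-cong {suc n} f g e = cong₂ _+_ (sumF-cong (λ j → cong I (cong₂ invS (e Fin.zero) (e (Fin.suc j)))))
    (inv-cong (tail f) (tail g) (e ∘ Fin.suc))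

  inv-punch : (a : SVal (suc D)) (h : Fin n → SVal D) → inv (punch a ∘ h) ≡ inv h
  inv-punch {n = zero}  a h = refl
  inv-punch {n = suc n} a h = cong₂ _+_ (sumF-cong (λ j → cong I (invS-punch a (h Fin.zero) (h (Fin.suc j)))))
    (inv-punch a (tail h))

  negWeight : SVal D → ℕ
  negWeight     (false , m) = 0
  negWeight {D} (true  , m) = D ∸ toℕ m

  lpm-spec : (s : Fin d → SVal d) → lpm s ≡ inv s + sumF (negWeight ∘ s)
  lpm-spec {d} s = cong₂ _+_
    (trans (length-filter _ (pairs d)) (trans (sumL-pairs d _) (go s)))
    (trans (sumL-allFin d _) (sumF-cong (λ i → weight (s i))))
    where
    c : ∀ {D} → SVal D → SVal D → Bool
    c x y = (ℤ.+ 0) <ℤ (toℤ x ℤ.* toℤ y ℤ.* (toℤ x ℤ.- toℤ y))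
    go : ∀ {n D} (s : Fin n → SVal D) →
      sumF (λ i → sumF (λ j → I (⌊ toℕ i <? toℕ j ⌋ ∧ c (s i) (s j)))) ≡ inv s
    go {zero}  s = refl
    go {suc n} s = cong₂ _+_
      (sumF-cong (λ j → cong I (<ℤ-invS (s Fin.zero) (s (Fin.suc j)))))
      (trans (sumF-cong (λ i → sumF-cong (λ j → cong (λ z → I (z ∧ c (s (Fin.suc i)) (s (Fin.suc j))))
                (trans (⌊<?⌋ (suc (toℕ i)) (suc (toℕ j))) (sym (⌊<?⌋ (toℕ i) (toℕ j)))))))
             (go (tail s)))
    weight : (x : SVal d) → (if toℤ x <ℤ (ℤ.+ 0) then absℤ ((ℤ.+ suc d) ℤ.+ toℤ x) else 0) ≡ negWeight x
    weight (false , m) = refl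
    weight (true  , m) = trans (cong ℤ.∣_∣ (ℤP.[1+m]⊖[1+n]≡m⊖n d (toℕ m)))
      (cong ℤ.∣_∣ (ℤP.⊖-≥ {d} {toℕ m} (<⇒≤ (FP.toℕ<n m))))

  lpm-cong : Resp (lpm {d})
  lpm-cong f g e = trans (lpm-spec f) (trans
    (cong₂ _+_ (inv-cong f g e) (sumF-cong (λ i → cong negWeight (e i)))) (sym (lpm-spec g)))

  -- The rank of a in the order 1 < … < d+1 < −(d+1) < … < −1.
  headLength : ∀ d → SVal (suc d) → ℕ
  headLength d (false , i) = toℕ i
  headLength d (true  , i) = (d ∸ toℕ i) + suc d

  sumF-Tree : {h : Fin d → SVal d} → Tree h → (g : Fin d → ℕ) → sumF (λ j → g (proj₂ (h j))) ≡ sumF g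
  sumF-Tree leaf       g = refl
  sumF-Tree (node a t) g = trans (cong (g (proj₂ a) +_) (sumF-Tree t (g ∘ punchIn (proj₂ a))))
    (sym (sumF-punchIn (proj₂ a) g))

  sumF-<ᵇ : (i : Fin (suc d)) → sumF {d} (λ l → I (toℕ l <ᵇ toℕ i)) ≡ toℕ i
  sumF-<ᵇ {d}     Fin.zero    = sumF-zero {d} (λ _ → refl)
  sumF-<ᵇ {suc d} (Fin.suc i) = cong suc (sumF-<ᵇ i)

  -- Removing the head affects each later value twice: through its inversion with the head and, if
  -- it is negative, through the change of its weight when standardised. The sum of the two effects
  -- does not depend on the sign of the later value. For a positive head it is 1 if the later
  -- absolute value is the smaller one and 0 otherwise; for a negative head it is always 1. Since
  -- the later absolute values are all of `Fin d`, the total depends on the head only.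
  lpm-⊲ : (a : SVal (suc d)) {h : Fin d → SVal d} → Tree h → lpm (a ⊲ h) ≡ headLength d a + lpm h
  lpm-⊲ {d} a {h} t = begin
    lpm (a ⊲ h)
      ≡⟨ lpm-spec (a ⊲ h) ⟩
    (sumF (λ j → I (invS a (punch a (h j)))) + inv (punch a ∘ h)) + (negWeight a + sumF (λ j → negWeight (punch a (h j))))
      ≡⟨ cong (λ z → (sumF (λ j → I (invS a (punch a (h j)))) + z) + (negWeight a + sumF (λ j → negWeight (punch a (h j))))) (inv-punch a h) ⟩
    (sumF (λ j → I (invS a (punch a (h j)))) + inv h) + (negWeight a + sumF (λ j → negWeight (punch a (h j))))
      ≡⟨ shuffle₁ (sumF (λ j → I (invS a (punch a (h j))))) (inv h) (negWeight a) _ ⟩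
    negWeight a + inv h + (sumF (λ j → I (invS a (punch a (h j)))) + sumF (λ j → negWeight (punch a (h j))))
      ≡⟨ cong (negWeight a + inv h +_) (sumF-+ (λ j → I (invS a (punch a (h j)))) _) ⟨
    negWeight a + inv h + sumF (λ j → I (invS a (punch a (h j))) + negWeight (punch a (h j)))
      ≡⟨ cong (negWeight a + inv h +_) (trans (sumF-cong (λ j → pair a (h j))) (sumF-+ (τ a ∘ proj₂ ∘ h) (negWeight ∘ h))) ⟩
    negWeight a + inv h + (sumF (τ a ∘ proj₂ ∘ h) + sumF (negWeight ∘ h))
      ≡⟨ shuffle₂ (negWeight a) (inv h) _ _ ⟩
    (negWeight a + sumF (τ a ∘ proj₂ ∘ h)) + (inv h + sumF (negWeight ∘ h))
      ≡⟨ cong₂ _+_ (trans (cong (negWeight a +_) (sumF-Tree t (τ a))) (total a)) (sym (lpm-spec h)) ⟩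
    headLength d a + lpm h ∎
    where
    shuffle₁ : ∀ x y z w → (x + y) + (z + w) ≡ z + y + (x + w)
    shuffle₁ = solve-∀
    shuffle₂ : ∀ x y z w → x + y + (z + w) ≡ (x + z) + (y + w)
    shuffle₂ = solve-∀
    -- The combined effect on a later value of absolute value `l`, whatever its sign.
    τ : SVal (suc d) → Fin d → ℕ
    τ (false , i) l = I (toℕ l <ᵇ toℕ i)
    τ (true  , i) l = 1
    I-not : ∀ b x → I (not b) + (x + I b) ≡ 1 + x
    I-not false x = cong suc (+-identityʳ x)
    I-not true  x = +-comm x 1
    pair : ∀ a x → I (invS a (punch a x)) + negWeight (punch a x) ≡ τ a (proj₂ x) + negWeight x
    pair (false , i) (false , l) = cong (λ z → I z + 0) (punchIn-<ᵇ i l)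
    pair (false , i) (true  , l) = trans (∸-punchIn i l) (+-comm (d ∸ toℕ l) _)
    pair (true  , i) (false , l) = refl
    pair (true  , i) (true  , l) = trans (cong₂ (λ x y → I x + y) (<ᵇ-punchIn i l) (∸-punchIn i l)) (I-not (toℕ l <ᵇ toℕ i) (d ∸ toℕ l))
    total : ∀ a → negWeight a + sumF (τ a) ≡ headLength d a
    total (false , i) = sumF-<ᵇ i
    total (true  , i) = begin
      (suc d ∸ toℕ i) + sumF {d} (λ _ → 1) ≡⟨ cong₂ _+_ (+-∸-assoc 1 (≤-pred (FP.toℕ<n i))) (trans (sumF-const d 1) (*-identityʳ d)) ⟩
      suc (d ∸ toℕ i) + d                  ≡⟨ sym (+-suc (d ∸ toℕ i) d) ⟩
      (d ∸ toℕ i) + suc d                  ∎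

  descent : (Fin (suc n) → SVal D) → Bool
  descent {zero}  s = false
  descent {suc n} s = ltS (s (Fin.suc Fin.zero)) (s Fin.zero)

  -- Used as slack: the entry after b must be less than b + `asc s`, so it may equal b exactly when
  -- there is no descent.
  asc : (Fin (suc n) → SVal D) → ℕ
  asc s = I (not (descent s))

  des : (Fin n → SVal D) → ℕ
  des {zero}  s = 0
  des {suc n} s = I (descent s) + des (tail s)

  -- The sum of the descents, the first position being numbered k.
  maj : ℕ → (Fin n → SVal D) → ℕ
  maj {zero}  k s = 0
  maj {suc n} k s = (if descent s then k else 0) + maj (suc k) (tail s)

  negs : (Fin n → SVal D) → ℕ
  negs s = sumF (I ∘ proj₁ ∘ s)

  maj-suc : ∀ k (s : Fin n → SVal D) → maj (suc k) s ≡ des s + maj k s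
  maj-suc {zero}  k s = refl
  maj-suc {suc n} k s = trans (cong₂ _+_ (lem (descent s)) (maj-suc (suc k) (tail s)))
    (+-interchange (I (descent s)) _ _ _)
    where
    lem : ∀ b → (if b then suc k else 0) ≡ I b + (if b then k else 0)
    lem false = refl
    lem true  = refl

  des≤maj : (s : Fin n → SVal D) → des s ≤ maj 1 s
  des≤maj s = subst (des s ≤_) (sym (maj-suc 0 s)) (m≤m+n (des s) _)

  Wmaj-spec : (s : Fin d → SVal d) → Wmaj s ≡ maj 1 s + negs s
  Wmaj-spec {d} s = cong₂ _+_
    (trans (sumL-pairs d _) (go 1 s))
    (trans (length-filter _ (allFin d)) (trans (sumL-allFin d _) (sumF-cong (λ i → cong I (neg (s i))))))
    where
    neg : (x : SVal d) → (toℤ x <ℤ (ℤ.+ 0)) ≡ proj₁ x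
    neg (false , _) = refl
    neg (true  , _) = refl
    term : ∀ {n D} → ℕ → (Fin n → SVal D) → Fin n → Fin n → ℕ
    term k s i j = if ⌊ toℕ j ≟ suc (toℕ i) ⌋ ∧ (toℤ (s j) <ℤ toℤ (s i)) then k + toℕ i else 0
    term-suc : ∀ {n D} k (s : Fin (suc n) → SVal D) i j → term k s (Fin.suc i) (Fin.suc j) ≡ term (suc k) (tail s) i j
    term-suc k s i j = cong₂ (λ b x → if b ∧ (toℤ (s (Fin.suc j)) <ℤ toℤ (s (Fin.suc i))) then x else 0)
      (trans (⌊≟⌋ (suc (toℕ j)) (suc (suc (toℕ i)))) (sym (⌊≟⌋ (toℕ j) (suc (toℕ i)))))
      (+-suc k (toℕ i))
    first : ∀ {n D} k (s : Fin (suc n) → SVal D) → sumF (term k s Fin.zero) ≡ (if descent s then k else 0)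
    first {zero}  k s = refl
    first {suc n} k s = trans (cong₂ _+_
      (cong₂ (λ b x → if b then x else 0) (<ℤ-ltS (s (Fin.suc Fin.zero)) (s Fin.zero)) (+-identityʳ k))
      (sumF-zero {n} (λ j → refl)))
      (+-identityʳ _)
    go : ∀ {n D} k (s : Fin n → SVal D) → sumF (λ i → sumF (term k s i)) ≡ maj k s
    go {zero}  k s = refl
    go {suc n} k s = cong₂ _+_ (first k s)
      (trans (sumF-cong (λ i → sumF-cong (λ j → term-suc k s i j))) (go (suc k) (tail s)))

  descent-cong : (f g : Fin (suc n) → SVal D) → (∀ i → f i ≡ g i) → descent f ≡ descent g
  descent-cong {zero}  f g e = refl
  descent-cong {suc n} f g e = cong₂ ltS (e (Fin.suc Fin.zero)) (e Fin.zero)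

  maj-cong : ∀ k (f g : Fin n → SVal D) → (∀ i → f i ≡ g i) → maj k f ≡ maj k g
  maj-cong {zero}  k f g e = refl
  maj-cong {suc n} k f g e = cong₂ _+_ (cong (if_then k else 0) (descent-cong f g e)) (maj-cong (suc k) _ _ (e ∘ Fin.suc))

  Wmaj-cong : Resp (Wmaj {d})
  Wmaj-cong f g e = trans (Wmaj-spec f) (trans
    (cong₂ _+_ (maj-cong 1 f g e) (sumF-cong (λ i → cong (I ∘ proj₁) (e i)))) (sym (Wmaj-spec g)))

  -- Q m s is the generating function of the sequences m > b₁ ≥ b₂ ≥ … ≥ 0 that
  -- decrease strictly at the descents of s.
  Q : ℕ → (Fin n → SVal D) → Series
  Q {zero}  m s t = oneS t
  Q {suc n} m s t = Σ< m (λ b → sh b (Q (b + asc s) (tail s)) t)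

  descent-punch : (a : SVal (suc D)) (h : Fin (suc n) → SVal D) → descent (punch a ∘ h) ≡ descent h
  descent-punch {n = zero}  a h = refl
  descent-punch {n = suc n} a h = ltS-punch a (h (Fin.suc Fin.zero)) (h Fin.zero)

  Q-punch : (a : SVal (suc D)) (h : Fin n → SVal D) → ∀ m t → Q m (punch a ∘ h) t ≡ Q m h t
  Q-punch {n = zero}  a h m t = refl
  Q-punch {n = suc n} a h m t = Σ<-cong m (λ b → sh-cong b t (λ t′ → trans
    (cong (λ z → Q (b + I (not z)) (punch a ∘ tail h) t′) (descent-punch a h))
    (Q-punch a (tail h) (b + asc h) t′)))

  asc+descent : (s : Fin (suc n) → SVal D) → asc s + I (descent s) ≡ 1
  asc+descent s with descent s
  ... | false = refl
  ... | true  = refl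

  Q-small : ∀ (s : Fin (suc n) → SVal D) m t → m ≤ des s → Q m s t ≡ 0
  Q-small {zero}  s zero t _ = refl
  Q-small {suc n} s m t le = Σ<-zero m (λ b b<m → sh-zero b t (λ t′ → Q-small (tail s) (b + asc s) t′ (bound b b<m)))
    where
    bound : ∀ b → b < m → b + asc s ≤ des (tail s)
    bound b b<m with descent s
    ... | false = subst (_≤ des (tail s)) (+-comm 1 b) (≤-trans b<m le)
    ... | true  = subst (_≤ des (tail s)) (sym (+-identityʳ b)) (≤-pred (≤-trans b<m le))

  -- Subtract from each entry the number of descents from its position on. What remains is an
  -- arbitrary weakly decreasing sequence with entries at most c. A descent at position i is
  -- subtracted from i entries, so the weight drops by `maj 1 s`.
  Q-closed : ∀ (s : Fin (suc n) → SVal D) c t → Q (des s + suc c) s t ≡ sh (maj 1 s) (G c (suc n)) t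
  Q-closed {zero}  s c t = refl
  Q-closed {suc n} s c t = begin
    Σ< (des s + suc c) f
      ≡⟨ Σ<-+ (des s) (suc c) f ⟩
    Σ< (des s) f + Σ< (suc c) (λ i → f (des s + i))
      ≡⟨ cong₂ _+_ (Σ<-zero (des s) (λ b b<d → sh-zero b t (λ t′ → Q-small (tail s) (b + asc s) t′ (low b b<d))))
           (Σ<-cong (suc c) high) ⟩
    Σ< (suc c) (λ i → sh (des s + maj 1 (tail s)) (sh i (G i (suc n))) t)
      ≡⟨ sh-Σ< (des s + maj 1 (tail s)) (suc c) (λ i → sh i (G i (suc n))) t ⟨
    sh (des s + maj 1 (tail s)) (G c (suc (suc n))) t
      ≡⟨ cong (λ z → sh z (G c (suc (suc n))) t) majs ⟩
    sh (maj 1 s) (G c (suc (suc n))) t ∎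
    where
    f : ℕ → ℕ
    f b = sh b (Q (b + asc s) (tail s)) t
    low : ∀ b → b < des s → b + asc s ≤ des (tail s)
    low b b<d with descent s
    ... | false = subst (_≤ des (tail s)) (+-comm 1 b) b<d
    ... | true  = subst (_≤ des (tail s)) (sym (+-identityʳ b)) (≤-pred b<d)
    arith : ∀ x y i a → (x + y) + i + a ≡ y + ((a + x) + i)
    arith = solve-∀
    arith₂ : ∀ x i y → x + i + y ≡ (x + y) + i
    arith₂ = solve-∀
    high : ∀ i → f (des s + i) ≡ sh (des s + maj 1 (tail s)) (sh i (G i (suc n))) t
    high i = begin
      sh (des s + i) (Q (des s + i + asc s) (tail s)) t
        ≡⟨ sh-cong (des s + i) t (λ t′ → trans
             (cong (λ z → Q z (tail s) t′) (trans (arith (I (descent s)) (des (tail s)) i (asc s))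
               (cong (λ z → des (tail s) + (z + i)) (asc+descent s))))
             (Q-closed (tail s) i t′)) ⟩
      sh (des s + i) (sh (maj 1 (tail s)) (G i (suc n))) t
        ≡⟨ sh-sh (des s + i) (maj 1 (tail s)) (G i (suc n)) t ⟩
      sh (des s + i + maj 1 (tail s)) (G i (suc n)) t
        ≡⟨ cong (λ z → sh z (G i (suc n)) t) (arith₂ (des s) i (maj 1 (tail s))) ⟩
      sh (des s + maj 1 (tail s) + i) (G i (suc n)) t
        ≡⟨ sh-sh (des s + maj 1 (tail s)) i (G i (suc n)) t ⟨
      sh (des s + maj 1 (tail s)) (sh i (G i (suc n))) t ∎
    majs : des s + maj 1 (tail s) ≡ maj 1 s
    majs = trans (+-assoc (I (descent s)) _ _) (cong (I (descent s) +_) (sym (maj-suc 1 (tail s))))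

  -- In degree t a sequence has entries at most t, so the bound `suc t` costs nothing. Only the
  -- descent part of `Wmaj` is absorbed into the sequences; the number of negative values stays as a
  -- separate shift.
  sh-Wmaj : ∀ (s : Fin d → SVal d) t → sh (Wmaj s) (prodGeom d) t ≡ sh (negs s) (Q (suc t) s) t
  sh-Wmaj {zero}  s t = refl
  sh-Wmaj {suc d} s t = begin
    sh (Wmaj s) (prodGeom (suc d)) t
      ≡⟨ cong (λ z → sh z (prodGeom (suc d)) t) (trans (Wmaj-spec s) (+-comm (maj 1 s) (negs s))) ⟩
    sh (negs s + maj 1 s) (prodGeom (suc d)) t
      ≡⟨ sh-sh (negs s) (maj 1 s) (prodGeom (suc d)) t ⟨
    sh (negs s) (sh (maj 1 s) (prodGeom (suc d))) t
      ≡⟨ sh-cong-≤ (negs s) t (λ m le → inner m (≤-trans (m≤n+m m (negs s)) le)) ⟩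
    sh (negs s) (Q (suc t) s) t ∎
    where
    inner : ∀ m → m ≤ t → sh (maj 1 s) (prodGeom (suc d)) m ≡ Q (suc t) s m
    inner m m≤t with des s ≤? t
    ... | yes des≤t = begin
      sh (maj 1 s) (prodGeom (suc d)) m
        ≡⟨ sh-cong-≤ (maj 1 s) m (λ r le → sym (G≡prodGeom (t ∸ des s) (suc d) r (bound r le))) ⟩
      sh (maj 1 s) (G (t ∸ des s) (suc d)) m
        ≡⟨ Q-closed s (t ∸ des s) m ⟨
      Q (des s + suc (t ∸ des s)) s m
        ≡⟨ cong (λ z → Q z s m) (trans (+-suc (des s) _) (cong suc (m+[n∸m]≡n des≤t))) ⟩
      Q (suc t) s m ∎
      where
      bound : ∀ r → maj 1 s + r ≤ m → r ≤ t ∸ des s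
      bound r le = subst (_≤ t ∸ des s) (m+n∸m≡n (des s) r)
        (∸-monoˡ-≤ (des s) (≤-trans (+-monoˡ-≤ r (des≤maj s)) (≤-trans le m≤t)))
    -- With more than t descents both sides vanish: the first entry would exceed t, and `maj 1 s` is
    -- at least the number of descents.
    ... | no des≰t = trans
      (sh-small (maj 1 s) (prodGeom (suc d)) m (≤-trans (s≤s m≤t) (≤-trans (≰⇒> des≰t) (des≤maj s))))
      (sym (Q-small s (suc t) m (≰⇒> des≰t)))

  -- Signed permutations with sequences, counted as words.

  module PermutationSums (q : ℕ) where
    open QBinomial q

    -- The part b₁ = b of Q.
    Qtop : ∀ {n D} → ℕ → (Fin (suc n) → SVal D) → Series
    Qtop b h = sh b (Q (b + asc h) (tail h))

    -- Sums over the signed permutations starting with the value x, this value being removed.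
    A : ∀ d → ℕ → SVal (suc d) → Series
    A d b x t = PS d (λ h → q ^ lpm h * sh (negs h) (Q (b + asc (x ⊲ h)) h) t)

    Y : ∀ d → ℕ → Series
    Y d b t = PS d (λ h → q ^ lpm h * sh (negs h) (Q b h) t)

    -- A positive value with entry b is the letter b, a negative one the letter -(b+1); the
    -- additional 1 is its contribution to `negs`.
    letterWeight : ℕ → SVal D → ℕ
    letterWeight b x = I (proj₁ x) + b

    B : ∀ d → ℕ → SVal (suc d) → Series
    B d b x t = q ^ headLength d x * sh (letterWeight b x) (A d b x) t

    term-B : ∀ d b (x : SVal (suc d)) t →
      PS d (λ h → q ^ lpm (x ⊲ h) * sh (negs (x ⊲ h)) (Qtop b (x ⊲ h)) t) ≡ B d b x t
    term-B d b x t = begin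
      PS d (λ h → q ^ lpm (x ⊲ h) * sh (negs (x ⊲ h)) (sh b (Q (b + asc (x ⊲ h)) (punch x ∘ h))) t)
        ≡⟨ PS-cong d step ⟩
      PS d (λ h → q ^ headLength d x * sh (letterWeight b x) (λ t′ → q ^ lpm h * sh (negs h) (Q (b + asc (x ⊲ h)) h) t′) t)
        ≡⟨ PS-*ˡ d (q ^ headLength d x) _ ⟩
      q ^ headLength d x * PS d (λ h → sh (letterWeight b x) (λ t′ → q ^ lpm h * sh (negs h) (Q (b + asc (x ⊲ h)) h) t′) t)
        ≡⟨ cong (q ^ headLength d x *_) (PS-sh d (letterWeight b x) _ t) ⟨
      B d b x t ∎
      where
      β = I (proj₁ x)
      arith : ∀ x y z → x + y + z ≡ (x + z) + y
      arith = solve-∀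
      step : ∀ h → Tree h →
        q ^ lpm (x ⊲ h) * sh (negs (x ⊲ h)) (sh b (Q (b + asc (x ⊲ h)) (punch x ∘ h))) t
        ≡ q ^ headLength d x * sh (letterWeight b x) (λ t′ → q ^ lpm h * sh (negs h) (Q (b + asc (x ⊲ h)) h) t′) t
      step h tr = begin
        q ^ lpm (x ⊲ h) * sh (β + negs h) (sh b (Q m (punch x ∘ h))) t
          ≡⟨ cong₂ _*_ (trans (cong (q ^_) (lpm-⊲ x tr)) (^-distribˡ-+-* q (headLength d x) (lpm h)))
               (sh-cong (β + negs h) t (λ t₁ → sh-cong b t₁ (Q-punch x h m))) ⟩
        q ^ headLength d x * q ^ lpm h * sh (β + negs h) (sh b (Q m h)) t
          ≡⟨ *-assoc (q ^ headLength d x) (q ^ lpm h) _ ⟩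
        q ^ headLength d x * (q ^ lpm h * sh (β + negs h) (sh b (Q m h)) t)
          ≡⟨ cong (λ z → q ^ headLength d x * (q ^ lpm h * z)) (trans (sh-sh (β + negs h) b (Q m h) t)
               (trans (cong (λ z → sh z (Q m h) t) (arith β (negs h) b)) (sym (sh-sh (β + b) (negs h) (Q m h) t)))) ⟩
        q ^ headLength d x * (q ^ lpm h * sh (letterWeight b x) (sh (negs h) (Q m h)) t)
          ≡⟨ cong (q ^ headLength d x *_) (sh-* (letterWeight b x) (q ^ lpm h) (sh (negs h) (Q m h)) t) ⟨
        q ^ headLength d x * sh (letterWeight b x) (λ t′ → q ^ lpm h * sh (negs h) (Q m h) t′) t ∎
        where m = b + asc (x ⊲ h)

    Y-zero : ∀ b t → Y 0 b t ≡ oneS t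
    Y-zero b t = *-identityˡ (oneS t)

    Y-suc-0 : ∀ d t → Y (suc d) 0 t ≡ 0
    Y-suc-0 d t = PS-zero (suc d) (λ h → trans (cong (q ^ lpm h *_) (sh-zero (negs h) t (λ _ → refl))) (*-zeroʳ (q ^ lpm h)))

    Y-suc-suc : ∀ d b t → Y (suc d) (suc b) t ≡ Y (suc d) b t + sumS (λ x → B d b x t)
    Y-suc-suc d b t = begin
      PS (suc d) (λ h → q ^ lpm h * sh (negs h) (λ t′ → Q b h t′ + Qtop b h t′) t)
        ≡⟨ PS-cong (suc d) (λ h _ → trans (cong (q ^ lpm h *_) (sh-+ (negs h) (Q b h) (Qtop b h) t)) (*-distribˡ-+ (q ^ lpm h) (sh (negs h) (Q b h) t) _)) ⟩
      PS (suc d) (λ h → q ^ lpm h * sh (negs h) (Q b h) t + q ^ lpm h * sh (negs h) (Qtop b h) t)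
        ≡⟨ PS-+ (suc d) (λ h → q ^ lpm h * sh (negs h) (Q b h) t)
             (λ h → q ^ lpm h * sh (negs h) (Qtop b h) t) ⟩
      Y (suc d) b t + PS (suc d) (λ h → q ^ lpm h * sh (negs h) (Qtop b h) t)
        ≡⟨ cong (Y (suc d) b t +_) (sumS-cong (λ x → term-B d b x t)) ⟩
      Y (suc d) b t + sumS (λ x → B d b x t) ∎

    follows : SVal (suc D) → SVal D → Bool
    follows x y = not (ltS (punch x y) x)

    Q-+I : ∀ {n D} (h : Fin (suc n) → SVal D) b β t →
      Q (b + I β) h t ≡ Q b h t + I β * Qtop b h t
    Q-+I h b false t = trans (cong (λ z → Q z h t) (+-identityʳ b)) (sym (+-identityʳ _))
    Q-+I h b true  t = trans (cong (λ z → Q z h t) (+-comm b 1)) (cong (Q b h t +_) (sym (*-identityˡ _)))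

    -- The entry after b is either less than b, with no condition on the values, or equal to b, and
    -- then the next value must not create a descent.
    A-suc : ∀ d b x t → A (suc d) b x t ≡ Y (suc d) b t + sumS (λ y → I (follows x y) * B d b y t)
    A-suc d b x t = begin
      PS (suc d) (λ h → q ^ lpm h * sh (negs h) (Q (b + I (φ h)) h) t)
        ≡⟨ PS-cong (suc d) (λ h _ → split h) ⟩
      PS (suc d) (λ h → q ^ lpm h * sh (negs h) (Q b h) t + I (φ h) * (q ^ lpm h * sh (negs h) (Qtop b h) t))
        ≡⟨ PS-+ (suc d) (λ h → q ^ lpm h * sh (negs h) (Q b h) t)
             (λ h → I (φ h) * (q ^ lpm h * sh (negs h) (Qtop b h) t)) ⟩
      Y (suc d) b t + PS (suc d) (λ h → I (φ h) * (q ^ lpm h * sh (negs h) (Qtop b h) t))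
        ≡⟨ cong (Y (suc d) b t +_) (sumS-cong (λ y → trans (PS-*ˡ d (I (follows x y)) _) (cong (I (follows x y) *_) (term-B d b y t)))) ⟩
      Y (suc d) b t + sumS (λ y → I (follows x y) * B d b y t) ∎
      where
      φ : (Fin (suc d) → SVal (suc d)) → Bool
      φ h = follows x (h Fin.zero)
      arith : ∀ p u β v → p * (u + β * v) ≡ p * u + β * (p * v)
      arith = solve-∀
      split : ∀ h → q ^ lpm h * sh (negs h) (Q (b + I (φ h)) h) t
        ≡ q ^ lpm h * sh (negs h) (Q b h) t + I (φ h) * (q ^ lpm h * sh (negs h) (Qtop b h) t)
      split h = begin
        q ^ lpm h * sh (negs h) (Q (b + I (φ h)) h) t
          ≡⟨ cong (q ^ lpm h *_) (trans (sh-cong (negs h) t (Q-+I h b (φ h)))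
               (trans (sh-+ (negs h) (Q b h) _ t) (cong (sh (negs h) (Q b h) t +_) (sh-* (negs h) (I (φ h)) _ t)))) ⟩
        q ^ lpm h * (sh (negs h) (Q b h) t + I (φ h) * sh (negs h) (Qtop b h) t)
          ≡⟨ arith (q ^ lpm h) (sh (negs h) (Q b h) t) (I (φ h)) _ ⟩
        q ^ lpm h * sh (negs h) (Q b h) t + I (φ h) * (q ^ lpm h * sh (negs h) (Qtop b h) t) ∎

    Lpos Lneg : ℕ → ℕ → ℕ → Series
    Lpos b = L (prev b) 𝟙 b
    Lneg b = L (Tpos b) (q ^_) (suc b)

    Claim : ℕ → Set
    Claim d = ∀ b (i : Fin (suc d)) t →
      (A d b (false , i) t ≡ Lpos b (toℕ i) (d ∸ toℕ i) t) × (A d b (true , i) t ≡ Lneg b (d ∸ toℕ i) (toℕ i) t)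

    Bpos Bneg : ℕ → ℕ → ℕ → Series
    Bpos d b i t = q ^ i * sh b (Lpos b i (d ∸ i)) t
    Bneg d b i t = q ^ (d ∸ i + suc d) * sh (suc b) (Lneg b (d ∸ i) i) t

    sumF-≮ : ∀ N u (f : ℕ → ℕ) → u < N →
      sumF {N} (λ i → I (not (toℕ i <ᵇ u)) * f (toℕ i)) ≡ sumF {N} (λ i → I (not (toℕ i <ᵇ suc u)) * f (toℕ i)) + f u
    sumF-≮ (suc N) zero f _ =
      trans (cong₂ _+_ (*-identityˡ (f 0)) refl)
        (+-comm (f 0) (sumF {N} (λ i → 1 * f (suc (toℕ i)))))
    sumF-≮ (suc N) (suc u) f (s≤s u<N) = sumF-≮ N u (f ∘ suc) u<N

    sumF-< : ∀ N v (f : ℕ → ℕ) → v < N →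
      sumF {N} (λ i → I (toℕ i <ᵇ suc v) * f (toℕ i)) ≡ sumF {N} (λ i → I (toℕ i <ᵇ v) * f (toℕ i)) + f v
    sumF-< (suc N) zero f _ = trans (cong₂ _+_ (*-identityˡ (f 0)) refl) (+-comm (f 0) _)
    sumF-< (suc N) (suc v) f (s≤s v<N) = trans
      (cong (1 * f 0 +_) (sumF-< N v (f ∘ suc) v<N)) (sym (+-assoc (1 * f 0) _ _))

    I-≮-all : ∀ {N} (i : Fin N) → not (toℕ i <ᵇ N) ≡ false
    I-≮-all Fin.zero    = refl
    I-≮-all (Fin.suc i) = I-≮-all i

    I-<-all : ∀ {N} (i : Fin N) → (toℕ i <ᵇ N) ≡ true
    I-<-all Fin.zero    = refl
    I-<-all (Fin.suc i) = I-<-all i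

    -- The recursion of `L` unrolled over the place i ≥ u that takes the new letter first; `prev` is
    -- left when no place does.
    Lpos-sum : ∀ d b r u t → u + r ≡ suc d →
      prev b (suc d) t + sumF {suc d} (λ i → I (not (toℕ i <ᵇ u)) * Bpos d b (toℕ i) t) ≡ Lpos b u r t
    Lpos-sum d b zero u t e = begin
      prev b (suc d) t + sumF {suc d} (λ i → I (not (toℕ i <ᵇ u)) * Bpos d b (toℕ i) t)
        ≡⟨ cong₂ (λ x y → prev b x t + y) (sym e′)
             (sumF-zero {suc d} (λ i → cong (λ z → z * Bpos d b (toℕ i) t)
               (cong I (trans (cong (λ z → not (toℕ i <ᵇ z)) e′) (I-≮-all i))))) ⟩
      prev b u t + 0 ≡⟨ +-identityʳ _ ⟩
      prev b u t ∎
      where e′ = trans (sym (+-identityʳ u)) e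
    Lpos-sum d b (suc r) u t e = begin
      prev b (suc d) t + sumF {suc d} (λ i → I (not (toℕ i <ᵇ u)) * Bpos d b (toℕ i) t)
        ≡⟨ cong (prev b (suc d) t +_) (sumF-≮ (suc d) u (λ i → Bpos d b i t) (s≤s (subst (u ≤_) e″ (m≤m+n u r)))) ⟩
      prev b (suc d) t + (sumF {suc d} (λ i → I (not (toℕ i <ᵇ suc u)) * Bpos d b (toℕ i) t) + Bpos d b u t)
        ≡⟨ +-assoc (prev b (suc d) t) _ _ ⟨
      prev b (suc d) t + sumF {suc d} (λ i → I (not (toℕ i <ᵇ suc u)) * Bpos d b (toℕ i) t) + Bpos d b u t
        ≡⟨ cong₂ _+_ (Lpos-sum d b r (suc u) t (cong suc e″))
             (cong₂ (λ x y → x * sh b (Lpos b u y) t) (sym (*-identityʳ (q ^ u)))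
               (trans (cong (_∸ u) (sym e″)) (m+n∸m≡n u r))) ⟩
      Lpos b u (suc r) t ∎
      where e″ = suc-injective (trans (sym (+-suc u r)) e)

    -- The same unrolling for negative values, which increase as the absolute value decreases, so
    -- that `suc d ∸ v` places are frozen. Here `ψ` is q^(d+1), evaluated at the current length; it
    -- matches the summand d + 1 in `headLength` of a negative value.
    Lneg-sum : ∀ d b v t → v ≤ suc d →
      Tpos b (suc d) t + sumF {suc d} (λ i → I (toℕ i <ᵇ v) * Bneg d b (toℕ i) t) ≡ Lneg b (suc d ∸ v) v t
    Lneg-sum d b zero t _ = trans (cong (Tpos b (suc d) t +_) (sumF-zero {suc d} (λ _ → refl))) (+-identityʳ _)
    Lneg-sum d b (suc v) t (s≤s v≤d) = begin
      Tpos b (suc d) t + sumF {suc d} (λ i → I (toℕ i <ᵇ suc v) * Bneg d b (toℕ i) t)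
        ≡⟨ cong (Tpos b (suc d) t +_) (sumF-< (suc d) v (λ i → Bneg d b i t) (s≤s v≤d)) ⟩
      Tpos b (suc d) t + (sumF {suc d} (λ i → I (toℕ i <ᵇ v) * Bneg d b (toℕ i) t) + Bneg d b v t)
        ≡⟨ +-assoc (Tpos b (suc d) t) _ _ ⟨
      Tpos b (suc d) t + sumF {suc d} (λ i → I (toℕ i <ᵇ v) * Bneg d b (toℕ i) t) + Bneg d b v t
        ≡⟨ cong₂ _+_ (trans (Lneg-sum d b v t (m≤n⇒m≤1+n v≤d)) (cong (λ z → Lneg b z v t) (+-∸-assoc 1 v≤d)))
             (cong (_* sh (suc b) (Lneg b (d ∸ v) v) t)
               (trans (^-distribˡ-+-* q (d ∸ v) (suc d)) (cong (λ z → q ^ (d ∸ v) * q ^ suc z) (sym (m∸n+n≡m v≤d))))) ⟩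
      Lneg b (d ∸ v) (suc v) t ∎

    module Step (d : ℕ) (IH : Claim d) where
      B≡ : ∀ b (i : Fin (suc d)) t → (B d b (false , i) t ≡ Bpos d b (toℕ i) t) × (B d b (true , i) t ≡ Bneg d b (toℕ i) t)
      B≡ b i t =
        cong (q ^ toℕ i *_) (sh-cong b t (λ t′ → proj₁ (IH b i t′))) ,
        cong (q ^ (d ∸ toℕ i + suc d) *_) (sh-cong (suc b) t (λ t′ → proj₂ (IH b i t′)))

      posSum : ∀ b t → prev b (suc d) t + sumF {suc d} (λ i → Bpos d b (toℕ i) t) ≡ Tpos b (suc d) t
      posSum b t = trans (cong (prev b (suc d) t +_) (sumF-cong {suc d} (λ i → sym (*-identityˡ (Bpos d b (toℕ i) t)))))
        (Lpos-sum d b (suc d) 0 t refl)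

      negSum : ∀ b t → Tpos b (suc d) t + sumF {suc d} (λ i → Bneg d b (toℕ i) t) ≡ Tneg b (suc d) t
      negSum b t = trans
        (cong (Tpos b (suc d) t +_) (sumF-cong {suc d} (λ i → sym (trans (cong (λ z → I z * Bneg d b (toℕ i) t) (I-<-all i)) (*-identityˡ _)))))
        (trans (Lneg-sum d b (suc d) t ≤-refl) (cong (λ z → Lneg b z (suc d) t) (n∸n≡0 d)))

      -- Raising the bound from b to b + 1 admits the positive and the negative values with entry b,
      -- that is, the next two letters b and -(b+1) of the alphabet.
      Y≡prev : ∀ b t → Y (suc d) b t ≡ prev b (suc d) t
      Y≡prev zero    t = Y-suc-0 d t
      Y≡prev (suc b) t = begin
        Y (suc d) (suc b) t
          ≡⟨ Y-suc-suc d b t ⟩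
        Y (suc d) b t + (sumF (λ i → B d b (false , i) t) + sumF (λ i → B d b (true , i) t))
          ≡⟨ cong₂ _+_ (Y≡prev b t) (cong₂ _+_ (sumF-cong (λ i → proj₁ (B≡ b i t))) (sumF-cong (λ i → proj₂ (B≡ b i t)))) ⟩
        prev b (suc d) t + (sumF {suc d} (λ i → Bpos d b (toℕ i) t) + sumF {suc d} (λ i → Bneg d b (toℕ i) t))
          ≡⟨ +-assoc (prev b (suc d) t) _ _ ⟨
        prev b (suc d) t + sumF {suc d} (λ i → Bpos d b (toℕ i) t) + sumF {suc d} (λ i → Bneg d b (toℕ i) t)
          ≡⟨ cong (_+ sumF {suc d} (λ i → Bneg d b (toℕ i) t)) (posSum b t) ⟩
        Tpos b (suc d) t + sumF {suc d} (λ i → Bneg d b (toℕ i) t)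
          ≡⟨ negSum b t ⟩
        Tneg b (suc d) t ∎

      claim-suc : Claim (suc d)
      claim-suc b i t = pos , neg
        where
        pos : A (suc d) b (false , i) t ≡ Lpos b (toℕ i) (suc d ∸ toℕ i) t
        pos = begin
          A (suc d) b (false , i) t
            ≡⟨ A-suc d b (false , i) t ⟩
          Y (suc d) b t + (sumF (λ l → I (not (toℕ (punchIn i l) <ᵇ toℕ i)) * B d b (false , l) t) + sumF {suc d} (λ l → 0))
            ≡⟨ cong₂ _+_ (Y≡prev b t) (trans (cong₂ _+_
                 (sumF-cong (λ l → cong₂ (λ x y → I (not x) * y) (punchIn-<ᵇ i l) (proj₁ (B≡ b l t))))
                 (sumF-zero {suc d} (λ _ → refl))) (+-identityʳ _)) ⟩
          prev b (suc d) t + sumF {suc d} (λ l → I (not (toℕ l <ᵇ toℕ i)) * Bpos d b (toℕ l) t)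
            ≡⟨ Lpos-sum d b (suc d ∸ toℕ i) (toℕ i) t (m+[n∸m]≡n (≤-pred (FP.toℕ<n i))) ⟩
          Lpos b (toℕ i) (suc d ∸ toℕ i) t ∎
        I-not-not : ∀ b → I (not (not b)) ≡ I b
        I-not-not b = cong I (BP.not-involutive b)
        neg : A (suc d) b (true , i) t ≡ Lneg b (suc d ∸ toℕ i) (toℕ i) t
        neg = begin
          A (suc d) b (true , i) t
            ≡⟨ A-suc d b (true , i) t ⟩
          Y (suc d) b t + (sumF (λ l → 1 * B d b (false , l) t) + sumF (λ l → I (not (toℕ i <ᵇ toℕ (punchIn i l))) * B d b (true , l) t))
            ≡⟨ cong₂ _+_ (Y≡prev b t) (cong₂ _+_
                 (sumF-cong (λ l → trans (*-identityˡ _) (proj₁ (B≡ b l t))))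
                 (sumF-cong (λ l → cong₂ _*_ (trans (cong (I ∘ not) (<ᵇ-punchIn i l)) (I-not-not (toℕ l <ᵇ toℕ i))) (proj₂ (B≡ b l t))))) ⟩
          prev b (suc d) t + (sumF {suc d} (λ l → Bpos d b (toℕ l) t) + sumF {suc d} (λ l → I (toℕ l <ᵇ toℕ i) * Bneg d b (toℕ l) t))
            ≡⟨ +-assoc (prev b (suc d) t) _ _ ⟨
          prev b (suc d) t + sumF {suc d} (λ l → Bpos d b (toℕ l) t) + sumF {suc d} (λ l → I (toℕ l <ᵇ toℕ i) * Bneg d b (toℕ l) t)
            ≡⟨ cong (_+ sumF {suc d} (λ l → I (toℕ l <ᵇ toℕ i) * Bneg d b (toℕ l) t)) (posSum b t) ⟩
          Tpos b (suc d) t + sumF {suc d} (λ l → I (toℕ l <ᵇ toℕ i) * Bneg d b (toℕ l) t)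
            ≡⟨ Lneg-sum d b (toℕ i) t (≤-pred (FP.toℕ<n i)) ⟩
          Lneg b (suc d ∸ toℕ i) (toℕ i) t ∎

    prev-0 : ∀ b t → prev b 0 t ≡ oneS t
    prev-0 zero    t = refl
    prev-0 (suc b) t = prev-0 b t

    claim : ∀ d → Claim d
    claim zero b Fin.zero t =
      trans (*-identityˡ (oneS t)) (sym (prev-0 b t)) , trans (*-identityˡ (oneS t)) (sym (prev-0 b t))
    claim (suc d) = Step.claim-suc d (claim d)

    Y≡prev : ∀ d b t → Y d b t ≡ prev b d t
    Y≡prev zero    b t = trans (Y-zero b t) (sym (prev-0 b t))
    Y≡prev (suc d) b t = Step.Y≡prev d (claim d) b t

    anti-select : ∀ w c (g : Series) n → anti (λ k l → (if ⌊ w ≟ k ⌋ then c else 0) * g l) n ≡ c * sh w g n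
    anti-select zero c g zero    = refl
    anti-select zero c g (suc n) = trans (cong (c * g (suc n) +_) (anti-zero n (λ k l _ → refl))) (+-identityʳ _)
    anti-select (suc w) c g zero    = sym (*-zeroʳ c)
    anti-select (suc w) c g (suc n) = trans
      (anti-cong′ n (λ k l → cong (λ z → (if z then c else 0) * g l) (trans (⌊≟⌋ (suc w) (suc k)) (sym (⌊≟⌋ w k)))))
      (anti-select w c g n)

    anti-sumL : ∀ {S : Set} (F : ℕ → S → ℕ) (g : Series) xs n →
      anti (λ k l → sumL (F k) xs * g l) n ≡ sumL (λ s → anti (λ k l → F k s * g l) n) xs
    anti-sumL F g []       n = anti-zero n (λ _ _ _ → refl)
    anti-sumL F g (x ∷ xs) n = trans
      (anti-cong′ n (λ k l → *-distribʳ-+ (g l) (F k x) (sumL (F k) xs)))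
      (trans (anti-+ (λ k l → F k x * g l) _ n) (cong (anti (λ k l → F k x * g l) n +_) (anti-sumL F g xs n)))

    rhsSeries≡V : ∀ d n → rhsSeries q d n ≡ V φ± (suc n) d n
    rhsSeries≡V d n = begin
      rhsSeries q d n
        ≡⟨ ⋆-anti (Mpm q d) (prodGeom d) n ⟩
      anti (λ k l → Mpm q d k * prodGeom d l) n
        ≡⟨ anti-sumL (λ k s → if ⌊ Wmaj s ≟ k ⌋ then q ^ lpm s else 0) (prodGeom d) (signedPerms d) n ⟩
      sumL (λ s → anti (λ k l → (if ⌊ Wmaj s ≟ k ⌋ then q ^ lpm s else 0) * prodGeom d l) n) (signedPerms d)
        ≡⟨ sumL-cong (signedPerms d) (λ s → anti-select (Wmaj s) (q ^ lpm s) (prodGeom d) n) ⟩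
      sumL (λ s → q ^ lpm s * sh (Wmaj s) (prodGeom d) n) (signedPerms d)
        ≡⟨ sumL-signedPerms d _ (λ f g e → cong₂ (λ x y → q ^ x * sh y (prodGeom d) n) (lpm-cong f g e) (Wmaj-cong f g e)) ⟩
      PS d (λ s → q ^ lpm s * sh (Wmaj s) (prodGeom d) n)
        ≡⟨ PS-cong d (λ s _ → cong (q ^ lpm s *_) (sh-Wmaj s n)) ⟩
      Y d (suc n) n
        ≡⟨ Y≡prev d (suc n) n ⟩
      Tneg n d n
        ≡⟨ Tneg≡V d n ⟩
      V φ± (suc n) d n ∎

-- Counting up to an equivalence relation.

module Counting where
  open import Data.Fin using (_↑ˡ_; _↑ʳ_; splitAt)
  open import Data.Nat
  open import Data.Nat.Properties
  open Combinatorics using (sumF; sumF-const)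

  private variable
    A B : Set
    N M : ℕ

  -- `HasCount` accepts any relation; an equivalence is what makes the count unique and lets it be
  -- transported along maps. Vectors, subspaces and flags are all compared extensionally.
  record Equiv (A : Set) : Set₁ where
    field
      _≈_   : A → A → Set
      rfl   : ∀ {a} → a ≈ a
      symm  : ∀ {a b} → a ≈ b → b ≈ a
      trns  : ∀ {a b c} → a ≈ b → b ≈ c → a ≈ c

  ≡-equiv : (A : Set) → Equiv A
  ≡-equiv A = record { _≈_ = _≡_ ; rfl = refl ; symm = sym ; trns = trans }

  pull : (A → B) → Equiv B → Equiv A
  pull f E = record { _≈_ = λ a b → f a ≈ f b ; rfl = rfl ; symm = symm ; trns = trns }
    where open Equiv E

  sub : Equiv A → (P : A → Set) → Equiv (Σ A P)
  sub E P = pull proj₁ E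

  infix 4 _≈[_]_ ∣_∣≡_
  _≈[_]_ : A → Equiv A → A → Set
  a ≈[ E ] b = Equiv._≈_ E a b

  ∣_∣≡_ : Equiv A → ℕ → Set
  ∣_∣≡_ {A} E N = HasCount A (Equiv._≈_ E) N

  count-push : {E : Equiv A} {F : Equiv B}
    (f : A → B) → (∀ {a b} → a ≈[ E ] b → f a ≈[ F ] f b) → (∀ {a b} → f a ≈[ F ] f b → a ≈[ E ] b) →
    (∀ b → Σ A λ a → f a ≈[ F ] b) → ∣ E ∣≡ N → ∣ F ∣≡ N
  count-push {F = F} f resp refl′ surj (e , inj , sur) =
    f ∘ e , (λ i j p → inj i j (refl′ p)) ,
    λ b → let a , p = surj b; i , r = sur a in i , Equiv.trns F (resp r) p

  count-pull : {E : Equiv A} {F : Equiv B}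
    (f : A → B) → (∀ {a b} → a ≈[ E ] b → f a ≈[ F ] f b) → (∀ {a b} → f a ≈[ F ] f b → a ≈[ E ] b) →
    (∀ b → Σ A λ a → f a ≈[ F ] b) → ∣ F ∣≡ N → ∣ E ∣≡ N
  count-pull {F = F} f resp refl′ surj (e , inj , sur) =
    proj₁ ∘ surj ∘ e ,
    (λ i j p → inj i j (trns (symm (proj₂ (surj (e i)))) (trns (resp p) (proj₂ (surj (e j)))))) ,
    λ a → let i , r = sur (f a) in i , refl′ (trns (proj₂ (surj (e i))) r)
    where open Equiv F

  count-≤ : (E : Equiv A) → ∣ E ∣≡ N → ∣ E ∣≡ M → N ≤ M
  count-≤ E (e , inj , _) (e′ , _ , sur′) = FP.injective⇒≤ {f = λ i → proj₁ (sur′ (e i))}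
    (λ {i} {j} p → inj i j (trns (symm (proj₂ (sur′ (e i)))) (subst (λ k → e′ k ≈ e j) (sym p) (proj₂ (sur′ (e j))))))
    where open Equiv E

  count-unique : (E : Equiv A) → ∣ E ∣≡ N → ∣ E ∣≡ M → N ≡ M
  count-unique E c c′ = ≤-antisym (count-≤ E c c′) (count-≤ E c′ c)

  count-empty : (E : Equiv A) → ¬ A → ∣ E ∣≡ 0
  count-empty E ¬a = (λ ()) , (λ ()) , λ a → ⊥-elim (¬a a)

  decode : (c : Fin N → ℕ) → Fin (sumF c) → Σ (Fin N) (Fin ∘ c)
  decode {suc N} c k = [ (λ j → Fin.zero , j) , (λ k′ → let i , j = decode (c ∘ Fin.suc) k′ in Fin.suc i , j) ]′
    (splitAt (c Fin.zero) k)

  encode : (c : Fin N → ℕ) → (i : Fin N) → Fin (c i) → Fin (sumF c)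
  encode c Fin.zero    j = j ↑ˡ _
  encode c (Fin.suc i) j = c Fin.zero ↑ʳ encode (c ∘ Fin.suc) i j

  decode-encode : (c : Fin N → ℕ) (i : Fin N) (j : Fin (c i)) → decode c (encode c i j) ≡ (i , j)
  decode-encode {suc N} c Fin.zero    j rewrite FP.splitAt-↑ˡ (c Fin.zero) j (sumF (c ∘ Fin.suc)) = refl
  decode-encode {suc N} c (Fin.suc i) j
    rewrite FP.splitAt-↑ʳ (c Fin.zero) (sumF (c ∘ Fin.suc)) (encode (c ∘ Fin.suc) i j)
          | decode-encode (c ∘ Fin.suc) i j = refl

  encode-decode : (c : Fin N → ℕ) (k : Fin (sumF c)) → encode c (proj₁ (decode c k)) (proj₂ (decode c k)) ≡ k
  encode-decode {suc N} c k with splitAt (c Fin.zero) k in eq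
  ... | inj₁ j  = FP.splitAt⁻¹-↑ˡ eq
  ... | inj₂ k′ = trans (cong (c Fin.zero ↑ʳ_) (encode-decode (c ∘ Fin.suc) k′)) (FP.splitAt⁻¹-↑ʳ eq)

  count-fibres : (E : Equiv A) (f : A → Fin N) → (∀ {a b} → a ≈[ E ] b → f a ≡ f b) →
    (c : Fin N → ℕ) → (∀ i → ∣ sub E (λ a → f a ≡ i) ∣≡ c i) → ∣ E ∣≡ sumF c
  count-fibres {A} E f resp c fib = e′ , inj′ , sur′
    where
    open Equiv E
    pt : ∀ p → A
    pt (i , j) = proj₁ (proj₁ (fib i) j)
    e′ = pt ∘ decode c
    pt-f : ∀ p → f (pt p) ≡ proj₁ p
    pt-f (i , j) = proj₂ (proj₁ (fib i) j)
    pt-inj : ∀ p p′ → pt p ≈ pt p′ → p ≡ p′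
    pt-inj p@(i , j) p′@(i′ , j′) r with trans (sym (pt-f p)) (trans (resp r) (pt-f p′))
    ... | refl = cong (i ,_) (proj₁ (proj₂ (fib i)) j j′ r)
    inj′ : ∀ k k′ → e′ k ≈ e′ k′ → k ≡ k′
    inj′ k k′ r = trans (sym (encode-decode c k)) (trans
      (cong (λ p → encode c (proj₁ p) (proj₂ p)) (pt-inj (decode c k) (decode c k′) r)) (encode-decode c k′))
    sur′ : ∀ a → Σ (Fin (sumF c)) λ k → e′ k ≈ a
    sur′ a = let j , r = proj₂ (proj₂ (fib (f a))) (a , refl) in
      encode c (f a) j , subst (λ p → pt p ≈ a) (sym (decode-encode c (f a) j)) r

  count-fibration : (E : Equiv A) (F : Equiv B)
    (f : A → B) → (∀ {a b} → a ≈[ E ] b → f a ≈[ F ] f b) → ∣ F ∣≡ N →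
    ∀ c → (∀ b → ∣ sub E (λ a → f a ≈[ F ] b) ∣≡ c) → ∣ E ∣≡ N * c
  count-fibration {A} {N = N} E F f resp (e , inj , sur) c fib =
    subst (∣ E ∣≡_) (sumF-const N c) (count-fibres E idx idx-resp (λ _ → c) fib′)
    where
    module E = Equiv E
    module F = Equiv F
    idx : A → Fin N
    idx a = proj₁ (sur (f a))
    idx-spec : ∀ a → e (idx a) F.≈ f a
    idx-spec a = proj₂ (sur (f a))
    idx-resp : ∀ {a b} → a E.≈ b → idx a ≡ idx b
    idx-resp {a} {b} r = inj _ _ (F.trns (idx-spec a) (F.trns (resp r) (F.symm (idx-spec b))))
    fib′ : ∀ i → ∣ sub E (λ a → idx a ≡ i) ∣≡ c
    fib′ i = count-push {E = sub E (λ a → f a F.≈ e i)} {F = sub E (λ a → idx a ≡ i)}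
      (λ { (a , p) → a , inj _ _ (F.trns (idx-spec a) p) }) id id
      (λ { (a , refl) → (a , F.symm (idx-spec a)) , E.rfl }) (fib (e i))

  -- Exhaustive search. It supplies the Boolean membership tests of spans and replaces classical
  -- existence arguments.
  count-any? : (E : Equiv A) → ∣ E ∣≡ N → {P : A → Set} → (∀ {a b} → a ≈[ E ] b → P a → P b) →
    (∀ a → Dec (P a)) → Dec (Σ A P)
  count-any? E (e , _ , sur) resp P? = map′ (λ { (i , p) → e i , p })
    (λ { (a , p) → let i , r = sur a in i , resp (Equiv.symm E r) p }) (FP.any? (P? ∘ e))

  count-all? : (E : Equiv A) → ∣ E ∣≡ N → {P : A → Set} → (∀ {a b} → a ≈[ E ] b → P a → P b) →
    (∀ a → Dec (P a)) → Dec (∀ a → P a)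
  count-all? E (e , _ , sur) resp P? = map′
    (λ h a → let i , r = sur a in resp r (h i)) (λ h i → h (e i)) (FP.all? (P? ∘ e))

  count-subset-Fin : ∀ N (p : Fin N → Bool) b → Σ ℕ λ n → ∣ sub (≡-equiv (Fin N)) (λ i → p i ≡ b) ∣≡ n
  count-subset-Fin zero p b = 0 , count-empty (sub (≡-equiv (Fin 0)) (λ i → p i ≡ b)) (λ ())
  count-subset-Fin (suc N) p b with count-subset-Fin N (p ∘ Fin.suc) b | p Fin.zero BP.≟ b
  ... | n , e , inj , sur | no ¬p = n ,
    (λ i → Fin.suc (proj₁ (e i)) , proj₂ (e i)) , (λ i j r → inj i j (FP.suc-injective r)) ,
    λ { (Fin.zero , r) → ⊥-elim (¬p r) ; (Fin.suc a , r) → let i , s = sur (a , r) in i , cong Fin.suc s }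
  ... | n , e , inj , sur | yes p₀ = suc n , e′ , inj′ , sur′
    where
    e′ : Fin (suc n) → Σ (Fin (suc N)) λ i → p i ≡ b
    e′ Fin.zero    = Fin.zero , p₀
    e′ (Fin.suc i) = Fin.suc (proj₁ (e i)) , proj₂ (e i)
    inj′ : ∀ i j → proj₁ (e′ i) ≡ proj₁ (e′ j) → i ≡ j
    inj′ Fin.zero    Fin.zero    r = refl
    inj′ (Fin.suc i) (Fin.suc j) r = cong Fin.suc (inj i j (FP.suc-injective r))
    sur′ : ∀ a → Σ (Fin (suc n)) λ i → proj₁ (e′ i) ≡ proj₁ a
    sur′ (Fin.zero , r)  = Fin.zero , refl
    sur′ (Fin.suc a , r) = let i , s = sur (a , r) in Fin.suc i , cong Fin.suc s

  count-subset : (E : Equiv A) → ∣ E ∣≡ N → (p : A → Bool) → (∀ {a b} → a ≈[ E ] b → p a ≡ p b) →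
    ∀ b → Σ ℕ λ n → ∣ sub E (λ a → p a ≡ b) ∣≡ n
  count-subset {N = N} E (e , inj , sur) p resp b =
    let n , c = count-subset-Fin N (p ∘ e) b in n ,
    count-push {E = sub (≡-equiv (Fin N)) (λ i → p (e i) ≡ b)} {F = sub E (λ a → p a ≡ b)}
      (λ { (i , r) → e i , r }) (λ { refl → rfl }) (inj _ _)
      (λ { (a , r) → let i , s = sur a in (i , trans (resp s) r) , s }) c
    where open Equiv E

  count-complement : (E : Equiv A) → ∣ E ∣≡ N → (p : A → Bool) → (∀ {a b} → a ≈[ E ] b → p a ≡ p b) →
    ∣ sub E (λ a → p a ≡ true) ∣≡ M → ∣ sub E (λ a → p a ≡ false) ∣≡ N ∸ M
  count-complement {A} {N} {M} E c p resp cT = subst (∣ sub E (λ a → p a ≡ false) ∣≡_) eq cF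
    where
    open Equiv E
    nF = proj₁ (count-subset E c p resp false)
    cF = proj₂ (count-subset E c p resp false)
    f : A → Fin 2
    f a with p a
    ... | true  = Fin.zero
    ... | false = Fin.suc Fin.zero
    f-true : ∀ a → p a ≡ true → f a ≡ Fin.zero
    f-true a eq rewrite eq = refl
    f-false : ∀ a → p a ≡ false → f a ≡ Fin.suc Fin.zero
    f-false a eq rewrite eq = refl
    true-f : ∀ a → f a ≡ Fin.zero → p a ≡ true
    true-f a eq with p a
    ... | true = refl
    false-f : ∀ a → f a ≡ Fin.suc Fin.zero → p a ≡ false
    false-f a eq with p a
    ... | false = refl
    f-resp : ∀ {a b} → a ≈ b → f a ≡ f b
    f-resp {a} {b} r with p a | p b | resp r
    ... | true  | .true  | refl = refl
    ... | false | .false | refl = refl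
    counts : Fin 2 → ℕ
    counts Fin.zero    = M
    counts (Fin.suc _) = nF
    fib : ∀ i → ∣ sub E (λ a → f a ≡ i) ∣≡ counts i
    fib Fin.zero = count-push {E = sub E (λ a → p a ≡ true)} {F = sub E (λ a → f a ≡ Fin.zero)}
      (λ { (a , r) → a , f-true a r }) id id (λ { (a , r) → (a , true-f a r) , rfl }) cT
    fib (Fin.suc Fin.zero) = count-push {E = sub E (λ a → p a ≡ false)} {F = sub E (λ a → f a ≡ Fin.suc Fin.zero)}
      (λ { (a , r) → a , f-false a r }) id id (λ { (a , r) → (a , false-f a r) , rfl }) cF
    total : N ≡ M + (nF + 0)
    total = count-unique E c (count-fibres E f f-resp counts fib)
    eq : nF ≡ N ∸ M
    eq = sym (trans (cong (_∸ M) total) (trans (m+n∸m≡n M (nF + 0)) (+-identityʳ nF)))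

  count-quotient-Fin : ∀ M (E : Equiv (Fin M)) → (∀ i j → Dec (i ≈[ E ] j)) → Σ ℕ λ N → ∣ E ∣≡ N
  count-quotient-Fin zero E _≈?_ = 0 , count-empty E (λ ())
  count-quotient-Fin (suc M) E _≈?_
    with count-quotient-Fin M (pull Fin.suc E) (λ i j → Fin.suc i ≈? Fin.suc j) | FP.any? (λ j → Fin.zero ≈? Fin.suc j)
  ... | N , e , inj , sur | yes (j , r) = N , Fin.suc ∘ e , inj ,
    λ { Fin.zero → let i , s = sur j in i , trns s (symm r) ; (Fin.suc a) → sur a }
    where open Equiv E
  ... | N , e , inj , sur | no ¬r = suc N , e′ , inj′ , sur′
    where
    open Equiv E
    e′ : Fin (suc N) → Fin (suc M)
    e′ Fin.zero    = Fin.zero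
    e′ (Fin.suc i) = Fin.suc (e i)
    inj′ : ∀ i j → e′ i ≈ e′ j → i ≡ j
    inj′ Fin.zero    Fin.zero    r = refl
    inj′ Fin.zero    (Fin.suc j) r = ⊥-elim (¬r (e j , r))
    inj′ (Fin.suc i) Fin.zero    r = ⊥-elim (¬r (e i , symm r))
    inj′ (Fin.suc i) (Fin.suc j) r = cong Fin.suc (inj i j r)
    sur′ : ∀ a → Σ (Fin (suc N)) λ i → e′ i ≈ a
    sur′ Fin.zero    = Fin.zero , rfl
    sur′ (Fin.suc a) = let i , s = sur a in Fin.suc i , s

  -- Division by the size of the fibres: the classes are found by deciding the relation on an
  -- enumeration of A, and counting A a second time, fibre by fibre, gives the product.
  count-quotient : (E : Equiv A) (F : Equiv B) →
    ∣ E ∣≡ M → (f : A → B) → (∀ {a b} → a ≈[ E ] b → f a ≈[ F ] f b) → (∀ a b → Dec (f a ≈[ F ] f b)) →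
    (∀ b → Σ A λ a → f a ≈[ F ] b) → ∀ c → (∀ b → ∣ sub E (λ a → f a ≈[ F ] b) ∣≡ c) →
    Σ ℕ λ N → ∣ F ∣≡ N × N * c ≡ M
  count-quotient {M = M} E F cE@(e , inj , sur) f resp dec surj c fib =
    let N , cQ = count-quotient-Fin M (pull (f ∘ e) F) (λ i j → dec (e i) (e j))
        cF = count-push {E = pull (f ∘ e) F} {F = F} (f ∘ e) id id
               (λ b → let a , r = surj b; i , s = sur a in i , F.trns (resp s) r) cQ
    in N , cF , count-unique E (count-fibration E F f resp cF c fib) cE
    where
    module E = Equiv E
    module F = Equiv F

  ≗-equiv : (n : ℕ) (E : Equiv A) → Equiv (Fin n → A)
  ≗-equiv n E = record
    { _≈_ = λ f g → ∀ i → f i ≈ g i ; rfl = λ _ → rfl ; symm = λ r i → symm (r i) ; trns = λ r s i → trns (r i) (s i) }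
    where open Equiv E

  count-functions : (E : Equiv A) → ∣ E ∣≡ N → ∀ n → ∣ ≗-equiv n E ∣≡ N ^ n
  count-functions E c zero = (λ _ ()) , (λ { Fin.zero Fin.zero _ → refl }) , λ _ → Fin.zero , λ ()
  count-functions {A} {N} E c (suc n) = subst (∣ ≗-equiv (suc n) E ∣≡_) (*-comm (N ^ n) N)
    (count-fibration (≗-equiv (suc n) E) (≗-equiv n E) tail (λ r i → r (Fin.suc i)) (count-functions E c n) N fib)
    where
    open Equiv E
    fib : ∀ g → ∣ sub (≗-equiv (suc n) E) (λ f → ∀ i → f (Fin.suc i) ≈ g i) ∣≡ N
    fib g = count-push {E = E} {F = sub (≗-equiv (suc n) E) (λ f → ∀ i → f (Fin.suc i) ≈ g i)}
      (λ a → a ◂ g , λ i → rfl)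
      (λ { r Fin.zero → r ; r (Fin.suc i) → rfl })
      (λ r → r Fin.zero)
      (λ { (f , r) → f Fin.zero , λ { Fin.zero → rfl ; (Fin.suc i) → symm (r i) } }) c

open Combinatorics using (anti; anti-cong′; sh; sh-∸; sh-small; sumF; ⌊⌋-⇔; module QBinomial; module PermutationSums)
open Counting

⌊⌋-true : ∀ {P : Set} (P? : Dec P) → P → ⌊ P? ⌋ ≡ true
⌊⌋-true P? p = trans (isYes≗does P?) (dec-true P? p)

⌊⌋-true⁻ : ∀ {P : Set} (P? : Dec P) → ⌊ P? ⌋ ≡ true → P
⌊⌋-true⁻ (yes p) _ = p

-- Linear algebra over a finite field.

module LinearAlgebra (K : Field) where
  open Field K using (Carrier; isCommutativeRing; 0≢1; inverse)
  open LinAlg K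

  commutativeRing : CommutativeRing 0ℓ 0ℓ
  commutativeRing = record { isCommutativeRing = isCommutativeRing }

  open CommutativeRing commutativeRing public
    using (_+_; _*_; -_; 0#; 1#; +-assoc; +-comm; +-identityˡ; +-identityʳ; -‿inverseʳ; *-assoc; *-comm;
           *-identityˡ; *-identityʳ; distribˡ; distribʳ; zeroˡ; zeroʳ; ring)
  open import Algebra.Properties.Ring ring public
    using (-1*x≈-x; -‿involutive; +-cancelʳ)
  open ≡-Reasoning

  private variable
    m N : ℕ

  +-interchangeK : ∀ a b c d → (a + b) + (c + d) ≡ (a + c) + (b + d)
  +-interchangeK a b c d = begin
    (a + b) + (c + d) ≡⟨ +-assoc a b (c + d) ⟩
    a + (b + (c + d)) ≡⟨ cong (a +_) (sym (+-assoc b c d)) ⟩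
    a + ((b + c) + d) ≡⟨ cong (λ z → a + (z + d)) (+-comm b c) ⟩
    a + ((c + b) + d) ≡⟨ cong (a +_) (+-assoc c b d) ⟩
    a + (c + (b + d)) ≡⟨ sym (+-assoc a c (b + d)) ⟩
    (a + c) + (b + d) ∎

  *-leftSwap : ∀ a b c → a * (b * c) ≡ b * (a * c)
  *-leftSwap a b c = trans (sym (*-assoc a b c)) (trans (cong (_* c) (*-comm a b)) (*-assoc b a c))

  ∑-cong : {f g : Fin m → Carrier} → (∀ i → f i ≡ g i) → ∑ f ≡ ∑ g
  ∑-cong {zero}  h = refl
  ∑-cong {suc m} h = cong₂ _+_ (h Fin.zero) (∑-cong (h ∘ Fin.suc))

  ∑-zero : {f : Fin m → Carrier} → (∀ i → f i ≡ 0#) → ∑ f ≡ 0#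
  ∑-zero {zero}  h = refl
  ∑-zero {suc m} h = trans (cong₂ _+_ (h Fin.zero) (∑-zero (h ∘ Fin.suc))) (+-identityˡ 0#)

  ∑-+ : (f g : Fin m → Carrier) → ∑ (λ i → f i + g i) ≡ ∑ f + ∑ g
  ∑-+ {zero}  f g = sym (+-identityˡ 0#)
  ∑-+ {suc m} f g = trans (cong ((f Fin.zero + g Fin.zero) +_) (∑-+ (f ∘ Fin.suc) (g ∘ Fin.suc)))
    (+-interchangeK (f Fin.zero) (g Fin.zero) _ _)

  ∑-*ˡ : ∀ a (f : Fin m → Carrier) → ∑ (λ i → a * f i) ≡ a * ∑ f
  ∑-*ˡ {zero}  a f = sym (zeroʳ a)
  ∑-*ˡ {suc m} a f = trans (cong (a * f Fin.zero +_) (∑-*ˡ a (f ∘ Fin.suc))) (sym (distribˡ a _ _))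

  δ : Fin m → Fin m → Carrier
  δ Fin.zero    Fin.zero    = 1#
  δ Fin.zero    (Fin.suc j) = 0#
  δ (Fin.suc i) Fin.zero    = 0#
  δ (Fin.suc i) (Fin.suc j) = δ i j

  ∑-δ : (c : Fin m → Carrier) (i : Fin m) → ∑ (λ j → c j * δ i j) ≡ c i
  ∑-δ c Fin.zero    = trans (cong₂ _+_ (*-identityʳ _) (∑-zero (λ j → zeroʳ (c (Fin.suc j))))) (+-identityʳ _)
  ∑-δ c (Fin.suc i) = trans (cong₂ _+_ (zeroʳ _) (∑-δ (c ∘ Fin.suc) i)) (+-identityˡ _)

  record IsLinear {N} (f : Vect N → Carrier) : Set where
    field
      f-cong : ∀ {u v} → u ≗V v → f u ≡ f v
      f-+    : ∀ u v → f (u +V v) ≡ f u + f v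
      f-·    : ∀ a v → f (a ·V v) ≡ a * f v

    f-0 : f 0V ≡ 0#
    f-0 = trans (f-cong {0V} {0# ·V 0V} (λ _ → sym (zeroˡ 0#))) (trans (f-· 0# 0V) (zeroˡ _))

    f-lincomb : ∀ {m} (c : Fin m → Carrier) (b : Fin m → Vect N) → f (lincomb c b) ≡ ∑ (λ i → c i * f (b i))
    f-lincomb {zero}  c b = f-0
    f-lincomb {suc m} c b = trans (f-+ (c Fin.zero ·V b Fin.zero) (lincomb (tail c) (tail b)))
      (cong₂ _+_ (f-· _ _) (f-lincomb (tail c) (tail b)))

  ev-linearˡ : (B : Form N) (v : Vect N) → IsLinear (λ u → ev B u v)
  ev-linearˡ {N} B v = record
    { f-cong = λ {u} {u′} e → ∑-cong (λ i → ∑-cong (λ j → cong (_* (B i j * v j)) (e i)))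
    ; f-+ = λ u u′ → trans (∑-cong (λ i → trans (∑-cong (λ j → distribʳ (B i j * v j) (u i) (u′ i)))
          (∑-+ {N} (λ j → u i * (B i j * v j)) (λ j → u′ i * (B i j * v j)))))
        (∑-+ {N} (λ i → ∑ (λ j → u i * (B i j * v j))) (λ i → ∑ (λ j → u′ i * (B i j * v j))))
    ; f-· = λ a u → trans (∑-cong (λ i → trans (∑-cong (λ j → *-assoc a (u i) (B i j * v j)))
          (∑-*ˡ {N} a (λ j → u i * (B i j * v j)))))
        (∑-*ˡ {N} a (λ i → ∑ (λ j → u i * (B i j * v j))))
    }

  ev-linearʳ : (B : Form N) (u : Vect N) → IsLinear (ev B u)
  ev-linearʳ {N} B u = record
    { f-cong = λ e → ∑-cong (λ i → ∑-cong (λ j → cong (λ z → u i * (B i j * z)) (e j)))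
    ; f-+ = λ v v′ → trans (∑-cong (λ i → trans (∑-cong (λ j →
        trans (cong (u i *_) (distribˡ (B i j) (v j) (v′ j))) (distribˡ (u i) _ _)))
          (∑-+ {N} (λ j → u i * (B i j * v j)) (λ j → u i * (B i j * v′ j)))))
        (∑-+ {N} (λ i → ∑ (λ j → u i * (B i j * v j))) (λ i → ∑ (λ j → u i * (B i j * v′ j))))
    ; f-· = λ a v → trans (∑-cong (λ i → trans (∑-cong (λ j →
        trans (cong (u i *_) (*-leftSwap (B i j) a (v j))) (*-leftSwap (u i) a _)))
          (∑-*ˡ {N} a (λ j → u i * (B i j * v j)))))
        (∑-*ˡ {N} a (λ i → ∑ (λ j → u i * (B i j * v j))))
    }

  lincomb-cong : {c c′ : Fin m → Carrier} {b b′ : Fin m → Vect N} →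
    (∀ i → c i ≡ c′ i) → (∀ i → b i ≗V b′ i) → lincomb c b ≗V lincomb c′ b′
  lincomb-cong e e′ j = ∑-cong (λ i → cong₂ _*_ (e i) (e′ i j))

  lincomb-+ : (c c′ : Fin m → Carrier) (b : Fin m → Vect N) → lincomb (c +V c′) b ≗V (lincomb c b +V lincomb c′ b)
  lincomb-+ c c′ b j = trans (∑-cong (λ i → distribʳ (b i j) (c i) (c′ i)))
    (∑-+ (λ i → c i * b i j) (λ i → c′ i * b i j))

  lincomb-· : ∀ a (c : Fin m → Carrier) (b : Fin m → Vect N) → lincomb (a ·V c) b ≗V (a ·V lincomb c b)
  lincomb-· a c b j = trans (∑-cong (λ i → *-assoc a (c i) (b i j))) (∑-*ˡ a (λ i → c i * b i j))

  lincomb-0 : (b : Fin m → Vect N) → lincomb 0V b ≗V 0V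
  lincomb-0 b j = ∑-zero (λ i → zeroˡ (b i j))

  x+-1*x : ∀ x → x + (- 1#) * x ≡ 0#
  x+-1*x x = trans (cong (x +_) (-1*x≈-x x)) (-‿inverseʳ x)

  x+-1*y≡0 : ∀ x y → x + (- 1#) * y ≡ 0# → x ≡ y
  x+-1*y≡0 x y e = +-cancelʳ ((- 1#) * y) x y (trans e (sym (x+-1*x y)))

  lincomb-injective : {b : Fin m → Vect N} → LinIndep b → ∀ c c′ → lincomb c b ≗V lincomb c′ b → ∀ i → c i ≡ c′ i
  lincomb-injective {b = b} ind c c′ e i = x+-1*y≡0 (c i) (c′ i) (ind (c +V ((- 1#) ·V c′)) zero-comb i)
    where
    zero-comb : lincomb (c +V ((- 1#) ·V c′)) b ≗V 0V
    zero-comb j = begin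
      lincomb (c +V ((- 1#) ·V c′)) b j              ≡⟨ lincomb-+ c ((- 1#) ·V c′) b j ⟩
      lincomb c b j + lincomb ((- 1#) ·V c′) b j     ≡⟨ cong₂ _+_ (e j) (lincomb-· (- 1#) c′ b j) ⟩
      lincomb c′ b j + (- 1#) * lincomb c′ b j       ≡⟨ x+-1*x _ ⟩
      0#                                             ∎

  LinIndep-tail : {b : Fin (suc m) → Vect N} → LinIndep b → LinIndep (tail b)
  LinIndep-tail {b = b} ind c e i = ind (0# ◂ c)
    (λ j → trans (cong₂ _+_ (zeroˡ (b Fin.zero j)) (e j)) (+-identityˡ 0#)) (Fin.suc i)

  LinIndep-resp : {b b′ : Fin m → Vect N} → (∀ i → b i ≗V b′ i) → LinIndep b → LinIndep b′
  LinIndep-resp e ind c h = ind c (λ j → trans (lincomb-cong (λ _ → refl) e j) (h j))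

  mem-lincomb : (S : Subspace N) (c : Fin m → Carrier) (b : Fin m → Vect N) → (∀ i → b i ∈S S) → lincomb c b ∈S S
  mem-lincomb {m = zero}  S c b h = mem-0 S
  mem-lincomb {m = suc m} S c b h = mem-+ S _ _ (mem-· S (c Fin.zero) (b Fin.zero) (h Fin.zero))
    (mem-lincomb S (tail c) (tail b) (h ∘ Fin.suc))

  ∈S-resp : (S : Subspace N) {u v : Vect N} → u ≗V v → u ∈S S → v ∈S S
  ∈S-resp S {u} {v} e h = trans (sym (mem-resp S u v e)) h

  VE : (N : ℕ) → Equiv (Vect N)
  VE N = ≗-equiv N (≡-equiv Carrier)

  SubspaceE : (N : ℕ) → Equiv (Subspace N)
  SubspaceE N = record
    { _≈_ = SameSub ; rfl = λ _ → refl ; symm = λ r v → sym (r v) ; trns = λ r s v → trans (r v) (s v) }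

  _⊆S_ : Subspace N → Subspace N → Set
  S ⊆S T = ∀ v → v ∈S S → v ∈S T

  ⊆-antisym : (S T : Subspace N) → S ⊆S T → T ⊆S S → SameSub S T
  ⊆-antisym S T h h′ v with mem S v in eS | mem T v in eT
  ... | true  | true  = refl
  ... | false | false = refl
  ... | true  | false = ⊥-elim (BP.not-¬ refl (trans (sym (h v eS)) eT))
  ... | false | true  = ⊥-elim (BP.not-¬ refl (trans (sym (h′ v eT)) eS))

  module FiniteField (q : ℕ) (enum : Fin q ↔ Carrier) where

    count-Carrier : ∣ ≡-equiv Carrier ∣≡ q
    count-Carrier = Inverse.to enum ,
      (λ i j e → trans (sym (Inverse.strictlyInverseʳ enum i)) (trans (cong (Inverse.from enum) e) (Inverse.strictlyInverseʳ enum j))) ,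
      λ a → Inverse.from enum a , Inverse.strictlyInverseˡ enum a

    _≟K_ : (a b : Carrier) → Dec (a ≡ b)
    a ≟K b = map′ (λ e → trans (sym (Inverse.strictlyInverseˡ enum a)) (trans (cong (Inverse.to enum) e) (Inverse.strictlyInverseˡ enum b)))
      (cong (Inverse.from enum)) (Inverse.from enum a Fin.≟ Inverse.from enum b)

    1<q : 1 ℕ.< q
    1<q = ℕP.≰⇒> (λ q≤1 → 0≢1 (trans (sym (Inverse.strictlyInverseˡ enum 0#))
      (trans (cong (Inverse.to enum) (subsingleton q≤1 _ _)) (Inverse.strictlyInverseˡ enum 1#))))
      where
      subsingleton : q ℕ.≤ 1 → (i j : Fin q) → i ≡ j
      subsingleton (ℕ.s≤s ℕ.z≤n) Fin.zero Fin.zero = refl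

    count-Vect : ∀ N → ∣ VE N ∣≡ q ^ N
    count-Vect = count-functions (≡-equiv Carrier) count-Carrier

    _≗V?_ : (u v : Vect N) → Dec (u ≗V v)
    u ≗V? v = FP.all? (λ i → u i ≟K v i)

    inSpan? : (b : Fin m → Vect N) (v : Vect N) → Dec (Σ (Fin m → Carrier) λ c → lincomb c b ≗V v)
    inSpan? {m} b v = count-any? (VE m) (count-Vect m)
      (λ e h j → trans (sym (lincomb-cong {b = b} e (λ _ _ → refl) j)) (h j)) (λ c → lincomb c b ≗V? v)

    span : (Fin m → Vect N) → Subspace N
    span b = record
      { mem      = λ v → ⌊ inSpan? b v ⌋
      ; mem-resp = λ u v e → ⌊⌋-⇔ (inSpan? b u) (inSpan? b v)
          (λ { (c , h) → c , λ j → trans (h j) (e j) }) (λ { (c , h) → c , λ j → trans (h j) (sym (e j)) })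
      ; mem-0    = ⌊⌋-true (inSpan? b 0V) (0V , lincomb-0 b)
      ; mem-+    = λ u v hu hv →
          let c , e = ⌊⌋-true⁻ (inSpan? b u) hu; c′ , e′ = ⌊⌋-true⁻ (inSpan? b v) hv in
          ⌊⌋-true (inSpan? b _) (c +V c′ , λ j → trans (lincomb-+ c c′ b j) (cong₂ _+_ (e j) (e′ j)))
      ; mem-·    = λ a v hv → let c , e = ⌊⌋-true⁻ (inSpan? b v) hv in
          ⌊⌋-true (inSpan? b _) (a ·V c , λ j → trans (lincomb-· a c b j) (cong (a *_) (e j)))
      }

    span-elim : (b : Fin m → Vect N) {v : Vect N} → v ∈S span b → Σ (Fin m → Carrier) λ c → lincomb c b ≗V v
    span-elim b {v} = ⌊⌋-true⁻ (inSpan? b v)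

    span-intro : (b : Fin m → Vect N) {v : Vect N} → ∀ c → lincomb c b ≗V v → v ∈S span b
    span-intro b {v} c e = ⌊⌋-true (inSpan? b v) (c , e)

    ∉-span : (b : Fin m → Vect N) {v : Vect N} → ¬ (Σ (Fin m → Carrier) λ c → lincomb c b ≗V v) → mem (span b) v ≡ false
    ∉-span b {v} h = trans (isYes≗does (inSpan? b v)) (dec-false (inSpan? b v) h)

    basis⊆span : (b : Fin m → Vect N) → ∀ i → b i ∈S span b
    basis⊆span b i = span-intro b (δ i) (λ j → trans (∑-cong (λ l → *-comm (δ i l) (b l j))) (∑-δ (λ l → b l j) i))

    span-⊆ : (S : Subspace N) (b : Fin m → Vect N) → (∀ i → b i ∈S S) → span b ⊆S S
    span-⊆ S b h v v∈ = let c , e = span-elim b v∈ in ∈S-resp S e (mem-lincomb S c b h)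

    span-hasDim : (b : Fin m → Vect N) → LinIndep b → HasDim (span b) m
    span-hasDim b ind = b , basis⊆span b , ind , λ v v∈ → let c , e = span-elim b v∈ in c , λ j → sym (e j)

    basis-span : (S : Subspace N) ((b , _) : HasDim S m) → SameSub (span b) S
    basis-span S (b , b∈ , ind , sp) = ⊆-antisym (span b) S (span-⊆ S b b∈)
      (λ v v∈ → let c , e = sp v v∈ in span-intro b c (λ j → sym (e j)))

    count-elements : (S : Subspace N) → HasDim S m → ∣ sub (VE N) (_∈S S) ∣≡ q ^ m
    count-elements {N} {m} S (b , b∈ , ind , sp) = count-push {E = VE m} {F = sub (VE N) (_∈S S)}
      (λ c → lincomb c b , mem-lincomb S c b b∈)
      (λ e → lincomb-cong {b = b} e (λ _ _ → refl))
      (λ {c} {c′} → lincomb-injective ind c c′)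
      (λ { (v , v∈) → let c , e = sp v v∈ in c , λ j → sym (e j) })
      (count-Vect m)

    -- The number of elements is q^m and q > 1, so counting takes the place of an exchange argument.
    HasDim-unique : (S : Subspace N) → ∀ {m m′} → HasDim S m → HasDim S m′ → m ≡ m′
    HasDim-unique {N} S {m} {m′} h h′ = ^-injective (count-unique (sub (VE N) (_∈S S)) (count-elements S h) (count-elements S h′))
      where
      ^-injective : q ^ m ≡ q ^ m′ → m ≡ m′
      ^-injective e with ℕP.<-cmp m m′
      ... | tri< lt _ _ = ⊥-elim (ℕP.<⇒≢ (ℕP.^-monoʳ-< q 1<q lt) e)
      ... | tri≈ _ eq _ = eq
      ... | tri> _ _ gt = ⊥-elim (ℕP.<⇒≢ (ℕP.^-monoʳ-< q 1<q gt) (sym e))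

    -- Both have q^m elements, so the part of `T` outside `S` has q^m - q^m = 0 of them.
    full-dimension : (S T : Subspace N) → HasDim S m → HasDim T m → S ⊆S T → T ⊆S S
    full-dimension {N} {m} S T hS hT sub⊆ v v∈T with mem S v in eq
    ... | true  = refl
    ... | false = ⊥-elim (FP.¬Fin0 (subst Fin (ℕP.n∸n≡0 (q ^ m)) (proj₁ (proj₂ (proj₂ rest) ((v , v∈T) , eq)))))
      where
      E = sub (VE N) (_∈S T)
      rest : ∣ sub E (λ x → mem S (proj₁ x) ≡ false) ∣≡ q ^ m ∸ q ^ m
      rest = count-complement E (count-elements T hT) (mem S ∘ proj₁) (λ {a} {b} e → mem-resp S (proj₁ a) (proj₁ b) e)
        (count-push {E = sub (VE N) (_∈S S)} {F = sub E (λ x → mem S (proj₁ x) ≡ true)}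
          (λ { (u , u∈) → (u , sub⊆ u u∈) , u∈ }) id id (λ { ((u , _) , u∈) → (u , u∈) , λ _ → refl }) (count-elements S hS))

    LinIndep-cons : (b : Fin m → Vect N) (v : Vect N) → LinIndep b → mem (span b) v ≡ false → LinIndep (v ◂ b)
    LinIndep-cons {m} b v ind v∉ c e with c Fin.zero ≟K 0#
    ... | yes c₀≡0 = λ { Fin.zero → c₀≡0 ; (Fin.suc i) → ind (tail c) tail≡0 i }
      where
      tail≡0 : lincomb (tail c) b ≗V 0V
      tail≡0 j = begin
        lincomb (tail c) b j                         ≡⟨ sym (+-identityˡ _) ⟩
        0# + lincomb (tail c) b j                    ≡⟨ cong (_+ lincomb (tail c) b j) (sym (trans (cong (_* v j) c₀≡0) (zeroˡ (v j)))) ⟩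
        c Fin.zero * v j + lincomb (tail c) b j      ≡⟨ e j ⟩
        0#                                           ∎
    ... | no c₀≢0 = ⊥-elim (BP.not-¬ refl (trans (sym (span-intro b (a ·V tail c) inspan)) v∉))
      where
      y = proj₁ (inverse (c Fin.zero) c₀≢0)
      a = y * (- 1#)
      inspan : lincomb (a ·V tail c) b ≗V v
      inspan j = begin
        lincomb (a ·V tail c) b j              ≡⟨ lincomb-· a (tail c) b j ⟩
        y * (- 1#) * lincomb (tail c) b j      ≡⟨ *-assoc y (- 1#) _ ⟩
        y * ((- 1#) * lincomb (tail c) b j)    ≡⟨ cong (y *_) (sym c₀v) ⟩
        y * (c Fin.zero * v j)                 ≡⟨ sym (*-assoc y _ _) ⟩
        y * c Fin.zero * v j                   ≡⟨ cong (_* v j) (trans (*-comm y _) (proj₂ (inverse (c Fin.zero) c₀≢0))) ⟩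
        1# * v j                               ≡⟨ *-identityˡ (v j) ⟩
        v j                                    ∎
        where
        c₀v : c Fin.zero * v j ≡ (- 1#) * lincomb (tail c) b j
        c₀v = +-cancelʳ (lincomb (tail c) b j) _ _ (trans (e j) (sym (trans (+-comm _ _) (x+-1*x _))))

    LinIndep-head : (b : Fin (suc m) → Vect N) → LinIndep b → mem (span (tail b)) (b Fin.zero) ≡ false
    LinIndep-head b ind = ∉-span (tail b) (λ { (c , e) → 0≢1 (sym (begin
      1#            ≡⟨ sym (-‿involutive 1#) ⟩
      - (- 1#)      ≡⟨ cong -_ (ind ((- 1#) ◂ c) (λ j → trans (+-comm _ _) (trans (cong (_+ (- 1#) * b Fin.zero j) (e j)) (x+-1*x (b Fin.zero j)))) Fin.zero) ⟩
      - 0#          ≡⟨ sym (+-identityˡ (- 0#)) ⟩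
      0# + - 0#     ≡⟨ -‿inverseʳ 0# ⟩
      0#            ∎)) })

-- Numerical identities for numbers of frames.

module FrameNumbers (q : ℕ) where
  open QBinomial q
  open ≡-Reasoning

  -- `A m` is the number of vectors compatible with a frame of length m, including the q^m vectors
  -- of its span, which are then discarded.
  frames : (ℕ → ℕ) → ℕ → ℕ
  frames A zero    = 1
  frames A (suc m) = frames A m ℕ.* (A m ∸ q ^ m)

  frames-vanish : ∀ A {l m} → l ℕ.< m → A l ≡ q ^ l → frames A m ≡ 0
  frames-vanish A {l} {suc m} l<m e with ℕP.m≤n⇒m<n∨m≡n (ℕP.≤-pred l<m)
  ... | inj₁ l<m′ = cong (ℕ._* (A m ∸ q ^ m)) (frames-vanish A l<m′ e)
  ... | inj₂ refl = trans (cong (frames A l ℕ.*_) (trans (cong (_∸ q ^ l) e) (ℕP.n∸n≡0 (q ^ l)))) (ℕP.*-zeroʳ (frames A l))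

  frames-nonZero : ∀ A m → (∀ l → l ℕ.< m → q ^ l ℕ.< A l) → ℕ.NonZero (frames A m)
  frames-nonZero A zero    h = _
  frames-nonZero A (suc m) h = ℕP.m*n≢0 (frames A m) (A m ∸ q ^ m)
    {{frames-nonZero A m (λ l l<m → h l (ℕP.m<n⇒m<1+n l<m))}}
    {{ℕ.>-nonZero (ℕP.m<n⇒0<n∸m (h m (ℕP.n<1+n m)))}}

  module _ (1<q : 1 ℕ.< q) where
    private
      p = q ∸ 1
      q≡1+p : q ≡ suc p
      q≡1+p = sym (ℕP.m+[n∸m]≡n (ℕP.<⇒≤ 1<q))

    p*qint : ∀ n → suc (p ℕ.* qint n) ≡ q ^ n
    p*qint zero    = cong suc (ℕP.*-zeroʳ p)
    p*qint (suc n) = begin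
      suc (p ℕ.* (1 ℕ.+ q ℕ.* qint n))        ≡⟨ lem p q (qint n) ⟩
      suc p ℕ.+ q ℕ.* (p ℕ.* qint n)          ≡⟨ cong (ℕ._+ q ℕ.* (p ℕ.* qint n)) (sym q≡1+p) ⟩
      q ℕ.+ q ℕ.* (p ℕ.* qint n)              ≡⟨ sym (ℕP.*-suc q (p ℕ.* qint n)) ⟩
      q ℕ.* suc (p ℕ.* qint n)                ≡⟨ cong (q ℕ.*_) (p*qint n) ⟩
      q ^ suc n                               ∎
      where
      lem : ∀ p q x → suc (p ℕ.* (1 ℕ.+ q ℕ.* x)) ≡ suc p ℕ.+ q ℕ.* (p ℕ.* x)
      lem = solve-∀

    q^-difference : ∀ j n → q ^ (j ℕ.+ n) ∸ q ^ j ≡ q ^ j ℕ.* (p ℕ.* qint n)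
    q^-difference j n = begin
      q ^ (j ℕ.+ n) ∸ q ^ j                         ≡⟨ cong (_∸ q ^ j) (ℕP.^-distribˡ-+-* q j n) ⟩
      q ^ j ℕ.* q ^ n ∸ q ^ j                       ≡⟨ cong (λ z → q ^ j ℕ.* z ∸ q ^ j) (sym (p*qint n)) ⟩
      q ^ j ℕ.* suc (p ℕ.* qint n) ∸ q ^ j          ≡⟨ cong (_∸ q ^ j) (ℕP.*-suc (q ^ j) (p ℕ.* qint n)) ⟩
      q ^ j ℕ.+ q ^ j ℕ.* (p ℕ.* qint n) ∸ q ^ j    ≡⟨ ℕP.m+n∸m≡n (q ^ j) _ ⟩
      q ^ j ℕ.* (p ℕ.* qint n)                      ∎

    -- The factor q^(j(j-1)/2) (q-1)^j of the number of j-frames. It does not depend on the ambient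
    -- dimension and therefore cancels in the quotient by the number of bases.
    κ : ℕ → ℕ
    κ zero    = 1
    κ (suc j) = κ j ℕ.* (q ^ j ℕ.* p)

    frames-qfac : ∀ j i N → j ℕ.+ i ≡ N → frames (λ _ → q ^ N) j ℕ.* qfac i ≡ κ j ℕ.* qfac N
    frames-qfac zero    i N refl = refl
    frames-qfac (suc j) i N refl = begin
      F ℕ.* (q ^ N ∸ q ^ j) ℕ.* qfac i
        ≡⟨ cong (λ z → F ℕ.* z ℕ.* qfac i) (trans (cong (λ z → q ^ z ∸ q ^ j) (sym (ℕP.+-suc j i))) (q^-difference j (suc i))) ⟩
      F ℕ.* (q ^ j ℕ.* (p ℕ.* qint (suc i))) ℕ.* qfac i
        ≡⟨ lem F (q ^ j) p (qint (suc i)) (qfac i) ⟩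
      F ℕ.* qfac (suc i) ℕ.* (q ^ j ℕ.* p)
        ≡⟨ cong (ℕ._* (q ^ j ℕ.* p)) (frames-qfac j (suc i) N (ℕP.+-suc j i)) ⟩
      κ j ℕ.* qfac N ℕ.* (q ^ j ℕ.* p)
        ≡⟨ lem₂ (κ j) (qfac N) (q ^ j ℕ.* p) ⟩
      κ (suc j) ℕ.* qfac N ∎
      where
      F = frames (λ _ → q ^ N) j
      lem : ∀ f x p y z → f ℕ.* (x ℕ.* (p ℕ.* y)) ℕ.* z ≡ f ℕ.* (y ℕ.* z) ℕ.* (x ℕ.* p)
      lem = solve-∀
      lem₂ : ∀ a b c → a ℕ.* b ℕ.* c ≡ a ℕ.* c ℕ.* b
      lem₂ = solve-∀

    frames-subspaces : ∀ j i → qb j i ℕ.* frames (λ _ → q ^ j) j ≡ frames (λ _ → q ^ (j ℕ.+ i)) j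
    frames-subspaces j i = ℕP.*-cancelʳ-≡ _ _ (qfac i) {{qfac-nonZero i}} (begin
      qb j i ℕ.* frames (λ _ → q ^ j) j ℕ.* qfac i
        ≡⟨ cong (λ z → qb j i ℕ.* z ℕ.* qfac i) (trans (sym (ℕP.*-identityʳ _)) (frames-qfac j 0 j (ℕP.+-identityʳ j))) ⟩
      qb j i ℕ.* (κ j ℕ.* qfac j) ℕ.* qfac i
        ≡⟨ lem (qb j i) (κ j) (qfac j) (qfac i) ⟩
      κ j ℕ.* (qb j i ℕ.* (qfac j ℕ.* qfac i))
        ≡⟨ cong (κ j ℕ.*_) (qb-qfac j i) ⟩
      κ j ℕ.* qfac (j ℕ.+ i)
        ≡⟨ sym (frames-qfac j i (j ℕ.+ i) refl) ⟩
      frames (λ _ → q ^ (j ℕ.+ i)) j ℕ.* qfac i ∎)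
      where
      lem : ∀ a b c d → a ℕ.* (b ℕ.* c) ℕ.* d ≡ b ℕ.* (a ℕ.* (c ℕ.* d))
      lem = solve-∀

    -- The factors are differences of squares: q^(2d-j) - q^j = (q^d - q^j)(1 + q^(d-j)). The first
    -- factor belongs to frames in a d-dimensional space, the second ones multiply up to `ρ φ±`.
    frames-isotropic : ∀ j i d → j ℕ.+ i ≡ d →
      frames (λ l → q ^ (2 ℕ.* d ∸ l)) j ≡ frames (λ _ → q ^ d) j ℕ.* ρ φ± j i
    frames-isotropic zero    i d e    = refl
    frames-isotropic (suc j) i d refl = begin
      frames A j ℕ.* (q ^ (2 ℕ.* d ∸ j) ∸ q ^ j)
        ≡⟨ cong₂ ℕ._*_ (frames-isotropic j (suc i) d (ℕP.+-suc j i)) factor ⟩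
      F ℕ.* ρ φ± j (suc i) ℕ.* ((q ^ d ∸ q ^ j) ℕ.* φ± (suc i))
        ≡⟨ lem F (ρ φ± j (suc i)) (q ^ d ∸ q ^ j) (φ± (suc i)) ⟩
      F ℕ.* (q ^ d ∸ q ^ j) ℕ.* (ρ φ± j (suc i) ℕ.* (φ± (suc i) ℕ.* 1))
        ≡⟨ cong (F ℕ.* (q ^ d ∸ q ^ j) ℕ.*_) (trans (ρ-+ φ± j 1 i) (cong (λ z → ρ φ± z i) (ℕP.+-comm j 1))) ⟩
      F ℕ.* (q ^ d ∸ q ^ j) ℕ.* ρ φ± (suc j) i ∎
      where
      A : ℕ → ℕ
      A l = q ^ (2 ℕ.* d ∸ l)
      F = frames (λ _ → q ^ d) j
      s = suc i
      x = q ^ j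
      lem : ∀ a b c e → a ℕ.* b ℕ.* (c ℕ.* e) ≡ a ℕ.* c ℕ.* (b ℕ.* (e ℕ.* 1))
      lem = solve-∀
      e₁ : ∀ j i → 2 ℕ.* (suc j ℕ.+ i) ≡ j ℕ.+ (j ℕ.+ (suc i ℕ.+ suc i))
      e₁ = solve-∀
      lem₂ : ∀ x z → x ℕ.* (suc z ℕ.* suc z) ≡ x ℕ.+ x ℕ.* z ℕ.* (2 ℕ.+ z)
      lem₂ = solve-∀
      z = p ℕ.* qint s
      factor : q ^ (2 ℕ.* d ∸ j) ∸ x ≡ (q ^ d ∸ x) ℕ.* φ± s
      factor = begin
        q ^ (2 ℕ.* d ∸ j) ∸ x
          ≡⟨ cong (λ n → q ^ n ∸ x) (trans (cong (_∸ j) (e₁ j i)) (ℕP.m+n∸m≡n j _)) ⟩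
        q ^ (j ℕ.+ (s ℕ.+ s)) ∸ x
          ≡⟨ cong (_∸ x) (trans (ℕP.^-distribˡ-+-* q j (s ℕ.+ s)) (cong (x ℕ.*_) (ℕP.^-distribˡ-+-* q s s))) ⟩
        x ℕ.* (q ^ s ℕ.* q ^ s) ∸ x
          ≡⟨ cong (λ y → x ℕ.* (y ℕ.* y) ∸ x) (sym (p*qint s)) ⟩
        x ℕ.* (suc z ℕ.* suc z) ∸ x
          ≡⟨ trans (cong (_∸ x) (lem₂ x z)) (ℕP.m+n∸m≡n x _) ⟩
        x ℕ.* z ℕ.* (2 ℕ.+ z)
          ≡⟨ cong₂ ℕ._*_ (sym (q^-difference j s)) (cong suc (p*qint s)) ⟩
        (q ^ (j ℕ.+ s) ∸ x) ℕ.* φ± s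
          ≡⟨ cong (λ n → (q ^ n ∸ x) ℕ.* φ± s) (ℕP.+-suc j i) ⟩
        (q ^ d ∸ x) ℕ.* φ± s ∎

-- Subspaces counted as frames divided by bases.

module Frames (K : Field) (q : ℕ) (enum : Fin q ↔ Field.Carrier K) where
  open Field K using (Carrier; 0≢1; inverse)
  open LinAlg K
  open LinearAlgebra K
  open FiniteField q enum
  open QBinomial q
  open FrameNumbers q

  private variable
    m N : ℕ

  -- A class of subspaces that can be built up one basis vector at a time, the number
  -- of admissible extensions depending on the dimension only.
  record Class (N : ℕ) : Set₁ where
    field
      C          : Subspace N → Set
      adm        : ∀ {m} → (Fin m → Vect N) → Set
      adm-resp   : ∀ {m} {b b′ : Fin m → Vect N} → (∀ i → b i ≗V b′ i) → adm b → adm b′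
      adm-nil    : (b : Fin 0 → Vect N) → adm b
      adm-tail   : ∀ {m} {b : Fin (suc m) → Vect N} → adm b → adm (tail b)
      C⇒adm      : ∀ {m} (S : Subspace N) (b : Fin m → Vect N) → C S → (∀ i → b i ∈S S) → adm b
      adm⇒C      : ∀ {m} (b : Fin m → Vect N) → adm b → C (span b)
      ext        : ∀ {m} (b : Fin m → Vect N) → Subspace N
      ext⇒adm    : ∀ {m} (b : Fin m → Vect N) v → adm b → v ∈S ext b → adm (v ◂ b)
      adm⇒ext    : ∀ {m} (b : Fin m → Vect N) v → adm (v ◂ b) → v ∈S ext b
      basis⊆ext  : ∀ {m} (b : Fin m → Vect N) → adm b → ∀ i → b i ∈S ext b
      A          : ℕ → ℕ
      ext-count  : ∀ {m} (b : Fin m → Vect N) → LinIndep b → adm b → ∣ sub (VE N) (_∈S ext b) ∣≡ A m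

    Frame : ℕ → Set
    Frame m = Σ (Fin m → Vect N) λ b → LinIndep b × adm b

    FrameE : ∀ m → Equiv (Frame m)
    FrameE m = pull proj₁ (≗-equiv m (VE N))

    -- The span of `b` lies inside `ext b` by `basis⊆ext`, so its q^m elements are removed from
    -- exactly `A m` candidates.
    count-extensions : ∀ m ((b , _) : Frame m) → ∣ sub (FrameE (suc m)) (λ x → ∀ i → tail (proj₁ x) i ≗V b i) ∣≡ A m ∸ q ^ m
    count-extensions m (b , ind , ad) =
      count-push {E = sub E′ (λ x → mem (span b) (proj₁ x) ≡ false)}
        {F = sub (FrameE (suc m)) (λ x → ∀ i → tail (proj₁ x) i ≗V b i)}
        (λ { ((v , v∈) , v∉) → (v ◂ b , LinIndep-cons b v ind v∉ , ext⇒adm b v ad v∈) , λ i j → refl })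
        (λ { r Fin.zero → r ; r (Fin.suc i) → λ _ → refl })
        (λ r → r Fin.zero)
        (λ { ((b′ , ind′ , ad′) , r) →
          let e : ∀ i → b′ i ≗V (b′ Fin.zero ◂ b) i
              e = λ { Fin.zero → λ _ → refl ; (Fin.suc i) → r i } in
          ((b′ Fin.zero , adm⇒ext b (b′ Fin.zero) (adm-resp e ad′)) ,
           LinIndep-head (b′ Fin.zero ◂ b) (LinIndep-resp e ind′)) ,
          λ { Fin.zero → λ _ → refl ; (Fin.suc i) j → sym (r i j) } })
        outside
      where
      E′ = sub (VE N) (_∈S ext b)
      outside : ∣ sub E′ (λ x → mem (span b) (proj₁ x) ≡ false) ∣≡ A m ∸ q ^ m
      outside = count-complement E′ (ext-count b ind ad) (mem (span b) ∘ proj₁)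
        (λ {u} {v} e → mem-resp (span b) (proj₁ u) (proj₁ v) e)
        (count-push {E = sub (VE N) (_∈S span b)} {F = sub E′ (λ x → mem (span b) (proj₁ x) ≡ true)}
          (λ { (u , u∈) → (u , span-⊆ (ext b) b (basis⊆ext b ad) u u∈) , u∈ }) id id
          (λ { ((u , _) , u∈) → (u , u∈) , λ _ → refl })
          (count-elements (span b) (span-hasDim b ind)))

    count-frames : ∀ m → ∣ FrameE m ∣≡ frames A m
    count-frames zero = (λ _ → (λ ()) , (λ _ _ ()) , adm-nil _) , (λ { Fin.zero Fin.zero _ → refl }) , λ _ → Fin.zero , λ ()
    count-frames (suc m) = count-fibration (FrameE (suc m)) (FrameE m)
      (λ { (b , ind , ad) → tail b , LinIndep-tail {b = b} ind , adm-tail ad }) (λ r i → r (Fin.suc i))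
      (count-frames m) (A m ∸ q ^ m) (count-extensions m)

    Member : ℕ → Set
    Member m = Σ (Subspace N) λ S → HasDim S m × C S

    MemberE : ∀ m → Equiv (Member m)
    MemberE m = pull proj₁ (SubspaceE N)

  within : (U : Subspace N) {k : ℕ} → HasDim U k → Class N
  within {N} U {k} h = record
    { C = λ S → S ⊆S U
    ; adm = λ b → ∀ i → b i ∈S U
    ; adm-resp = λ e ad i → ∈S-resp U (e i) (ad i)
    ; adm-nil = λ _ ()
    ; adm-tail = λ ad i → ad (Fin.suc i)
    ; C⇒adm = λ S b S⊆ b∈ i → S⊆ (b i) (b∈ i)
    ; adm⇒C = λ b ad → span-⊆ U b ad
    ; ext = λ _ → U
    ; ext⇒adm = λ { b v ad v∈ Fin.zero → v∈ ; b v ad v∈ (Fin.suc i) → ad i }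
    ; adm⇒ext = λ b v ad → ad Fin.zero
    ; basis⊆ext = λ b ad → ad
    ; A = λ _ → q ^ k
    ; ext-count = λ _ _ _ → count-elements U h
    }

  SameSub? : (S T : Subspace N) → Dec (SameSub S T)
  SameSub? {N} S T = count-all? (VE N) (count-Vect N)
    (λ {u} {v} e r → trans (sym (mem-resp S u v e)) (trans r (mem-resp T u v e)))
    (λ v → mem S v BP.≟ mem T v)

  -- By equality of dimensions, m independent vectors of `S` already span `S`. So the bases of `S`
  -- are the frames of the class `within S h`, whatever class `S` was taken from.
  count-bases : (𝒞 : Class N) → let open Class 𝒞 in ∀ m ((S , _) : Member m) →
    ∣ sub (FrameE m) (λ x → SameSub (span (proj₁ x)) S) ∣≡ frames (λ _ → q ^ m) m
  count-bases 𝒞 m (S , h , CS) = count-push {E = Class.FrameE (within S h) m} {F = sub (FrameE m) (λ x → SameSub (span (proj₁ x)) S)}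
    (λ { (b , ind , b∈) → (b , ind , C⇒adm S b CS b∈) ,
         ⊆-antisym (span b) S (span-⊆ S b b∈) (full-dimension (span b) S (span-hasDim b ind) h (span-⊆ S b b∈)) })
    id id
    (λ { ((b , ind , ad) , e) → (b , ind , λ i → trans (sym (e (b i))) (basis⊆span b i)) , λ _ _ → refl })
    (Class.count-frames (within S h) m)
    where open Class 𝒞

  count-members′ : (𝒞 : Class N) → let open Class 𝒞 in ∀ m → Σ ℕ λ n → ∣ MemberE m ∣≡ n × n ℕ.* frames (λ _ → q ^ m) m ≡ frames A m
  count-members′ 𝒞 m = count-quotient (FrameE m) (MemberE m) (count-frames m)
    (λ { (b , ind , ad) → span b , span-hasDim b ind , adm⇒C b ad })
    (λ {x} {y} r v → ⌊⌋-⇔ (inSpan? (proj₁ x) v) (inSpan? (proj₁ y) v)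
      (λ { (c , e) → c , λ j → trans (sym (lincomb-cong {b = proj₁ x} {b′ = proj₁ y} (λ _ → refl) r j)) (e j) })
      (λ { (c , e) → c , λ j → trans (lincomb-cong {b = proj₁ x} {b′ = proj₁ y} (λ _ → refl) r j) (e j) }))
    (λ x y → SameSub? (span (proj₁ x)) (span (proj₁ y)))
    (λ { (S , h@(b , b∈ , ind , sp) , CS) → (b , ind , C⇒adm S b CS b∈) , basis-span S h })
    (frames (λ _ → q ^ m) m) (count-bases 𝒞 m)
    where open Class 𝒞

  bases-nonZero : ∀ m → ℕ.NonZero (frames (λ _ → q ^ m) m)
  bases-nonZero m = frames-nonZero (λ _ → q ^ m) m (λ l l<m → ℕP.^-monoʳ-< q 1<q l<m)

  count-members : (𝒞 : Class N) → let open Class 𝒞 in ∀ m n → n ℕ.* frames (λ _ → q ^ m) m ≡ frames A m → ∣ MemberE m ∣≡ n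
  count-members 𝒞 m n e = let n′ , c , e′ = count-members′ 𝒞 m in
    subst (∣ Class.MemberE 𝒞 m ∣≡_) (ℕP.*-cancelʳ-≡ n′ n _ {{bases-nonZero m}} (trans e′ (sym e))) c

  -- At length D the span exhausts the admissible vectors, so the number of frames of any greater
  -- length contains a factor 0.
  dimension-≤ : (𝒞 : Class N) → let open Class 𝒞 in ∀ D → A D ≡ q ^ D → ∀ m → Member m → m ℕ.≤ D
  dimension-≤ 𝒞 D e m x = ℕP.≮⇒≥ (λ D<m →
    FP.¬Fin0 (proj₁ (proj₂ (proj₂ (count-members 𝒞 m 0 (sym (frames-vanish (Class.A 𝒞) D<m e)))) x)))

  count-within : (U : Subspace N) {k : ℕ} (h : HasDim U k) → ∀ j i → j ℕ.+ i ≡ k → ∣ Class.MemberE (within U h) j ∣≡ qb j i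
  count-within U h j i refl = count-members (within U h) j (qb j i) (frames-subspaces 1<q j i)

-- Isotropic subspaces of a symplectic space.

module Symplectic (K : Field) (q : ℕ) (enum : Fin q ↔ Field.Carrier K)
  (d : ℕ) (ω : LinAlg.Form K (2 ℕ.* d)) (alt : LinAlg.Alternating K ω) (nondeg : LinAlg.NonDegenerate K ω) where
  open Field K using (Carrier; 0≢1; inverse)
  open LinAlg K
  open LinearAlgebra K
  open FiniteField q enum
  open QBinomial q
  open FrameNumbers q
  open Frames K q enum
  open ≡-Reasoning

  N : ℕ
  N = 2 ℕ.* d

  private variable
    m : ℕ

  ⟨_,_⟩ : Vect N → Vect N → Carrier
  ⟨ u , v ⟩ = ev ω u v

  module L (v : Vect N) = IsLinear (ev-linearˡ ω v)
  module R (u : Vect N) = IsLinear (ev-linearʳ ω u)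

  orth-sym : ∀ u v → ⟨ u , v ⟩ ≡ 0# → ⟨ v , u ⟩ ≡ 0#
  orth-sym u v e = begin
    ⟨ v , u ⟩                                         ≡⟨ sym (trans (cong₂ _+_ (trans (cong₂ _+_ (alt u) e) (+-identityˡ 0#)) (trans (cong (⟨ v , u ⟩ +_) (alt v)) (+-identityʳ _))) (+-identityˡ _)) ⟩
    (⟨ u , u ⟩ + ⟨ u , v ⟩) + (⟨ v , u ⟩ + ⟨ v , v ⟩) ≡⟨ sym (cong₂ _+_ (R.f-+ u u v) (R.f-+ v u v)) ⟩
    ⟨ u , u +V v ⟩ + ⟨ v , u +V v ⟩                   ≡⟨ sym (L.f-+ (u +V v) u v) ⟩
    ⟨ u +V v , u +V v ⟩                               ≡⟨ alt (u +V v) ⟩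
    0#                                                ∎

  separating : ∀ g → ¬ (g ≗V 0V) → Σ (Vect N) λ v → ¬ (⟨ g , v ⟩ ≡ 0#)
  separating g g≢0 with count-any? (VE N) (count-Vect N) {P = λ v → ¬ (⟨ g , v ⟩ ≡ 0#)}
    (λ {u} {v} e h h′ → h (trans (R.f-cong g e) h′)) (λ v → ¬? (⟨ g , v ⟩ ≟K 0#))
  ... | yes p = p
  ... | no ¬p = ⊥-elim (g≢0 (nondeg g (λ v → decidable-stable (⟨ g , v ⟩ ≟K 0#) (λ h → ¬p (v , h)))))

  -- Dual vectors make v ↦ (⟨ b i , v ⟩)ᵢ surjective, and this determines the size of its kernel.
  -- The induction is a Gram-Schmidt process between `b` and its dual family.
  dual : ∀ {m} (b : Fin m → Vect N) → LinIndep b → Σ (Fin m → Vect N) λ u → ∀ i j → ⟨ b i , u j ⟩ ≡ δ i j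
  dual {zero}  b ind = (λ ()) , λ ()
  dual {suc m} b ind = u , dual-u
    where
    x = b Fin.zero
    b′ = tail b
    u′ : Fin m → Vect N
    u′ = proj₁ (dual b′ (LinIndep-tail {b = b} ind))
    dual′ : ∀ i j → ⟨ b′ i , u′ j ⟩ ≡ δ i j
    dual′ = proj₂ (dual b′ (LinIndep-tail {b = b} ind))
    -a : Fin m → Carrier
    -a j = (- 1#) * ⟨ x , u′ j ⟩
    -- The head corrected by its pairings with the old dual vectors. It is nonzero by independence,
    -- so non-degeneracy gives a `v` with ⟨ g , v ⟩ ≠ 0.
    g = (1# ·V x) +V lincomb -a b′
    g≢0 : ¬ (g ≗V 0V)
    g≢0 e = 0≢1 (sym (ind (1# ◂ -a) e Fin.zero))
    v = proj₁ (separating g g≢0)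
    s = ⟨ g , v ⟩
    s≢0 = proj₂ (separating g g≢0)
    s⁻¹ = proj₁ (inverse s s≢0)
    -c : Fin m → Carrier
    -c j = (- 1#) * ⟨ b′ j , v ⟩
    -- The correction makes `w` orthogonal to the whole tail `b′`; its pairing with `x` then turns
    -- out to be ⟨ g , v ⟩, hence invertible.
    w = v +V lincomb -c u′
    b′w : ∀ i → ⟨ b′ i , w ⟩ ≡ 0#
    b′w i = begin
      ⟨ b′ i , w ⟩                                      ≡⟨ R.f-+ (b′ i) v _ ⟩
      ⟨ b′ i , v ⟩ + ⟨ b′ i , lincomb -c u′ ⟩           ≡⟨ cong (⟨ b′ i , v ⟩ +_) (R.f-lincomb (b′ i) -c u′) ⟩
      ⟨ b′ i , v ⟩ + ∑ (λ j → -c j * ⟨ b′ i , u′ j ⟩)   ≡⟨ cong (⟨ b′ i , v ⟩ +_) (trans (∑-cong (λ j → cong (-c j *_) (dual′ i j))) (∑-δ -c i)) ⟩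
      ⟨ b′ i , v ⟩ + (- 1#) * ⟨ b′ i , v ⟩              ≡⟨ x+-1*x _ ⟩
      0#                                                ∎
    xw : ⟨ x , w ⟩ ≡ s
    xw = begin
      ⟨ x , w ⟩                                         ≡⟨ R.f-+ x v _ ⟩
      ⟨ x , v ⟩ + ⟨ x , lincomb -c u′ ⟩                 ≡⟨ cong (⟨ x , v ⟩ +_) (R.f-lincomb x -c u′) ⟩
      ⟨ x , v ⟩ + ∑ (λ j → -c j * ⟨ x , u′ j ⟩)         ≡⟨ cong₂ _+_ (sym (*-identityˡ _)) (∑-cong (λ j → swap ⟨ b′ j , v ⟩ ⟨ x , u′ j ⟩)) ⟩
      1# * ⟨ x , v ⟩ + ∑ (λ j → -a j * ⟨ b′ j , v ⟩)    ≡⟨ sym (cong₂ _+_ (L.f-· v 1# x) (L.f-lincomb v -a b′)) ⟩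
      ⟨ 1# ·V x , v ⟩ + ⟨ lincomb -a b′ , v ⟩           ≡⟨ sym (L.f-+ v (1# ·V x) (lincomb -a b′)) ⟩
      s                                                 ∎
      where
      swap : ∀ y z → (- 1#) * y * z ≡ (- 1#) * z * y
      swap y z = trans (*-assoc (- 1#) y z) (trans (cong ((- 1#) *_) (*-comm y z)) (sym (*-assoc (- 1#) z y)))
    u₀ = s⁻¹ ·V w
    xu₀ : ⟨ x , u₀ ⟩ ≡ 1#
    xu₀ = trans (R.f-· x s⁻¹ w) (trans (cong (s⁻¹ *_) xw) (trans (*-comm s⁻¹ s) (proj₂ (inverse s s≢0))))
    b′u₀ : ∀ i → ⟨ b′ i , u₀ ⟩ ≡ 0#
    b′u₀ i = trans (R.f-· (b′ i) s⁻¹ w) (trans (cong (s⁻¹ *_) (b′w i)) (zeroʳ s⁻¹))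
    -- Multiples of `u₀` make the old dual vectors orthogonal to `x`; since `u₀` is orthogonal to
    -- `b′`, their pairings with `b′` stay unchanged.
    u : Fin (suc m) → Vect N
    u = u₀ ◂ λ j → u′ j +V (-a j ·V u₀)
    dual-u : ∀ i j → ⟨ b i , u j ⟩ ≡ δ i j
    dual-u Fin.zero    Fin.zero    = xu₀
    dual-u (Fin.suc i) Fin.zero    = b′u₀ i
    dual-u Fin.zero    (Fin.suc j) = trans (R.f-+ x (u′ j) (-a j ·V u₀)) (trans
      (cong (⟨ x , u′ j ⟩ +_) (trans (R.f-· x (-a j) u₀) (trans (cong (-a j *_) xu₀) (*-identityʳ (-a j)))))
      (x+-1*x _))
    dual-u (Fin.suc i) (Fin.suc j) = trans (R.f-+ (b′ i) (u′ j) (-a j ·V u₀)) (trans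
      (cong₂ _+_ (dual′ i j) (trans (R.f-· (b′ i) (-a j) u₀) (trans (cong (-a j *_) (b′u₀ i)) (zeroʳ (-a j)))))
      (+-identityʳ _))

  perp? : (b : Fin m → Vect N) (v : Vect N) → Dec (∀ i → ⟨ b i , v ⟩ ≡ 0#)
  perp? b v = FP.all? (λ i → ⟨ b i , v ⟩ ≟K 0#)

  perp : (Fin m → Vect N) → Subspace N
  perp b = record
    { mem      = λ v → ⌊ perp? b v ⌋
    ; mem-resp = λ u v e → ⌊⌋-⇔ (perp? b u) (perp? b v)
        (λ h i → trans (sym (R.f-cong (b i) e)) (h i)) (λ h i → trans (R.f-cong (b i) e) (h i))
    ; mem-0    = ⌊⌋-true (perp? b 0V) (λ i → R.f-0 (b i))
    ; mem-+    = λ u v hu hv → ⌊⌋-true (perp? b (u +V v)) (λ i → trans (R.f-+ (b i) u v)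
        (trans (cong₂ _+_ (⌊⌋-true⁻ (perp? b u) hu i) (⌊⌋-true⁻ (perp? b v) hv i)) (+-identityˡ 0#)))
    ; mem-·    = λ a v hv → ⌊⌋-true (perp? b (a ·V v)) (λ i → trans (R.f-· (b i) a v)
        (trans (cong (a *_) (⌊⌋-true⁻ (perp? b v) hv i)) (zeroʳ a)))
    }

  -- All fibres of v ↦ (⟨ b i , v ⟩)ᵢ are translates of perp b, because dual vectors exist.
  count-perp : (b : Fin m → Vect N) → LinIndep b → ∣ sub (VE N) (_∈S perp b) ∣≡ q ^ (N ∸ m)
  count-perp {m} b ind = subst (∣ sub (VE N) (_∈S perp b) ∣≡_) size kernel-count
    where
    u = proj₁ (dual b ind)
    dual-u = proj₂ (dual b ind)
    kernelSize = proj₁ (count-subset (VE N) (count-Vect N) (mem (perp b)) (λ {x} {y} e → mem-resp (perp b) x y e) true)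
    kernel-count = proj₂ (count-subset (VE N) (count-Vect N) (mem (perp b)) (λ {x} {y} e → mem-resp (perp b) x y e) true)
    f : Vect N → Vect m
    f v i = ⟨ b i , v ⟩
    f-shift : ∀ c i → ⟨ b i , lincomb c u ⟩ ≡ c i
    f-shift c i = trans (R.f-lincomb (b i) c u) (trans (∑-cong (λ j → cong (c j *_) (dual-u i j))) (∑-δ c i))
    fib : ∀ c → ∣ sub (VE N) (λ v → f v ≗V c) ∣≡ kernelSize
    fib c = count-push {E = sub (VE N) (_∈S perp b)} {F = sub (VE N) (λ v → f v ≗V c)}
      (λ { (w , w∈) → w +V lincomb c u , λ i → trans (R.f-+ (b i) w (lincomb c u))
           (trans (cong₂ _+_ (⌊⌋-true⁻ (perp? b w) w∈ i) (f-shift c i)) (+-identityˡ _)) })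
      (λ r j → cong (_+ lincomb c u j) (r j))
      (λ {x} {y} r j → +-cancelʳ (lincomb c u j) (proj₁ x j) (proj₁ y j) (r j))
      (λ { (v , e) → (v +V ((- 1#) ·V lincomb c u) ,
             ⌊⌋-true (perp? b _) (λ i → trans (R.f-+ (b i) v ((- 1#) ·V lincomb c u))
               (trans (cong₂ _+_ (e i) (trans (R.f-· (b i) (- 1#) (lincomb c u)) (cong ((- 1#) *_) (f-shift c i)))) (x+-1*x (c i))))) ,
           λ j → trans (+-assoc (v j) _ _) (trans (cong (v j +_) (trans (+-comm _ _) (x+-1*x (lincomb c u j)))) (+-identityʳ (v j))) })
      kernel-count
    product : q ^ m ℕ.* kernelSize ≡ q ^ N
    product = count-unique (VE N)
      (count-fibration (VE N) (VE m) f (λ e i → R.f-cong (b i) e) (count-Vect m) kernelSize fib) (count-Vect N)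
    instance
      q-nonZero : ℕ.NonZero q
      q-nonZero = ℕ.>-nonZero (ℕP.<-trans ℕP.0<1+n 1<q)
    q^-nonZero : ∀ n → ℕ.NonZero (q ^ n)
    q^-nonZero n = ℕP.m^n≢0 q n
    -- Needed because `N ∸ m` is truncated: q^m times the nonzero kernel size is q^N, so q^m cannot
    -- exceed q^N.
    m≤N : m ℕ.≤ N
    m≤N = ℕP.≮⇒≥ (λ N<m → ℕP.<⇒≱ (ℕP.^-monoʳ-< q 1<q N<m) (subst (q ^ m ℕ.≤_) product
      (ℕP.m≤m*n (q ^ m) kernelSize {{ℕ.≢-nonZero (λ k≡0 → ℕ.≢-nonZero⁻¹ (q ^ N) {{q^-nonZero N}} (trans (sym product) (trans (cong (q ^ m ℕ.*_) k≡0) (ℕP.*-zeroʳ (q ^ m)))))}})))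
    size : kernelSize ≡ q ^ (N ∸ m)
    size = ℕP.*-cancelˡ-≡ kernelSize (q ^ (N ∸ m)) (q ^ m) {{q^-nonZero m}} (trans product
      (trans (cong (q ^_) (sym (ℕP.m+[n∸m]≡n m≤N))) (ℕP.^-distribˡ-+-* q m (N ∸ m))))

  isotropic : Class N
  isotropic = record
    { C = Isotropic ω
    ; adm = λ b → ∀ i j → ⟨ b i , b j ⟩ ≡ 0#
    ; adm-resp = λ {_} {b} {b′} e ad i j → trans (sym (trans (L.f-cong (b j) (e i)) (R.f-cong (b′ i) (e j)))) (ad i j)
    ; adm-nil = λ _ ()
    ; adm-tail = λ ad i j → ad (Fin.suc i) (Fin.suc j)
    ; C⇒adm = λ S b iso b∈ i j → iso (b i) (b j) (b∈ i) (b∈ j)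
    ; adm⇒C = λ b ad → isotropic-span b ad
    ; ext = perp
    ; ext⇒adm = λ { b v ad v∈ Fin.zero Fin.zero → alt v
                  ; b v ad v∈ Fin.zero (Fin.suc j) → orth-sym (b j) v (⌊⌋-true⁻ (perp? b v) v∈ j)
                  ; b v ad v∈ (Fin.suc i) Fin.zero → ⌊⌋-true⁻ (perp? b v) v∈ i
                  ; b v ad v∈ (Fin.suc i) (Fin.suc j) → ad i j }
    ; adm⇒ext = λ b v ad → ⌊⌋-true (perp? b v) (λ i → ad (Fin.suc i) Fin.zero)
    ; basis⊆ext = λ b ad i → ⌊⌋-true (perp? b (b i)) (λ j → ad j i)
    ; A = λ l → q ^ (N ∸ l)
    ; ext-count = λ b ind _ → count-perp b ind
    }
    where
    isotropic-span : (b : Fin m → Vect N) → (∀ i j → ⟨ b i , b j ⟩ ≡ 0#) → Isotropic ω (span b)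
    isotropic-span b ad x y x∈ y∈ =
      let c , e = span-elim b x∈; c′ , e′ = span-elim b y∈ in
      trans (sym (trans (L.f-cong (lincomb c′ b) e) (R.f-cong x e′)))
        (trans (L.f-lincomb (lincomb c′ b) c b) (∑-zero (λ i → trans (cong (c i *_)
          (trans (R.f-lincomb (b i) c′ b) (∑-zero (λ j → trans (cong (c′ j *_) (ad i j)) (zeroʳ (c′ j))))))
          (zeroʳ (c i)))))

  count-isotropic : ∀ j i → j ℕ.+ i ≡ d → ∣ Class.MemberE isotropic j ∣≡ qb j i ℕ.* ρ φ± j i
  count-isotropic j i e = count-members isotropic j (qb j i ℕ.* ρ φ± j i) (begin
    qb j i ℕ.* ρ φ± j i ℕ.* X          ≡⟨ lem (qb j i) (ρ φ± j i) X ⟩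
    qb j i ℕ.* X ℕ.* ρ φ± j i          ≡⟨ cong (ℕ._* ρ φ± j i) (trans (frames-subspaces 1<q j i) (cong (λ n → frames (λ _ → q ^ n) j) e)) ⟩
    frames (λ _ → q ^ d) j ℕ.* ρ φ± j i ≡⟨ sym (frames-isotropic 1<q j i d e) ⟩
    frames (λ l → q ^ (N ∸ l)) j       ∎)
    where
    X = frames (λ _ → q ^ j) j
    lem : ∀ a b c → a ℕ.* b ℕ.* c ≡ a ℕ.* c ℕ.* b
    lem = solve-∀

  -- The orthogonal of an isotropic d-frame has q^(2d-d) = q^d elements, just as many as its span.
  isotropic-dimension-≤ : ∀ m → Class.Member isotropic m → m ℕ.≤ d
  isotropic-dimension-≤ = dimension-≤ isotropic d (cong (q ^_) (trans (cong (λ z → d ℕ.+ z ∸ d) (ℕP.+-identityʳ d)) (ℕP.m+n∸m≡n d d)))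

anti-sumF : ∀ (f : ℕ → ℕ → ℕ) D → anti f D ≡ sumF {suc D} (λ j → f (toℕ j) (D ∸ toℕ j))
anti-sumF f zero    = sym (ℕP.+-identityʳ _)
anti-sumF f (suc D) = cong (f 0 (suc D) ℕ.+_) (anti-sumF (λ k l → f (suc k) l) D)

count-fibresℕ : ∀ {A : Set} (E : Equiv A) (g : A → ℕ) → (∀ {a b} → a ≈[ E ] b → g a ≡ g b) →
  ∀ D → (∀ a → g a ℕ.≤ D) → (c : ℕ → ℕ) → (∀ j → j ℕ.≤ D → ∣ sub E (λ a → g a ≡ j) ∣≡ c j) → ∣ E ∣≡ sumF {suc D} (c ∘ toℕ)
count-fibresℕ E g resp D bound c fib = count-fibres E f
  (λ r → FP.toℕ-injective (trans (f-spec _) (trans (resp r) (sym (f-spec _))))) (c ∘ toℕ)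
  (λ i → count-push {E = sub E (λ a → g a ≡ toℕ i)} {F = sub E (λ a → f a ≡ i)}
    (λ { (a , e) → a , FP.toℕ-injective (trans (f-spec a) e) }) id id
    (λ { (a , e) → (a , trans (sym (f-spec a)) (cong toℕ e)) , Equiv.rfl E })
    (fib (toℕ i) (ℕP.≤-pred (FP.toℕ<n i))))
  where
  f = λ a → Fin.fromℕ< (ℕ.s≤s (bound a))
  f-spec : ∀ a → toℕ (f a) ≡ g a
  f-spec a = FP.toℕ-fromℕ< (ℕ.s≤s (bound a))

-- Flags as multichains of isotropic subspaces.

module Flags (K : Field) (q : ℕ) (enum : Fin q ↔ Field.Carrier K)
  (d : ℕ) (ω : LinAlg.Form K (2 ℕ.* d)) (alt : LinAlg.Alternating K ω) (nondeg : LinAlg.NonDegenerate K ω) where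
  open Field K using (Carrier; 0≢1; inverse)
  open LinAlg K
  open LinearAlgebra K
  open FiniteField q enum
  open QBinomial q
  open Frames K q enum
  open Symplectic K q enum d ω alt nondeg

  -- The multiplicity of an entry is suc w.
  record Entry : Set where
    constructor entry
    field
      S      : Subspace N
      dim    : ℕ
      hasDim : HasDim S dim
      nz     : NonZeroSub S
      iso    : Isotropic ω S
      w      : ℕ
  open Entry

  -- Flags are listed from the largest subspace down.
  StrictlyBelow : Subspace N → List Entry → Set
  StrictlyBelow T []      = ⊤
  StrictlyBelow T (e ∷ l) = (S e ⊂S T) × StrictlyBelow (S e) l

  Chain : List Entry → Set
  Chain []      = ⊤
  Chain (e ∷ l) = StrictlyBelow (S e) l

  wt : List Entry → ℕ
  wt []      = 0
  wt (e ∷ l) = suc (w e) ℕ.* dim e ℕ.+ wt l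

  _≋_ : List Entry → List Entry → Set
  []      ≋ []        = ⊤
  []      ≋ (_ ∷ _)   = ⊥
  (_ ∷ _) ≋ []        = ⊥
  (e ∷ l) ≋ (e′ ∷ l′) = SameSub (S e) (S e′) × w e ≡ w e′ × l ≋ l′

  ≋-equiv : Equiv (List Entry)
  ≋-equiv = record { _≈_ = _≋_ ; rfl = λ {l} → r l ; symm = λ {l} {l′} → s l l′ ; trns = λ {l} {l′} {l″} → t l l′ l″ }
    where
    r : ∀ l → l ≋ l
    r []      = tt
    r (e ∷ l) = (λ _ → refl) , refl , r l
    s : ∀ l l′ → l ≋ l′ → l′ ≋ l
    s []      []        _           = tt
    s (e ∷ l) (e′ ∷ l′) (p , o , h) = (λ v → sym (p v)) , sym o , s l l′ h
    t : ∀ l l′ l″ → l ≋ l′ → l′ ≋ l″ → l ≋ l″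
    t []      []        []        _           _              = tt
    t (e ∷ l) (e′ ∷ l′) (e″ ∷ l″) (p , o , h) (p′ , o′ , h′) = (λ v → trans (p v) (p′ v)) , trans o o′ , t l l′ l″ h h′

  Flag : ℕ → Set
  Flag n = Σ (List Entry) λ l → Chain l × wt l ≡ n

  FlagE : ∀ n → Equiv (Flag n)
  FlagE n = pull proj₁ ≋-equiv

  TopIn : (Subspace N → Set) → List Entry → Set
  TopIn C []      = ⊤
  TopIn C (e ∷ l) = C (S e)

  topDim : List Entry → ℕ
  topDim []      = 0
  topDim (e ∷ l) = dim e

  HasDim-resp : {T T′ : Subspace N} → SameSub T T′ → ∀ {m} → HasDim T m → HasDim T′ m
  HasDim-resp r (b , b∈ , ind , sp) = b , (λ i → trans (sym (r (b i))) (b∈ i)) , ind , λ v v∈ → sp v (trans (r v) v∈)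

  topDim-resp : ∀ l l′ → l ≋ l′ → topDim l ≡ topDim l′
  topDim-resp []      []        _       = refl
  topDim-resp (e ∷ l) (e′ ∷ l′) (p , _) = HasDim-unique (S e′) (HasDim-resp {S e} {S e′} p (hasDim e)) (hasDim e′)

  NonZeroSub⇒0<dim : {T : Subspace N} → ∀ {m} → HasDim T m → NonZeroSub T → 0 ℕ.< m
  NonZeroSub⇒0<dim {m = zero}  (b , _ , _ , sp) (v , v∈ , v≢0) = ⊥-elim (v≢0 (λ j → proj₂ (sp v v∈) j))
  NonZeroSub⇒0<dim {m = suc m} _ _ = ℕ.s≤s ℕ.z≤n

  0<dim⇒NonZeroSub : {T : Subspace N} → ∀ {m} → HasDim T (suc m) → NonZeroSub T
  0<dim⇒NonZeroSub (b , b∈ , ind , _) = b Fin.zero , b∈ Fin.zero , λ b₀≡0 →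
    0≢1 (sym (ind (δ Fin.zero) (λ j → trans (trans (∑-cong (λ l → *-comm (δ Fin.zero l) (b l j))) (∑-δ (λ l → b l j) Fin.zero)) (b₀≡0 j)) Fin.zero))

  dim≤wt : ∀ e l → dim e ℕ.≤ wt (e ∷ l)
  dim≤wt e l = ℕP.≤-trans (ℕP.m≤m+n (dim e) (w e ℕ.* dim e)) (ℕP.m≤m+n _ (wt l))

  ⊂-resp : {T U U′ : Subspace N} → SameSub U U′ → T ⊂S U → T ⊂S U′
  ⊂-resp r (h , v , v∈ , v∉) = (λ x x∈ → trans (sym (r x)) (h x x∈)) , v , trans (sym (r v)) v∈ , v∉

  ⊂-trans : {T U W : Subspace N} → T ⊂S U → U ⊂S W → T ⊂S W
  ⊂-trans (h , v , v∈ , v∉) (h′ , _) = (λ x x∈ → h′ x (h x x∈)) , v , h′ v v∈ , v∉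

  ⊂-intro : (T U : Subspace N) → T ⊆S U → ¬ SameSub T U → T ⊂S U
  ⊂-intro T U h ne with count-any? (VE N) (count-Vect N) {P = λ v → (v ∈S U) × ¬ (v ∈S T)}
    (λ {u} {v} e p → ∈S-resp U e (proj₁ p) , λ v∈ → proj₂ p (∈S-resp T (λ i → sym (e i)) v∈))
    (λ v → (mem U v BP.≟ true) ×-dec (¬? (mem T v BP.≟ true)))
  ... | yes (v , p) = h , v , p
  ... | no ¬p = ⊥-elim (ne (⊆-antisym T U h (λ v v∈ → decidable-stable (mem T v BP.≟ true) (λ v∉ → ¬p (v , v∈ , v∉)))))

  StrictlyBelow-resp : {T T′ : Subspace N} → SameSub T T′ → ∀ l → StrictlyBelow T l → StrictlyBelow T′ l
  StrictlyBelow-resp r []      _        = tt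
  StrictlyBelow-resp {T} {T′} r (e ∷ l) (p , sb) = ⊂-resp {S e} {T} {T′} r p , sb

  StrictlyBelow⇒Chain : ∀ {T} l → StrictlyBelow T l → Chain l
  StrictlyBelow⇒Chain []      _        = tt
  StrictlyBelow⇒Chain (e ∷ l) (_ , sb) = sb

  -- Removes one copy of the largest subspace from the multichain. `w` is one less than the
  -- multiplicity, so at `zero` the last copy disappears together with its entry.
  decr : List Entry → List Entry
  decr [] = []
  decr (entry S dim hasDim nz iso zero    ∷ l) = l
  decr (entry S dim hasDim nz iso (suc w) ∷ l) = entry S dim hasDim nz iso w ∷ l

  decr-Chain : ∀ l → Chain l → Chain (decr l)
  decr-Chain [] _ = tt
  decr-Chain (entry _ _ _ _ _ zero    ∷ l) c = StrictlyBelow⇒Chain l c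
  decr-Chain (entry _ _ _ _ _ (suc w) ∷ l) c = c

  wt-decr : ∀ e l → wt (e ∷ l) ≡ dim e ℕ.+ wt (decr (e ∷ l))
  wt-decr (entry _ n _ _ _ zero)    l = cong (ℕ._+ wt l) (ℕP.+-identityʳ n)
  wt-decr (entry _ n _ _ _ (suc w)) l = ℕP.+-assoc n (n ℕ.+ w ℕ.* n) (wt l)

  decr-resp : ∀ l l′ → l ≋ l′ → decr l ≋ decr l′
  decr-resp [] [] _ = tt
  decr-resp (entry _ _ _ _ _ zero    ∷ l) (entry _ _ _ _ _ zero    ∷ l′) (p , e , h) = h
  decr-resp (entry _ _ _ _ _ (suc w) ∷ l) (entry _ _ _ _ _ (suc w′) ∷ l′) (p , e , h) = p , ℕP.suc-injective e , h

  ⊂⇒≉ : {T U : Subspace N} → T ⊂S U → ¬ SameSub T U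
  ⊂⇒≉ (_ , v , v∈ , v∉) r = v∉ (trans (r v) v∈)

  -- If the top disappears on one side only, the next subspace there would have to equal the common
  -- top, which strict inclusion excludes.
  decr-injective : ∀ e l e′ l′ → StrictlyBelow (S e) l → StrictlyBelow (S e′) l′ → SameSub (S e) (S e′) →
    decr (e ∷ l) ≋ decr (e′ ∷ l′) → (e ∷ l) ≋ (e′ ∷ l′)
  decr-injective (entry _ _ _ _ _ zero)    l (entry _ _ _ _ _ zero)     l′ _ _ p h = p , refl , h
  decr-injective (entry _ _ _ _ _ (suc w)) l (entry _ _ _ _ _ (suc w′)) l′ _ _ p (_ , o , h) = p , cong suc o , h
  decr-injective (entry T _ _ _ _ zero)    (f ∷ l) (entry T′ _ _ _ _ (suc w′)) l′ (f⊂ , _) _ p (p′ , _) =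
    ⊥-elim (⊂⇒≉ {S f} {T} f⊂ (λ v → trans (p′ v) (sym (p v))))
  decr-injective (entry T _ _ _ _ (suc w)) l (entry T′ _ _ _ _ zero) (f ∷ l′) _ (f⊂ , _) p (p′ , _) =
    ⊥-elim (⊂⇒≉ {S f} {T′} f⊂ (λ v → trans (sym (p′ v)) (p v)))

  decr-below : ∀ (T : Subspace N) e l → StrictlyBelow (S e) l → SameSub (S e) T → TopIn (_⊆S T) (decr (e ∷ l))
  decr-below T (entry _ _ _ _ _ (suc w)) l       _             p = λ v v∈ → trans (sym (p v)) v∈
  decr-below T (entry _ _ _ _ _ zero)    []      _             p = tt
  decr-below T (entry _ _ _ _ _ zero)    (f ∷ l) ((h , _) , _) p = λ v v∈ → trans (sym (p v)) (h v v∈)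

  Under : (T : Subspace N) → ∀ n → Equiv (Σ (Flag n) λ F → TopIn (_⊆S T) (proj₁ F))
  Under T n = sub (FlagE n) (λ F → TopIn (_⊆S T) (proj₁ F))

  -- Removing one copy of the top subspace T leaves a flag inside T whose weight is smaller by dim
  -- T, and every such flag arises exactly once. The class of possible tops is a parameter because
  -- the argument is applied both inside an isotropic subspace and to the whole symplectic space.
  module Tops (𝒞 : Class N) (C⇒iso : ∀ {T} → Class.C 𝒞 T → Isotropic ω T)
    (D : ℕ) (bound : ∀ m → Class.Member 𝒞 m → m ℕ.≤ D)
    (n# : ℕ → ℕ → ℕ) (n#-0 : ∀ i → n# 0 i ≡ 1) (count-C : ∀ j i → j ℕ.+ i ≡ D → ∣ Class.MemberE 𝒞 j ∣≡ n# j i)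
    (s : ℕ) (below : ∀ n → n ℕ.≤ s → ∀ T k → HasDim T k → Isotropic ω T → ∣ Under T n ∣≡ V 𝟙 s k n)
    (n : ℕ) (n≤1+s : n ℕ.≤ suc s) where

    open Class 𝒞 using (C; Member; MemberE)

    XE = sub (FlagE n) (λ F → TopIn C (proj₁ F))

    dimOf : Σ (Flag n) (λ F → TopIn C (proj₁ F)) → ℕ
    dimOf ((l , _) , _) = topDim l

    dimOf≤D : ∀ x → dimOf x ℕ.≤ D
    dimOf≤D (([] , _) , _)    = ℕ.z≤n
    dimOf≤D ((e ∷ l , _) , c) = bound (dim e) (S e , hasDim e , c)

    LevelE : ∀ j → Equiv (Σ (Σ (Flag n) (λ F → TopIn C (proj₁ F))) (λ x → dimOf x ≡ j))
    LevelE j = sub XE (λ x → dimOf x ≡ j)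

    no-zero-dim : ∀ e → ¬ (dim e ≡ 0)
    no-zero-dim e eq = ℕP.<⇒≢ (NonZeroSub⇒0<dim {S e} (hasDim e) (nz e)) (sym eq)

    count-empty-flag : ∣ LevelE 0 ∣≡ oneS n
    count-empty-flag with n ℕP.≟ 0
    ... | yes refl = (λ _ → (([] , tt , refl) , tt) , refl) , (λ { Fin.zero Fin.zero _ → refl }) ,
      λ { ((([] , _) , _) , _) → Fin.zero , tt ; (((e ∷ l , _) , _) , eq) → ⊥-elim (no-zero-dim e eq) }
    ... | no n≢0 = subst (∣ LevelE 0 ∣≡_) (oneS-0 n n≢0) (count-empty (LevelE 0)
      (λ { ((([] , _ , eq) , _) , _) → n≢0 (sym eq) ; (((e ∷ l , _) , _) , eq) → no-zero-dim e eq }))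
      where
      oneS-0 : ∀ m → ¬ (m ≡ 0) → 0 ≡ oneS m
      oneS-0 zero    h = ⊥-elim (h refl)
      oneS-0 (suc m) h = refl

    module Positive (j : ℕ) (n′ : ℕ) (n≡ : n ≡ suc j ℕ.+ n′) where

      top : Σ (Σ (Flag n) (λ F → TopIn C (proj₁ F))) (λ x → dimOf x ≡ suc j) → Member (suc j)
      top (((e ∷ l , _) , c) , eq) = S e , subst (HasDim (S e)) eq (hasDim e) , c

      top-resp : ∀ x y → proj₁ (proj₁ (proj₁ x)) ≋ proj₁ (proj₁ (proj₁ y)) → SameSub (proj₁ (top x)) (proj₁ (top y))
      top-resp (((e ∷ l , _) , _) , _) (((e′ ∷ l′ , _) , _) , _) (p , _) = p

      FibreE : (T : Subspace N) → Equiv (Σ _ λ x → SameSub (proj₁ (top x)) T)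
      FibreE T = sub (LevelE (suc j)) (λ x → SameSub (proj₁ (top x)) T)

      lower : (T : Subspace N) → (Σ _ λ x → SameSub (proj₁ (top x)) T) → Σ (Flag n′) λ F → TopIn (_⊆S T) (proj₁ F)
      lower T ((((e ∷ l , ch , eq) , c) , refl) , p) =
        (decr (e ∷ l) , decr-Chain (e ∷ l) ch , ℕP.+-cancelˡ-≡ (suc j) _ _ (trans (sym (wt-decr e l)) (trans eq n≡))) ,
        decr-below T e l ch p

      lower-resp : ∀ T x y → proj₁ (proj₁ (proj₁ (proj₁ x))) ≋ proj₁ (proj₁ (proj₁ (proj₁ y))) →
        proj₁ (proj₁ (lower T x)) ≋ proj₁ (proj₁ (lower T y))
      lower-resp T ((((e ∷ l , _) , _) , refl) , _) ((((e′ ∷ l′ , _) , _) , refl) , _) h = decr-resp (e ∷ l) (e′ ∷ l′) h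

      lower-injective : ∀ T x y → proj₁ (proj₁ (lower T x)) ≋ proj₁ (proj₁ (lower T y)) →
        proj₁ (proj₁ (proj₁ (proj₁ x))) ≋ proj₁ (proj₁ (proj₁ (proj₁ y)))
      lower-injective T ((((e ∷ l , ch , _) , _) , refl) , p) ((((e′ ∷ l′ , ch′ , _) , _) , e″) , p′) h with e″
      ... | refl = decr-injective e l e′ l′ ch ch′ (λ v → trans (p v) (sym (p′ v))) h

      lower-surjective : ∀ T (h : HasDim T (suc j)) → C T → (y : Σ (Flag n′) λ F → TopIn (_⊆S T) (proj₁ F)) → Σ (Σ _ λ x → SameSub (proj₁ (top x)) T) λ x →
        proj₁ (proj₁ (lower T x)) ≋ proj₁ (proj₁ y)
      lower-surjective T h c (([] , _ , eq) , _) =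
        ((((entry T (suc j) h (0<dim⇒NonZeroSub {T} h) (C⇒iso c) 0 ∷ [] , tt ,
            trans (cong (ℕ._+ 0) (ℕP.+-identityʳ (suc j))) (trans (cong (suc j ℕ.+_) eq) (sym n≡))) , c) , refl) , λ _ → refl) , tt
      -- One copy of `T` is put back: a top equal to `T` gains multiplicity, otherwise `T` becomes a
      -- new, strictly larger top of multiplicity one.
      lower-surjective T h c ((e ∷ l , ch , eq) , e⊆T) with SameSub? (S e) T
      ... | yes p =
        ((((E ∷ l , StrictlyBelow-resp p l ch ,
            trans (wt-decr E l) (trans (cong (λ z → suc j ℕ.+ (suc (w e) ℕ.* z ℕ.+ wt l)) dims)
              (trans (cong (suc j ℕ.+_) eq) (sym n≡)))) , c) , refl) , λ _ → refl) ,
        (λ v → sym (p v)) , refl , Equiv.rfl ≋-equiv {l}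
        where
        E = entry T (suc j) h (0<dim⇒NonZeroSub {T} h) (C⇒iso c) (suc (w e))
        dims : suc j ≡ dim e
        dims = HasDim-unique T h (HasDim-resp {S e} {T} p (hasDim e))
      ... | no ne =
        ((((E ∷ e ∷ l , (⊂-intro (S e) T e⊆T ne , ch) ,
            trans (wt-decr E (e ∷ l)) (trans (cong (suc j ℕ.+_) eq) (sym n≡))) , c) , refl) , λ _ → refl) ,
        Equiv.rfl ≋-equiv {e ∷ l}
        where
        E = entry T (suc j) h (0<dim⇒NonZeroSub {T} h) (C⇒iso c) 0

      -- The removed subspace has dimension at least one, so the weight falls under the bound for
      -- which `below` is available.
      n′≤s : n′ ℕ.≤ s
      n′≤s = ℕP.≤-trans (ℕP.m≤n+m n′ j) (ℕP.≤-pred (subst (ℕ._≤ suc s) n≡ n≤1+s))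

      count-level : ∀ i → suc j ℕ.+ i ≡ D → ∣ LevelE (suc j) ∣≡ n# (suc j) i ℕ.* V 𝟙 s (suc j) n′
      count-level i e = count-fibration (LevelE (suc j)) (MemberE (suc j)) top (λ {x} {y} → top-resp x y)
        (count-C (suc j) i e) (V 𝟙 s (suc j) n′)
        (λ { (T , h , c) → count-pull {E = FibreE T} {F = Under T n′} (lower T)
          (λ {x} {y} → lower-resp T x y) (λ {x} {y} → lower-injective T x y) (lower-surjective T h c)
          (below n′ n′≤s T (suc j) h (C⇒iso c)) })

    count-level : ∀ j → j ℕ.≤ D → ∣ LevelE j ∣≡ n# j (D ∸ j) ℕ.* sh j (V 𝟙 s j) n
    count-level zero _ = subst (∣ LevelE 0 ∣≡_)
      (sym (trans (cong₂ ℕ._*_ (n#-0 D) (V-0 𝟙 s n)) (ℕP.*-identityˡ (oneS n)))) count-empty-flag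
    count-level (suc j) le with suc j ℕP.≤? n
    ... | yes j<n = subst (λ z → ∣ LevelE (suc j) ∣≡ n# (suc j) (D ∸ suc j) ℕ.* z)
      (sym (sh-∸ (suc j) (V 𝟙 s (suc j)) n j<n))
      (Positive.count-level j (n ∸ suc j) (sym (ℕP.m+[n∸m]≡n j<n)) (D ∸ suc j) (ℕP.m+[n∸m]≡n le))
    ... | no j≮n = subst (∣ LevelE (suc j) ∣≡_)
      (sym (trans (cong (n# (suc j) (D ∸ suc j) ℕ.*_) (sh-small (suc j) (V 𝟙 s (suc j)) n (ℕP.≰⇒> j≮n))) (ℕP.*-zeroʳ (n# (suc j) (D ∸ suc j)))))
      (count-empty (LevelE (suc j)) (λ { (((e ∷ l , _ , eq) , _) , eq′) →
        j≮n (subst₂ ℕ._≤_ eq′ eq (dim≤wt e l)) }))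

    count-flags-in : ∣ XE ∣≡ anti (λ m i → n# m i ℕ.* sh m (V 𝟙 s m) n) D
    count-flags-in = subst (∣ XE ∣≡_) (sym (anti-sumF (λ m i → n# m i ℕ.* sh m (V 𝟙 s m) n) D))
      (count-fibresℕ XE dimOf (λ {x} {y} → topDim-resp (proj₁ (proj₁ x)) (proj₁ (proj₁ y))) D dimOf≤D
        (λ j → n# j (D ∸ j) ℕ.* sh j (V 𝟙 s j) n) count-level)

  -- The bound s on the weight is also the largest letter, so the induction on s runs parallel to
  -- `V-bottom`, where lowering the letters replaces `suc s` by `s`. The factor is `𝟙` because every
  -- subspace of `T` is isotropic.
  count-under : ∀ s n → n ℕ.≤ s → ∀ T k → HasDim T k → Isotropic ω T → ∣ Under T n ∣≡ V 𝟙 s k n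
  count-under zero .zero ℕ.z≤n T k h iso = (λ _ → ([] , tt , refl) , tt) , (λ { Fin.zero Fin.zero _ → refl }) ,
    λ { (([] , _) , _) → Fin.zero , tt
      ; ((e ∷ l , _ , eq) , _) → ⊥-elim (ℕP.<⇒≱ (NonZeroSub⇒0<dim {S e} (hasDim e) (nz e)) (subst (dim e ℕ.≤_) eq (dim≤wt e l))) }
  count-under (suc s) n n≤1+s T k h iso = subst (∣ Under T n ∣≡_)
    (sym (trans (V-bottom 𝟙 s k n) (anti-cong′ k (λ m i → sym (ℕP.*-assoc (qb m i) (ρ 𝟙 m i) _)))))
    (Tops.count-flags-in (within T h) (λ {U} U⊆ x y x∈ y∈ → iso x y (U⊆ x x∈) (U⊆ y y∈)) k
      (dimension-≤ (within T h) k refl) (λ m i → qb m i ℕ.* ρ 𝟙 m i) (λ _ → refl)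
      (λ j i e → subst (∣ Class.MemberE (within T h) j ∣≡_) (sym (trans (cong (qb j i ℕ.*_) (ρ-𝟙 j i)) (ℕP.*-identityʳ (qb j i)))) (count-within T h j i e))
      s (count-under s) n n≤1+s)

  -- Only the choice of the top involves the symplectic space, whence a single application of
  -- `V-bottom` with `φ±`; everything below takes place inside the top.
  count-flags : ∀ n → ∣ FlagE n ∣≡ V φ± (suc n) d n
  count-flags n = subst (∣ FlagE n ∣≡_)
    (sym (trans (V-bottom φ± n d n) (anti-cong′ d (λ m i → sym (ℕP.*-assoc (qb m i) (ρ φ± m i) _)))))
    (count-push {E = sub (FlagE n) (λ F → TopIn (Isotropic ω) (proj₁ F))} {F = FlagE n} proj₁ id id
      (λ { F@([] , _) → (F , tt) , Equiv.rfl ≋-equiv {proj₁ F} ; F@(e ∷ l , _) → (F , iso e) , Equiv.rfl ≋-equiv {proj₁ F} })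
      (Tops.count-flags-in isotropic id d isotropic-dimension-≤ (λ m i → qb m i ℕ.* ρ φ± m i) (λ _ → refl)
        count-isotropic n (count-under n) n (ℕP.n≤1+n n)))

-- Reversal of indices and passage to weighted flags.

opposite-fromℕ : ∀ n → opposite (fromℕ n) ≡ Fin.zero
opposite-fromℕ zero    = refl
opposite-fromℕ (suc n) = cong inject₁ (opposite-fromℕ n)

opposite-inject₁ : ∀ {n} (i : Fin n) → opposite (inject₁ i) ≡ Fin.suc (opposite i)
opposite-inject₁ Fin.zero    = refl
opposite-inject₁ (Fin.suc i) = cong inject₁ (opposite-inject₁ i)

opposite-cast : ∀ {m n} (p : m ≡ n) (i : Fin m) → opposite (cast p i) ≡ cast p (opposite i)
opposite-cast refl i = trans (cong opposite (FP.cast-is-id refl i)) (sym (FP.cast-is-id refl (opposite i)))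

opposite-< : ∀ {n} (i j : Fin n) → toℕ i ℕ.< toℕ j → toℕ (opposite j) ℕ.< toℕ (opposite i)
opposite-< {n} i j i<j = subst₂ ℕ._<_ (sym (FP.opposite-prop j)) (sym (FP.opposite-prop i))
  (ℕP.∸-monoʳ-< (ℕ.s≤s i<j) (FP.toℕ<n j))

module WeightedFlags (K : Field) (q : ℕ) (enum : Fin q ↔ Field.Carrier K)
  (d : ℕ) (ω : LinAlg.Form K (2 ℕ.* d)) (alt : LinAlg.Alternating K ω) (nondeg : LinAlg.NonDegenerate K ω) where
  open LinAlg K
  open Symplectic K q enum d ω alt nondeg using (N)
  open Flags K q enum d ω alt nondeg
  open Entry

  ∑ℕ-cong : ∀ {m} {f g : Fin m → ℕ} → (∀ i → f i ≡ g i) → ∑ℕ f ≡ ∑ℕ g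
  ∑ℕ-cong {zero}  h = refl
  ∑ℕ-cong {suc m} h = cong₂ ℕ._+_ (h Fin.zero) (∑ℕ-cong (h ∘ Fin.suc))

  ∑ℕ-last : ∀ {m} (f : Fin (suc m) → ℕ) → ∑ℕ f ≡ f (fromℕ m) ℕ.+ ∑ℕ (f ∘ inject₁)
  ∑ℕ-last {zero}  f = refl
  ∑ℕ-last {suc m} f = trans (cong (f Fin.zero ℕ.+_) (∑ℕ-last (f ∘ Fin.suc))) (lem (f Fin.zero) (f (Fin.suc (fromℕ m))) _)
    where
    lem : ∀ a b c → a ℕ.+ (b ℕ.+ c) ≡ b ℕ.+ (a ℕ.+ c)
    lem = solve-∀

  ∑ℕ-opposite : ∀ {m} (f : Fin m → ℕ) → ∑ℕ (f ∘ opposite) ≡ ∑ℕ f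
  ∑ℕ-opposite {zero}  f = refl
  ∑ℕ-opposite {suc m} f = trans (∑ℕ-last (f ∘ opposite)) (cong₂ ℕ._+_ (cong f (opposite-fromℕ m))
    (trans (∑ℕ-cong (λ i → cong f (opposite-inject₁ i))) (∑ℕ-opposite (f ∘ Fin.suc))))

  weightOf : Entry → ℕ
  weightOf e = suc (w e) ℕ.* dim e

  wt-lookup : ∀ l → ∑ℕ (λ i → weightOf (lookup l i)) ≡ wt l
  wt-lookup []      = refl
  wt-lookup (e ∷ l) = cong (weightOf e ℕ.+_) (wt-lookup l)

  StrictlyBelow-lookup : ∀ T l → StrictlyBelow T l → ∀ i → S (lookup l i) ⊂S T
  StrictlyBelow-lookup T (e ∷ l) (p , sb) Fin.zero    = p
  StrictlyBelow-lookup T (e ∷ l) (p , sb) (Fin.suc i) = ⊂-trans {S (lookup l i)} {S e} {T} (StrictlyBelow-lookup (S e) l sb i) p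

  Chain-lookup : ∀ l → Chain l → ∀ i j → toℕ i ℕ.< toℕ j → S (lookup l j) ⊂S S (lookup l i)
  Chain-lookup (e ∷ l) c Fin.zero    (Fin.suc j) _           = StrictlyBelow-lookup (S e) l c j
  Chain-lookup (e ∷ l) c (Fin.suc i) (Fin.suc j) (ℕ.s≤s i<j) = Chain-lookup l (StrictlyBelow⇒Chain l c) i j i<j

  -- A `WFlag` increases whereas the lists decrease, so every index passes through `opposite`.
  toWFlag : ∀ {n} → Flag n → WFlag ω n
  toWFlag (l , c , e) = record
    { k       = length l
    ; V       = λ i → S (at i)
    ; w       = λ i → suc (w (at i))
    ; dims    = λ i → dim (at i)
    ; w-pos   = λ _ → ℕ.s≤s ℕ.z≤n
    ; hasDim  = λ i → hasDim (at i)
    ; nonzero = λ i → nz (at i)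
    ; iso     = λ i → iso (at i)
    ; incr    = λ i j i<j → Chain-lookup l c (opposite j) (opposite i) (opposite-< i j i<j)
    ; weight  = trans (∑ℕ-opposite (λ i → weightOf (lookup l i))) (trans (wt-lookup l) e)
    }
    where
    at : Fin (length l) → Entry
    at i = lookup l (opposite i)

  ≋-from-lookup : ∀ l l′ (p : length l ≡ length l′) →
    (∀ i → SameSub (S (lookup l i)) (S (lookup l′ (cast p i))) × w (lookup l i) ≡ w (lookup l′ (cast p i))) → l ≋ l′
  ≋-from-lookup []      []        p h = tt
  ≋-from-lookup (e ∷ l) (e′ ∷ l′) p h = proj₁ (h Fin.zero) , proj₂ (h Fin.zero) ,
    ≋-from-lookup l l′ (ℕP.suc-injective p) (λ i → h (Fin.suc i))

  toWFlag-injective : ∀ {n} (F F′ : Flag n) → SameFlag (toWFlag F) (toWFlag F′) → proj₁ F ≋ proj₁ F′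
  toWFlag-injective (l , _) (l′ , _) (p , h) = ≋-from-lookup l l′ p pointwise
    where
    index : ∀ i → opposite (cast p (opposite i)) ≡ cast p i
    index i = trans (opposite-cast p (opposite i)) (cong (cast p) (FP.opposite-involutive i))
    pointwise : ∀ i → SameSub (S (lookup l i)) (S (lookup l′ (cast p i))) × w (lookup l i) ≡ w (lookup l′ (cast p i))
    pointwise i = subst₂ (λ a b → SameSub (S (lookup l a)) (S (lookup l′ b)) × w (lookup l a) ≡ w (lookup l′ b))
      (FP.opposite-involutive i) (index i)
      (proj₁ (h (opposite i)) , ℕP.suc-injective (proj₂ (h (opposite i))))

  Chain-tabulate : ∀ {k} (f : Fin k → Entry) → (∀ i j → toℕ i ℕ.< toℕ j → S (f j) ⊂S S (f i)) → Chain (tabulate f)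
  Chain-tabulate {zero}        f h = tt
  Chain-tabulate {suc zero}    f h = tt
  Chain-tabulate {suc (suc k)} f h =
    h Fin.zero (Fin.suc Fin.zero) (ℕ.s≤s ℕ.z≤n) ,
    Chain-tabulate (f ∘ Fin.suc) (λ i j i<j → h (Fin.suc i) (Fin.suc j) (ℕ.s≤s i<j))

  wt-tabulate : ∀ {k} (f : Fin k → Entry) → wt (tabulate f) ≡ ∑ℕ (λ i → weightOf (f i))
  wt-tabulate {zero}  f = refl
  wt-tabulate {suc k} f = cong (weightOf (f Fin.zero) ℕ.+_) (wt-tabulate (f ∘ Fin.suc))

  ≋-tabulate : ∀ {k} (f : Fin k → Entry) l → l ≋ tabulate f → Σ (length l ≡ k) λ p →
    ∀ i → SameSub (S (lookup l i)) (S (f (cast p i))) × w (lookup l i) ≡ w (f (cast p i))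
  ≋-tabulate {zero}  f []      _           = refl , λ ()
  ≋-tabulate {suc k} f (e ∷ l) (s , o , h) = let p , r = ≋-tabulate (f ∘ Fin.suc) l h in
    cong suc p , λ { Fin.zero → s , o ; (Fin.suc i) → r i }

  module _ {n} (F : WFlag ω n) where
    private module F = WFlag F

    entryAt : Fin F.k → Entry
    entryAt i = entry (F.V i) (F.dims i) (F.hasDim i) (F.nonzero i) (F.iso i) (ℕ.pred (F.w i))

    suc-pred-w : ∀ i → suc (ℕ.pred (F.w i)) ≡ F.w i
    suc-pred-w i = ℕP.suc-pred (F.w i) {{ℕ.>-nonZero (F.w-pos i)}}

    fromWFlag : Flag n
    fromWFlag = tabulate (entryAt ∘ opposite) ,
      Chain-tabulate (entryAt ∘ opposite) (λ i j i<j → F.incr (opposite j) (opposite i) (opposite-< i j i<j)) ,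
      trans (wt-tabulate (entryAt ∘ opposite)) (trans (∑ℕ-opposite (weightOf ∘ entryAt))
        (trans (∑ℕ-cong (λ i → cong (ℕ._* F.dims i) (suc-pred-w i))) F.weight))

    -- Stated for every `G` equivalent to `fromWFlag`, since an enumeration of flags reaches
    -- `fromWFlag` only up to `≋`.
    toWFlag-fromWFlag : (G : Flag n) → proj₁ G ≋ proj₁ fromWFlag → SameFlag (toWFlag G) F
    toWFlag-fromWFlag (l , _) h = p , λ i →
      let j = opposite i
          index : opposite (cast p j) ≡ cast p i
          index = trans (opposite-cast p j) (cong (cast p) (FP.opposite-involutive i)) in
      subst (λ a → SameSub (S (lookup l j)) (F.V a)) index (proj₁ (r j)) ,
      trans (cong suc (proj₂ (r j))) (trans (suc-pred-w (opposite (cast p j))) (cong F.w index))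
      where
      p = proj₁ (≋-tabulate (entryAt ∘ opposite) l h)
      r = proj₂ (≋-tabulate (entryAt ∘ opposite) l h)

  count-WFlags : ∀ n {c} → ∣ FlagE n ∣≡ c → HasCount (WFlag ω n) SameFlag c
  count-WFlags n (e , inj , sur) = toWFlag ∘ e ,
    (λ i j h → inj i j (toWFlag-injective (e i) (e j) h)) ,
    λ F → let i , r = sur (fromWFlag F) in i , toWFlag-fromWFlag F (e i) r

open import Data.Nat using (_*_)

theorem3p2 : (q : ℕ) → IsPrimePower q → ¬ (2 ∣ q)
    → (K : Field) → Fin q ↔ Field.Carrier K
    → (d : ℕ) → (ω : LinAlg.Form K (2 * d))
    → LinAlg.Alternating K ω → LinAlg.NonDegenerate K ω
    → (n : ℕ) → HasCount (LinAlg.WFlag K ω n) (LinAlg.SameFlag K) (rhsSeries q d n)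
theorem3p2 q _ _ K enum d ω alt nondeg n =
  -- The flags and the signed permutations have both been evaluated to `V φ± (suc n) d n`.
  subst (HasCount (LinAlg.WFlag K ω n) (LinAlg.SameFlag K)) (sym (PermutationSums.rhsSeries≡V q d n))
    (WeightedFlags.count-WFlags K q enum d ω alt nondeg n (Flags.count-flags K q enum d ω alt nondeg n))
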